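{- Let $r, n \in \mathbb N$ with $n \ge 2$, $(n,r) \notin \{(2,1),(2,2),(3,1)\}$, and $r \le \max\{2, (n+2)/6\}$. Let $G$ be an abelian group such that $\mathcal L(G) = \mathcal L(C_n^r)$. Then $G \cong C_n^r$.
   Context: For an additive abelian group $G$, a sequence over $G$ is an element $S = g_1 \cdot \ldots \cdot g_\ell$ of the free abelian monoid $\mathcal F(G)$ with basis $G$; its sum is $\sigma(S) = g_1 + \ldots + g_\ell$. The monoid of zero-sum sequences is $\mathcal B(G) = \{S \in \mathcal F(G) \mid \sigma(S) = 0\}$; its irreducible elements (atoms) are the minimal zero-sum sequences. For $B \in \mathcal B(G)$, the set of lengths $\mathsf L(B)$ is the set of all $k$ such that $B = A_1 \cdot \ldots \cdot A_k$ with atoms $A_1, \ldots, A_k$ (with $\mathsf L(B) = \{0\}$ if $B$ is the empty sequence), and $\mathcal L(G) = \{\mathsf L(B) \mid B \in \mathcal B(G)\}$ is the system of sets of lengths. $C_n^r$ denotes the direct sum of $r$ copies of the cyclic group of order $n$. -}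

module Defs where

open import Level using (Level; _⊔_)
open import Data.Nat using (ℕ; NonZero; _+_)
open import Data.Nat.DivMod using (_mod_)
open import Data.Fin using (Fin; toℕ)
open import Data.List using (List; []; _∷_; _++_; concat; length; foldr)
open import Data.List.Relation.Unary.All using (All)
open import Data.List.Relation.Binary.Permutation.Homogeneous using (Permutation)
open import Data.Product using (Σ; _×_; ∃-syntax)
open import Data.Sum using (_⊎_)
open import Function.Bundles using (_⇔_)
open import Relation.Binary.PropositionalEquality using (_≡_)
open import Algebra.Bundles using (RawMonoid)
open import Algebra.Bundles.Raw using ()

module Lengths {c ℓ : Level} (G : RawMonoid c ℓ) where
  open RawMonoid G

  -- Sequences over G: elements of the free abelian monoid F(G),
  -- represented by lists, compared up to permutation (modulo ≈).
  Seq : Set c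
  Seq = List Carrier

  _≋_ : Seq → Seq → Set (c ⊔ ℓ)
  _≋_ = Permutation _≈_

  σ : Seq → Carrier
  σ = foldr _∙_ ε

  ZeroSum : Seq → Set ℓ
  ZeroSum S = σ S ≈ ε

  -- atoms of B(G): irreducible elements (the only unit of B(G) is the empty sequence)
  Atom : Seq → Set (c ⊔ ℓ)
  Atom A = ZeroSum A × (A ≡ [] → Data.Empty.⊥) ×
           (∀ U V → ZeroSum U → ZeroSum V → A ≋ (U ++ V) → U ≡ [] ⊎ V ≡ [])
    where import Data.Empty

  _∈L_ : ℕ → Seq → Set (c ⊔ ℓ)
  k ∈L B = Σ (List Seq) λ As → All Atom As × length As ≡ k × B ≋ concat As

_⊆ℒ_ : {c₁ ℓ₁ c₂ ℓ₂ : Level} → RawMonoid c₁ ℓ₁ → RawMonoid c₂ ℓ₂ → Set (c₁ ⊔ ℓ₁ ⊔ c₂ ⊔ ℓ₂)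
G ⊆ℒ H = ∀ (B : LG.Seq) → LG.ZeroSum B →
           ∃[ B′ ] (LH.ZeroSum B′ × (∀ k → (k LG.∈L B) ⇔ (k LH.∈L B′)))
  where
  module LG = Lengths G
  module LH = Lengths H

_≡ℒ_ : {c₁ ℓ₁ c₂ ℓ₂ : Level} → RawMonoid c₁ ℓ₁ → RawMonoid c₂ ℓ₂ → Set (c₁ ⊔ ℓ₁ ⊔ c₂ ⊔ ℓ₂)
G ≡ℒ H = (G ⊆ℒ H) × (H ⊆ℒ G)

_+ₙ_ : {n : ℕ} .{{_ : NonZero n}} → Fin n → Fin n → Fin n
_+ₙ_ {n} a b = (toℕ a + toℕ b) mod n

Cⁿʳ : (n r : ℕ) .{{_ : NonZero n}} → RawMonoid Level.zero Level.zero
Cⁿʳ n r = record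
  { Carrier = Fin r → Fin n
  ; _≈_ = λ x y → ∀ i → x i ≡ y i
  ; _∙_ = λ x y i → x i +ₙ y i
  ; ε = λ _ → 0 mod n
  }

{-# OPTIONS --safe #-}
-- Sequences over a finite family G of group elements are written as exponent vectors x, and Fact G x k says that x is a
-- product of k atoms.  Suppose that all lengths of each sequence over G are congruent modulo d, and that some sequence has
-- lengths p < q.  Passing to large powers and discarding elements of bounded multiplicity, one finds a family with the same d
-- and elasticity at least q / p in every group (with finitely many elements) whose system of sets of lengths contains ℒ(⟨G⟩).
--
-- Let n be the exponent and wt x = Σ xᵢ n / ord gᵢ, so that g ^ ord g has weight n and every length k of x satisfies
-- n k ≡ wt x modulo d.  If 2 d ≥ n - 1 and two lengths differ, some atom has weight below n: a heavy atom whose support is minimal would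
-- yield d + 1 independent elements of equal order.  Such a light atom is squarefree of weight n - d over elements of order n,
-- and all but one of its n - d elements are independent.  In C_n^r, the atom (-e₁ - … - eᵣ) e₁ ⋯ eᵣ realizes d = n - r - 1.
-- Hence the other group contains C_n^r once its exponent is known to be n (from d = n - 2) and the d + 1 independent elements
-- are excluded by their elasticity.  Since the largest length l with L(B) ∋ 2, l determines the Davenport constant, which
-- agrees for both groups, the containment is an equality.  The groups C_4, C_3^2 and C_4^2 need separate arguments.
module Submission where

open import Defs
open import Level using (Level; _⊔_)
open import Data.Nat hiding (_/_; _%_)
open import Data.Nat.Properties
open import Data.Nat.Divisibility
open import Data.Nat.DivMod using (_/_; _%_; m≡m%n+[m/n]*n; m%n<n; _mod_)
open import Data.Nat.GCD using (gcd; gcd[m,n]∣m; gcd[m,n]∣n; gcd-greatest; module Bézout; gcd-GCD; gcd[m,n]≢0)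
open import Data.Nat.Coprimality using (Coprime; coprime-divisor; gcd≡1⇒coprime)
import Data.Fin.Properties as FinP
open import Data.Nat.Tactic.RingSolver using (solve-∀)
open import Data.Fin as Fin using (Fin; zero; suc; toℕ)
open import Data.Bool using (Bool; true; false; if_then_else_; _∧_; _xor_)
open import Data.Vec as Vec using (Vec; []; _∷_; lookup; zipWith; replicate)
import Data.Vec.Properties as VecP
open import Data.List as List using (List; []; _∷_; _++_; length; foldr; cartesianProductWith; upTo)
import Data.List.Properties as ListP
open import Data.List.Relation.Unary.All as All using (All; []; _∷_)
import Data.List.Relation.Unary.All.Properties as AllP
open import Data.List.Relation.Unary.Any as Any using (Any; here; there)
open import Data.List.Membership.Propositional using (_∈_; find; lose)
import Data.List.Membership.Propositional.Properties as MemP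
open import Data.Product using (_×_; _,_; proj₁; proj₂; ∃; ∃₂; ∃-syntax)
open import Data.Sum using (_⊎_; inj₁; inj₂; [_,_]′)
open import Data.Empty using (⊥; ⊥-elim)
open import Function using (_∘_; id; case_of_)
open import Relation.Nullary
open import Relation.Binary.Definitions using (tri<; tri≈; tri>)
open import Relation.Nullary.Decidable using (_×-dec_; _⊎-dec_; ¬?; map′; True; toWitness; decidable-stable)
open import Relation.Binary.PropositionalEquality using (_≡_; _≢_; refl; sym; trans; cong; cong₂; subst; subst₂; module ≡-Reasoning)
open import Algebra.Bundles using (AbelianGroup)
open import Algebra.Morphism.Structures using (module MonoidMorphisms)
import Algebra.Properties.CommutativeMonoid.Mult
import Algebra.Properties.CommutativeSemigroup
import Algebra.Properties.AbelianGroup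
import Relation.Binary.Reasoning.Setoid
import Data.List.Relation.Binary.Permutation.Setoid
import Data.List.Relation.Binary.Permutation.Setoid.Properties
open import Function.Bundles using (_⇔_; module Equivalence; mk⇔)
open import Data.Nat.Induction using (<-rec)

-- Neither finiteness nor decidable equality of the given group is assumed; both are read off from
-- lengths: `g (-g)` has length 1 or 2 according as `g` is nonzero or zero, and a bounded Davenport
-- constant lets the group be enumerated. Whether a subfamily has uniform lengths remains undecided,
-- so passage between groups is only doubly negated; this suffices, because the existence of r
-- independent elements of order n can be decided by search in an enumerated group. The bound 2 d ≥
-- n - 1 comes from light atoms: their weight is n - j d and at least 2, so j = 1. If d + 1 elements
-- of order P are independent, adjoining their sum gives a family with difference d and lengths P
-- and 1 + (P - 1)(d + 1), too elastic for C_n^r when r ≥ 2. For r = 1 and P = 2 the ratio is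
-- exactly the admissible n / 2. For n ≥ 5 the difference n - 3 helps, as it would force rank 2 in
-- C_n; for C_4 the obstruction is a set containing the lengths 3, 5 and 6. For C_3^2 and C_4^2 the
-- difference n - r - 1 is too small for the weight argument, and zero-sum free sequences of length
-- r (n - 1) take its place.

private variable
  t s : ℕ
  a b : Level

-- Congruence of natural numbers

-- Multiples are added on both sides, so that no subtraction occurs and symmetry is immediate;
-- `d = 0` gives equality.
Cong : ℕ → ℕ → ℕ → Set
Cong d k l = ∃₂ λ a b → k + a * d ≡ l + b * d

cong-refl : ∀ {d k} → Cong d k k
cong-refl = 0 , 0 , refl

cong-≡ : ∀ {d k l} → k ≡ l → Cong d k l
cong-≡ refl = cong-refl

cong-sym : ∀ {d k l} → Cong d k l → Cong d l k
cong-sym (a , b , e) = b , a , sym e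

cong-+ : ∀ {d k l k′ l′} → Cong d k l → Cong d k′ l′ → Cong d (k + k′) (l + l′)
cong-+ {d} {k} {l} {k′} {l′} (a , b , e) (a′ , b′ , e′) = a + a′ , b + b′ , (begin
  k + k′ + (a + a′) * d          ≡⟨ shuffle k k′ a a′ d ⟩
  (k + a * d) + (k′ + a′ * d)    ≡⟨ cong₂ _+_ e e′ ⟩
  (l + b * d) + (l′ + b′ * d)    ≡⟨ shuffle l l′ b b′ d ⟨
  l + l′ + (b + b′) * d          ∎)
  where
  open ≡-Reasoning
  shuffle : ∀ k k′ a a′ d → k + k′ + (a + a′) * d ≡ (k + a * d) + (k′ + a′ * d)
  shuffle = solve-∀

cong-trans : ∀ {d k l m} → Cong d k l → Cong d l m → Cong d k m
cong-trans {d} {k} {l} {m} (a , b , e) (a′ , b′ , e′) = a + a′ , b + b′ , (begin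
  k + (a + a′) * d         ≡⟨ sh₁ k a a′ d ⟩
  (k + a * d) + a′ * d     ≡⟨ cong (_+ a′ * d) e ⟩
  (l + b * d) + a′ * d     ≡⟨ sh₂ l b a′ d ⟩
  (l + a′ * d) + b * d     ≡⟨ cong (_+ b * d) e′ ⟩
  (m + b′ * d) + b * d     ≡⟨ sh₃ m b b′ d ⟩
  m + (b + b′) * d         ∎)
  where
  open ≡-Reasoning
  sh₁ : ∀ k a a′ d → k + (a + a′) * d ≡ (k + a * d) + a′ * d
  sh₁ = solve-∀
  sh₂ : ∀ l b a d → (l + b * d) + a * d ≡ (l + a * d) + b * d
  sh₂ = solve-∀
  sh₃ : ∀ m b b′ d → (m + b′ * d) + b * d ≡ m + (b + b′) * d
  sh₃ = solve-∀

cong-cancelˡ : ∀ {d} m {k l} → Cong d (m + k) (m + l) → Cong d k l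
cong-cancelˡ {d} m {k} {l} (a , b , e) = a , b ,
  +-cancelˡ-≡ m _ _ (trans (sym (+-assoc m k (a * d))) (trans e (+-assoc m l (b * d))))

cong-< : ∀ {d k l} → Cong d k l → k < l → ∃ λ j → l ≡ k + suc j * d
cong-< {d} {k} {l} (a , b , e) k<l with a ≤? b
... | yes a≤b = ⊥-elim (<-irrefl e (+-mono-<-≤ k<l (*-monoˡ-≤ d a≤b)))
... | no a≰b with ≰⇒> a≰b
... | b<a with m≤n⇒∃[o]m+o≡n b<a
... | j , refl = j , +-cancelʳ-≡ (b * d) _ _ (trans (sym e) (sh k b j d))
  where
  sh : ∀ k b j d → k + (suc b + j) * d ≡ k + suc j * d + b * d
  sh = solve-∀

-- The form in which uniform lengths are exploited throughout: a factorization that is strictly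
-- shorter than another is shorter by at least `d`.
cong-gap : ∀ {d k l} → Cong d k l → k < l → k + d ≤ l
cong-gap {d} {k} c k<l with cong-< c k<l
... | j , refl = +-monoʳ-≤ k (m≤m+n d (j * d))

cong-0⇒∣ : ∀ {o m} → Cong o m 0 → o ∣ m
cong-0⇒∣ {o} {m} (a , b , e) = ∣m+n∣m⇒∣n (subst (o ∣_) (trans (sym e) (+-comm m (a * o))) (n∣m*n b)) (n∣m*n a)

cong-unique : ∀ {d k l} → k < d → l < d → Cong d k l → k ≡ l
cong-unique {d} {k} {l} k<d l<d c with <-cmp k l
... | tri< k<l _ _ = ⊥-elim (<⇒≱ l<d (≤-trans (m≤n+m d k) (cong-gap c k<l)))
... | tri≈ _ e _   = e
... | tri> _ _ l<k = ⊥-elim (<⇒≱ k<d (≤-trans (m≤n+m d l) (cong-gap (cong-sym c) l<k)))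

∣⇒cong-0 : ∀ {o m} → o ∣ m → Cong o m 0
∣⇒cong-0 {o} {m} (divides q e) = 0 , q , trans (+-identityʳ m) e

cong-∣ : ∀ {o k l} → Cong o k l → o ∣ k → o ∣ l
cong-∣ c o∣k = cong-0⇒∣ (cong-trans (cong-sym c) (∣⇒cong-0 o∣k))

-- Exponent vectors

infixl 6 _⊕_
infixl 7 _·_
infix 4 _⊑_

_⊕_ : Vec ℕ t → Vec ℕ t → Vec ℕ t
_⊕_ = zipWith _+_

𝟘 𝟙 : Vec ℕ t
𝟘 = replicate _ 0
𝟙 = replicate _ 1

_·_ : ℕ → Vec ℕ t → Vec ℕ t
c · x = Vec.map (c *_) x

size : Vec ℕ t → ℕ
size = Vec.sum

single : Fin t → ℕ → Vec ℕ t
single zero    c = c ∷ 𝟘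
single (suc i) c = 0 ∷ single i c

_⊑_ : Vec ℕ t → Vec ℕ t → Set
u ⊑ x = ∃ λ v → x ≡ u ⊕ v

⊕-assoc : (x y z : Vec ℕ t) → x ⊕ y ⊕ z ≡ x ⊕ (y ⊕ z)
⊕-assoc = VecP.zipWith-assoc +-assoc

⊕-comm : (x y : Vec ℕ t) → x ⊕ y ≡ y ⊕ x
⊕-comm = VecP.zipWith-comm +-comm

⊕-identityˡ : (x : Vec ℕ t) → 𝟘 ⊕ x ≡ x
⊕-identityˡ = VecP.zipWith-identityˡ +-identityˡ

⊕-identityʳ : (x : Vec ℕ t) → x ⊕ 𝟘 ≡ x
⊕-identityʳ = VecP.zipWith-identityʳ +-identityʳ

⊕-cancelˡ : (x : Vec ℕ t) {y z : Vec ℕ t} → x ⊕ y ≡ x ⊕ z → y ≡ z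
⊕-cancelˡ []       {[]}    {[]}    _ = refl
⊕-cancelˡ (a ∷ x)  {b ∷ y} {c ∷ z} e =
  cong₂ _∷_ (+-cancelˡ-≡ a b c (VecP.∷-injectiveˡ e)) (⊕-cancelˡ x (VecP.∷-injectiveʳ e))

⊕-swap : (x y z : Vec ℕ t) → x ⊕ (y ⊕ z) ≡ y ⊕ (x ⊕ z)
⊕-swap x y z = trans (sym (⊕-assoc x y z)) (trans (cong (_⊕ z) (⊕-comm x y)) (⊕-assoc y x z))

⊕-𝟘 : (u v : Vec ℕ t) → u ⊕ v ≡ 𝟘 → u ≡ 𝟘
⊕-𝟘 []      []      e = refl
⊕-𝟘 (a ∷ u) (b ∷ v) e =
  cong₂ _∷_ (m+n≡0⇒m≡0 a (VecP.∷-injectiveˡ e)) (⊕-𝟘 u v (VecP.∷-injectiveʳ e))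

lookup-⊕ : (x y : Vec ℕ t) (i : Fin t) → lookup (x ⊕ y) i ≡ lookup x i + lookup y i
lookup-⊕ x y i = VecP.lookup-zipWith _+_ i x y

lookup-𝟘 : (i : Fin t) → lookup 𝟘 i ≡ 0
lookup-𝟘 i = VecP.lookup-replicate i 0

lookup-𝟙 : (i : Fin t) → lookup 𝟙 i ≡ 1
lookup-𝟙 i = VecP.lookup-replicate i 1

lookup-· : (c : ℕ) (x : Vec ℕ t) (i : Fin t) → lookup (c · x) i ≡ c * lookup x i
lookup-· c x i = VecP.lookup-map i (c *_) x

vec-ext : {A : Set a} {x y : Vec A t} → (∀ i → lookup x i ≡ lookup y i) → x ≡ y
vec-ext {x = []}    {[]}    e = refl
vec-ext {x = _ ∷ _} {_ ∷ _} e = cong₂ _∷_ (e zero) (vec-ext (e ∘ suc))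

lookup-single : (i : Fin t) (c : ℕ) → lookup (single i c) i ≡ c
lookup-single zero    c = refl
lookup-single (suc i) c = lookup-single i c

lookup-single-≢ : (i j : Fin t) (c : ℕ) → i ≢ j → lookup (single i c) j ≡ 0
lookup-single-≢ zero    zero    c i≢j = ⊥-elim (i≢j refl)
lookup-single-≢ zero    (suc j) c i≢j = lookup-𝟘 j
lookup-single-≢ (suc i) zero    c i≢j = refl
lookup-single-≢ (suc i) (suc j) c i≢j = lookup-single-≢ i j c (i≢j ∘ cong suc)

size-⊕ : (x y : Vec ℕ t) → size (x ⊕ y) ≡ size x + size y
size-⊕ []      []      = refl
size-⊕ (a ∷ x) (b ∷ y) = trans (cong (a + b +_) (size-⊕ x y)) (sh a b (size x) (size y))
  where
  sh : ∀ a b c d → (a + b) + (c + d) ≡ (a + c) + (b + d)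
  sh = solve-∀

size-𝟘 : ∀ t → size (𝟘 {t}) ≡ 0
size-𝟘 zero    = refl
size-𝟘 (suc t) = size-𝟘 t

size-𝟙 : ∀ t → size (𝟙 {t}) ≡ t
size-𝟙 zero    = refl
size-𝟙 (suc t) = cong suc (size-𝟙 t)

size-0 : (x : Vec ℕ t) → size x ≡ 0 → x ≡ 𝟘
size-0 []      e = refl
size-0 (a ∷ x) e = cong₂ _∷_ (m+n≡0⇒m≡0 a e) (size-0 x (m+n≡0⇒n≡0 a e))

size-pos : (x : Vec ℕ t) → x ≢ 𝟘 → 0 < size x
size-pos x x≢𝟘 with size x in e
... | zero  = ⊥-elim (x≢𝟘 (size-0 x e))
... | suc _ = s≤s z≤n

lookup≤size : (x : Vec ℕ t) (i : Fin t) → lookup x i ≤ size x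
lookup≤size (a ∷ x) zero    = m≤m+n a (size x)
lookup≤size (a ∷ x) (suc i) = ≤-trans (lookup≤size x i) (m≤n+m (size x) a)

size-single : (i : Fin t) (c : ℕ) → size (single i c) ≡ c
size-single {suc t} zero    c = trans (cong (c +_) (size-𝟘 t)) (+-identityʳ c)
size-single         (suc i) c = size-single i c

size-bound : (x : Vec ℕ t) (c : ℕ) → (∀ i → lookup x i ≤ c) → size x ≤ t * c
size-bound []      c h = z≤n
size-bound (a ∷ x) c h = +-mono-≤ (h zero) (size-bound x c (h ∘ suc))

_≟ᵛ_ : (x y : Vec ℕ t) → Dec (x ≡ y)
_≟ᵛ_ = VecP.≡-dec _≟_

nonzero-coordinate : (x : Vec ℕ t) → x ≢ 𝟘 → ∃ λ i → 0 < lookup x i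
nonzero-coordinate []            x≢𝟘 = ⊥-elim (x≢𝟘 refl)
nonzero-coordinate (zero  ∷ x)   x≢𝟘 with nonzero-coordinate x (x≢𝟘 ∘ cong (0 ∷_))
... | i , p = suc i , p
nonzero-coordinate (suc a ∷ x)   x≢𝟘 = zero , s≤s z≤n

0·x : (x : Vec ℕ t) → 0 · x ≡ 𝟘
0·x []      = refl
0·x (a ∷ x) = cong (0 ∷_) (0·x x)

suc· : ∀ c (x : Vec ℕ t) → suc c · x ≡ x ⊕ c · x
suc· c []      = refl
suc· c (a ∷ x) = cong (_ ∷_) (suc· c x)

⊑-trans : {x y z : Vec ℕ t} → x ⊑ y → y ⊑ z → x ⊑ z
⊑-trans {x = x} (u , refl) (v , refl) = u ⊕ v , ⊕-assoc x u v

⊑⇒≤ : {x y : Vec ℕ t} → x ⊑ y → ∀ i → lookup x i ≤ lookup y i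
⊑⇒≤ {x = x} (v , refl) i = subst (lookup x i ≤_) (sym (lookup-⊕ x v i)) (m≤m+n _ _)

abstract
  ≤⇒⊑ : (x y : Vec ℕ t) → (∀ i → lookup x i ≤ lookup y i) → x ⊑ y
  ≤⇒⊑ []      []      h = [] , refl
  ≤⇒⊑ (a ∷ x) (b ∷ y) h with ≤⇒⊑ x y (h ∘ suc)
  ... | v , e = b ∸ a ∷ v , cong₂ _∷_ (sym (m+[n∸m]≡n (h zero))) e

⊑-size : {x y : Vec ℕ t} → x ⊑ y → size x ≤ size y
⊑-size {x = x} (v , refl) = subst (size x ≤_) (sym (size-⊕ x v)) (m≤m+n _ _)

abstract
  single-⊑ : (i : Fin t) (c : ℕ) (x : Vec ℕ t) → c ≤ lookup x i → single i c ⊑ x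
  single-⊑ i c x c≤ = ≤⇒⊑ _ _ h
    where
    h : ∀ j → lookup (single i c) j ≤ lookup x j
    h j with i Fin.≟ j
    ... | yes refl = subst (_≤ lookup x i) (sym (lookup-single i c)) c≤
    ... | no i≢j   = subst (_≤ lookup x j) (sym (lookup-single-≢ i j c i≢j)) z≤n

below : Vec ℕ t → List (Vec ℕ t)
below []      = [] ∷ []
below (a ∷ x) = cartesianProductWith _∷_ (upTo (suc a)) (below x)

below-complete : (u x : Vec ℕ t) → (∀ i → lookup u i ≤ lookup x i) → u ∈ below x
below-complete []      []      h = here refl
below-complete (b ∷ u) (a ∷ x) h =
  MemP.∈-cartesianProductWith⁺ _∷_ (MemP.∈-upTo⁺ (s≤s (h zero))) (below-complete u x (h ∘ suc))

below-sound : (u x : Vec ℕ t) → u ∈ below x → ∀ i → lookup u i ≤ lookup x i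
below-sound u       (a ∷ x) m i with MemP.∈-cartesianProductWith⁻ _∷_ (upTo (suc a)) (below x) m
below-sound (b ∷ u) (a ∷ x) m zero    | _ , _ , b∈ , u∈ , refl = s≤s⁻¹ (MemP.∈-upTo⁻ b∈)
below-sound (b ∷ u) (a ∷ x) m (suc i) | _ , _ , b∈ , u∈ , refl = below-sound u x u∈ i

abstract
  search-below : {P : Vec ℕ t → Set a} → (∀ u → Dec (P u)) → (x : Vec ℕ t) →
    (∃ λ u → (∀ i → lookup u i ≤ lookup x i) × P u) ⊎ (∀ u → (∀ i → lookup u i ≤ lookup x i) → ¬ P u)
  search-below P? x with Any.any? P? (below x)
  ... | yes p with find p
  ... | u , u∈ , pu = inj₁ (u , below-sound u x u∈ , pu)
  search-below P? x | no ¬p = inj₂ λ u h pu → ¬p (lose (below-complete u x h) pu)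

-- Subfamilies and supports

mask-size : Vec Bool t → ℕ
mask-size []          = 0
mask-size (true  ∷ m) = suc (mask-size m)
mask-size (false ∷ m) = mask-size m

restrict : {A : Set a} (m : Vec Bool t) → Vec A t → Vec A (mask-size m)
restrict []          []      = []
restrict (true  ∷ m) (x ∷ v) = x ∷ restrict m v
restrict (false ∷ m) (x ∷ v) = restrict m v

extend : (m : Vec Bool t) → Vec ℕ (mask-size m) → Vec ℕ t
extend []          []      = []
extend (true  ∷ m) (x ∷ v) = x ∷ extend m v
extend (false ∷ m) v       = 0 ∷ extend m v

extend-⊕ : (m : Vec Bool t) (u v : Vec ℕ (mask-size m)) → extend m (u ⊕ v) ≡ extend m u ⊕ extend m v
extend-⊕ []          []      []      = refl
extend-⊕ (true  ∷ m) (x ∷ u) (y ∷ v) = cong (_ ∷_) (extend-⊕ m u v)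
extend-⊕ (false ∷ m) u       v       = cong (0 ∷_) (extend-⊕ m u v)

extend-𝟘 : (m : Vec Bool t) → extend m 𝟘 ≡ 𝟘
extend-𝟘 []          = refl
extend-𝟘 (true  ∷ m) = cong (0 ∷_) (extend-𝟘 m)
extend-𝟘 (false ∷ m) = cong (0 ∷_) (extend-𝟘 m)

extend-injective : (m : Vec Bool t) {u v : Vec ℕ (mask-size m)} → extend m u ≡ extend m v → u ≡ v
extend-injective []          {[]}    {[]}    e = refl
extend-injective (true  ∷ m) {x ∷ u} {y ∷ v} e =
  cong₂ _∷_ (VecP.∷-injectiveˡ e) (extend-injective m (VecP.∷-injectiveʳ e))
extend-injective (false ∷ m)                 e = extend-injective m (VecP.∷-injectiveʳ e)

-- A sum of natural numbers vanishes only if both summands do, so factors of a sequence over a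
-- subfamily stay in the subfamily. Hence atoms and factorizations are the same over the subfamily
-- and over the whole family.
extend-⊕⁻¹ : (m : Vec Bool t) (x : Vec ℕ (mask-size m)) (u v : Vec ℕ t) → extend m x ≡ u ⊕ v →
  ∃₂ λ u′ v′ → u ≡ extend m u′ × v ≡ extend m v′
extend-⊕⁻¹ []          []      []      []      e = [] , [] , refl , refl
extend-⊕⁻¹ (true  ∷ m) (x ∷ y) (a ∷ u) (b ∷ v) e
  with extend-⊕⁻¹ m y u v (VecP.∷-injectiveʳ e)
... | u′ , v′ , refl , refl = a ∷ u′ , b ∷ v′ , refl , refl
extend-⊕⁻¹ (false ∷ m) x       (a ∷ u) (b ∷ v) e
  with extend-⊕⁻¹ m x u v (VecP.∷-injectiveʳ e)
... | u′ , v′ , refl , refl = u′ , v′ ,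
  cong (_∷ _) (m+n≡0⇒m≡0 a (sym (VecP.∷-injectiveˡ e))) ,
  cong (_∷ _) (m+n≡0⇒n≡0 a (sym (VecP.∷-injectiveˡ e)))

size-extend : (m : Vec Bool t) (x : Vec ℕ (mask-size m)) → size (extend m x) ≡ size x
size-extend []          []      = refl
size-extend (true  ∷ m) (x ∷ v) = cong (x +_) (size-extend m v)
size-extend (false ∷ m) v       = size-extend m v

support : Vec ℕ t → Vec Bool t
support []          = []
support (zero  ∷ x) = false ∷ support x
support (suc _ ∷ x) = true ∷ support x

extend-support : (x : Vec ℕ t) → extend (support x) (restrict (support x) x) ≡ x
extend-support []          = refl
extend-support (zero  ∷ x) = cong (0 ∷_) (extend-support x)
extend-support (suc a ∷ x) = cong (suc a ∷_) (extend-support x)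

restrict-support-pos : (x : Vec ℕ t) (i : Fin (mask-size (support x))) →
  0 < lookup (restrict (support x) x) i
restrict-support-pos (zero  ∷ x) i       = restrict-support-pos x i
restrict-support-pos (suc a ∷ x) zero    = s≤s z≤n
restrict-support-pos (suc a ∷ x) (suc i) = restrict-support-pos x i

extend-support-pos : (x : Vec ℕ t) (y : Vec ℕ (mask-size (support x))) (i : Fin t) →
  0 < lookup (extend (support x) y) i → 0 < lookup x i
extend-support-pos (zero  ∷ x) y       (suc i) p = extend-support-pos x y i p
extend-support-pos (suc a ∷ x) (b ∷ y) zero    p = s≤s z≤n
extend-support-pos (suc a ∷ x) (b ∷ y) (suc i) p = extend-support-pos x y i p

mask-size-≤ : (m : Vec Bool t) → mask-size m ≤ t
mask-size-≤ []          = z≤n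
mask-size-≤ (true  ∷ m) = s≤s (mask-size-≤ m)
mask-size-≤ (false ∷ m) = m≤n⇒m≤1+n (mask-size-≤ m)

mask-size-support-< : (x : Vec ℕ t) (i : Fin t) → lookup x i ≡ 0 → mask-size (support x) < t
mask-size-support-< (zero  ∷ x) i       e = s≤s (mask-size-≤ (support x))
mask-size-support-< (suc a ∷ x) (suc i) e = s≤s (mask-size-support-< x i e)

sumV : List (Vec ℕ t) → Vec ℕ t
sumV = foldr _⊕_ 𝟘

sumV-++ : (us vs : List (Vec ℕ t)) → sumV (us ++ vs) ≡ sumV us ⊕ sumV vs
sumV-++ []       vs = sym (⊕-identityˡ _)
sumV-++ (u ∷ us) vs = trans (cong (u ⊕_) (sumV-++ us vs)) (sym (⊕-assoc u _ _))

zero-coordinate : ∀ {ws} {x : Vec ℕ t} i → sumV ws ≡ x → lookup x i ≡ 0 → All (λ w → lookup w i ≡ 0) ws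
zero-coordinate {ws = []}     i refl e = []
zero-coordinate {ws = w ∷ ws} i refl e = m+n≡0⇒m≡0 _ e′ ∷ zero-coordinate i refl (m+n≡0⇒n≡0 (lookup w i) e′)
  where e′ = trans (sym (lookup-⊕ w (sumV ws) i)) e

-- Zero-sum sequences, atoms and factorizations over a family

module Families {c ℓ} (𝔾 : AbelianGroup c ℓ) where
  open AbelianGroup 𝔾 hiding (_-_) renaming (Carrier to C; refl to ≈-refl; sym to ≈-sym; trans to ≈-trans) public
  open Algebra.Properties.CommutativeMonoid.Mult commutativeMonoid public
    renaming (_×_ to infixr 8 _⊗_) using (×-congʳ; ×-homo-+; ×-homo-1; ×-assocˡ; ×-distrib-+; ×-congˡ)
  module ≈R = Relation.Binary.Reasoning.Setoid setoid

  ⊗-ε : ∀ k → k ⊗ ε ≈ ε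
  ⊗-ε zero    = ≈-refl
  ⊗-ε (suc k) = ≈-trans (identityˡ _) (⊗-ε k)

  eval : Vec C t → Vec ℕ t → C
  eval []      []      = ε
  eval (g ∷ G) (k ∷ x) = k ⊗ g ∙ eval G x

  ∙-interchange : ∀ a b c d → (a ∙ b) ∙ (c ∙ d) ≈ (a ∙ c) ∙ (b ∙ d)
  ∙-interchange = Algebra.Properties.CommutativeSemigroup.interchange commutativeSemigroup

  eval-⊕ : (G : Vec C t) (x y : Vec ℕ t) → eval G (x ⊕ y) ≈ eval G x ∙ eval G y
  eval-⊕ []      []      []      = ≈-sym (identityˡ ε)
  eval-⊕ (g ∷ G) (k ∷ x) (l ∷ y) = ≈-trans
    (∙-cong (×-homo-+ g k l) (eval-⊕ G x y)) (∙-interchange _ _ _ _)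

  eval-𝟘 : (G : Vec C t) → eval G 𝟘 ≈ ε
  eval-𝟘 []      = ≈-refl
  eval-𝟘 (g ∷ G) = ≈-trans (identityˡ _) (eval-𝟘 G)

  eval-· : (G : Vec C t) (k : ℕ) (x : Vec ℕ t) → eval G (k · x) ≈ k ⊗ eval G x
  eval-· []      k []      = ≈-sym (⊗-ε k)
  eval-· (g ∷ G) k (l ∷ x) = ≈-trans
    (∙-cong (≈-sym (×-assocˡ g k l)) (eval-· G k x)) (≈-sym (×-distrib-+ _ _ k))

  eval-single : (G : Vec C t) (i : Fin t) (k : ℕ) → eval G (single i k) ≈ k ⊗ lookup G i
  eval-single (g ∷ G) zero    k = ≈-trans (∙-congˡ (eval-𝟘 G)) (identityʳ _)
  eval-single (g ∷ G) (suc i) k = ≈-trans (identityˡ _) (eval-single G i k)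

  eval-restrict : (m : Vec Bool t) (G : Vec C t) (x : Vec ℕ (mask-size m)) →
    eval G (extend m x) ≈ eval (restrict m G) x
  eval-restrict []          []      []      = ≈-refl
  eval-restrict (true  ∷ m) (g ∷ G) (k ∷ x) = ∙-congˡ (eval-restrict m G x)
  eval-restrict (false ∷ m) (g ∷ G) x       = ≈-trans (identityˡ _) (eval-restrict m G x)

  Zs : Vec C t → Vec ℕ t → Set ℓ
  Zs G x = eval G x ≈ ε

  zs-𝟘 : (G : Vec C t) → Zs G 𝟘
  zs-𝟘 = eval-𝟘

  zs-⊕ : (G : Vec C t) {x y : Vec ℕ t} → Zs G x → Zs G y → Zs G (x ⊕ y)
  zs-⊕ G {x} {y} p q = ≈-trans (eval-⊕ G x y) (≈-trans (∙-cong p q) (identityˡ ε))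

  zs-cancelˡ : (G : Vec C t) (x : Vec ℕ t) {y : Vec ℕ t} → Zs G (x ⊕ y) → Zs G x → Zs G y
  zs-cancelˡ G x {y} p q = begin
    eval G y             ≈⟨ identityˡ _ ⟨
    ε ∙ eval G y         ≈⟨ ∙-congʳ q ⟨
    eval G x ∙ eval G y  ≈⟨ eval-⊕ G x y ⟨
    eval G (x ⊕ y)       ≈⟨ p ⟩
    ε                    ∎
    where open ≈R

  zs-· : (G : Vec C t) (k : ℕ) {x : Vec ℕ t} → Zs G x → Zs G (k · x)
  zs-· G k {x} p = ≈-trans (eval-· G k x) (≈-trans (×-congʳ k p) (⊗-ε k))

  zs-sumV : (G : Vec C t) {xs : List (Vec ℕ t)} → All (Zs G) xs → Zs G (sumV xs)
  zs-sumV G []       = zs-𝟘 G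
  zs-sumV G (p ∷ ps) = zs-⊕ G p (zs-sumV G ps)

  Atom : Vec C t → Vec ℕ t → Set ℓ
  Atom G x = Zs G x × x ≢ 𝟘 × (∀ u v → Zs G u → Zs G v → x ≡ u ⊕ v → u ≡ 𝟘 ⊎ v ≡ 𝟘)

  atom-min : (G : Vec C t) {x u : Vec ℕ t} → Atom G x → Zs G u → u ≢ 𝟘 → u ⊑ x → u ≡ x
  atom-min G {u = u} (zx , _ , irr) zu u≢𝟘 (v , refl) with irr u v zu (zs-cancelˡ G u zx zu) refl
  ... | inj₁ u≡𝟘  = ⊥-elim (u≢𝟘 u≡𝟘)
  ... | inj₂ refl = sym (⊕-identityʳ u)

  Fact : Vec C t → Vec ℕ t → ℕ → Set ℓ
  Fact G x k = ∃ λ ws → All (Atom G) ws × length ws ≡ k × sumV ws ≡ x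

  fact-𝟘 : (G : Vec C t) → Fact G 𝟘 0
  fact-𝟘 G = [] , [] , refl , refl

  fact-atom : (G : Vec C t) {x : Vec ℕ t} → Atom G x → Fact G x 1
  fact-atom G {x} at = x ∷ [] , at ∷ [] , refl , ⊕-identityʳ x

  fact-⊕ : (G : Vec C t) {x y : Vec ℕ t} {k l : ℕ} → Fact G x k → Fact G y l → Fact G (x ⊕ y) (k + l)
  fact-⊕ G (us , aus , refl , refl) (vs , avs , refl , refl) =
    us ++ vs , AllP.++⁺ aus avs , ListP.length-++ us , sumV-++ us vs

  fact-subst : (G : Vec C t) {x y : Vec ℕ t} {k l : ℕ} → x ≡ y → k ≡ l → Fact G x k → Fact G y l
  fact-subst G refl refl f = f

  fact-· : (G : Vec C t) (c : ℕ) {x : Vec ℕ t} {k : ℕ} → Fact G x k → Fact G (c · x) (c * k)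
  fact-· G zero    {x} f = fact-subst G (sym (0·x x)) refl (fact-𝟘 G)
  fact-· G (suc c) {x} f = fact-subst G (sym (suc· c x)) refl (fact-⊕ G f (fact-· G c f))

  fact-zs : (G : Vec C t) {x : Vec ℕ t} {k : ℕ} → Fact G x k → Zs G x
  fact-zs G (ws , aws , _ , refl) = zs-sumV G (All.map proj₁ aws)

  fact-≤-size : (G : Vec C t) {x : Vec ℕ t} {k : ℕ} → Fact G x k → k ≤ size x
  fact-≤-size G (ws , aws , refl , refl) = go aws
    where
    go : ∀ {ws} → All (Atom G) ws → length ws ≤ size (sumV ws)
    go []       = z≤n
    go {w ∷ ws} ((_ , w≢𝟘 , _) ∷ aws) = subst (suc (length ws) ≤_) (sym (size-⊕ w _))
      (+-mono-≤ (size-pos w w≢𝟘) (go aws))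

  fact-0 : (G : Vec C t) {x : Vec ℕ t} {k : ℕ} → Fact G x k → k ≡ 0 → x ≡ 𝟘
  fact-0 G ([] , _ , _ , e) _ = sym e
  fact-0 G (_ ∷ _ , _ , refl , _) ()

  atom-fact : (G : Vec C t) {x : Vec ℕ t} {k : ℕ} → Atom G x → Fact G x k → k ≡ 1
  atom-fact G (_ , x≢𝟘 , _) ([] , _ , _ , refl) = ⊥-elim (x≢𝟘 refl)
  atom-fact G at (w ∷ ws , aw@(zw , w≢𝟘 , _) ∷ aws , refl , refl)
    with atom-min G at zw w≢𝟘 (sumV ws , refl)
  ... | e = cong suc (len ws aws (⊕-cancelˡ w (trans (sym e) (sym (⊕-identityʳ w)))))
    where
    len : ∀ ws → All (Atom G) ws → sumV ws ≡ 𝟘 → length ws ≡ 0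
    len []       _                    e = refl
    len (v ∷ vs) ((_ , v≢𝟘 , _) ∷ _)  e = ⊥-elim (v≢𝟘 (⊕-𝟘 v _ e))

  UL : ℕ → Vec C t → Set ℓ
  UL {t} d G = ∀ (x : Vec ℕ t) k l → Fact G x k → Fact G x l → Cong d k l

  HasLengths : ℕ → ℕ → ℕ → Set (c Level.⊔ ℓ)
  HasLengths d p q = ∃₂ λ t (G : Vec C t) → UL d G × ∃ λ x → Fact G x p × Fact G x q

  atom-extend : (m : Vec Bool t) (G : Vec C t) {x : Vec ℕ (mask-size m)} →
    Atom (restrict m G) x → Atom G (extend m x)
  atom-extend m G {x} (zx , x≢𝟘 , irr) =
    ≈-trans (eval-restrict m G x) zx ,
    (λ e → x≢𝟘 (extend-injective m (trans e (sym (extend-𝟘 m))))) ,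
    irr′
    where
    irr′ : ∀ u v → Zs G u → Zs G v → extend m x ≡ u ⊕ v → u ≡ 𝟘 ⊎ v ≡ 𝟘
    irr′ u v zu zv e with extend-⊕⁻¹ m x u v e
    ... | u′ , v′ , refl , refl
      with irr u′ v′ (≈-trans (≈-sym (eval-restrict m G u′)) zu) (≈-trans (≈-sym (eval-restrict m G v′)) zv)
             (extend-injective m (trans e (sym (extend-⊕ m u′ v′))))
    ... | inj₁ refl = inj₁ (extend-𝟘 m)
    ... | inj₂ refl = inj₂ (extend-𝟘 m)

  atom-extend⁻¹ : (m : Vec Bool t) (G : Vec C t) {x : Vec ℕ (mask-size m)} →
    Atom G (extend m x) → Atom (restrict m G) x
  atom-extend⁻¹ m G {x} (zx , x≢𝟘 , irr) =
    ≈-trans (≈-sym (eval-restrict m G x)) zx ,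
    (λ { refl → x≢𝟘 (extend-𝟘 m) }) ,
    irr′
    where
    irr′ : ∀ u v → Zs (restrict m G) u → Zs (restrict m G) v → x ≡ u ⊕ v → u ≡ 𝟘 ⊎ v ≡ 𝟘
    irr′ u v zu zv refl
      with irr (extend m u) (extend m v) (≈-trans (eval-restrict m G u) zu)
             (≈-trans (eval-restrict m G v) zv) (extend-⊕ m u v)
    ... | inj₁ e = inj₁ (extend-injective m (trans e (sym (extend-𝟘 m))))
    ... | inj₂ e = inj₂ (extend-injective m (trans e (sym (extend-𝟘 m))))

  fact-extend : (m : Vec Bool t) (G : Vec C t) {x : Vec ℕ (mask-size m)} {k : ℕ} →
    Fact (restrict m G) x k → Fact G (extend m x) k
  fact-extend m G (ws , aws , refl , refl) = List.map (extend m) ws ,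
    AllP.map⁺ (All.map (atom-extend m G) aws) , ListP.length-map (extend m) ws , go ws
    where
    go : ∀ ws → sumV (List.map (extend m) ws) ≡ extend m (sumV ws)
    go []       = sym (extend-𝟘 m)
    go (w ∷ ws) = trans (cong (extend m w ⊕_) (go ws)) (sym (extend-⊕ m w (sumV ws)))

  fact-extend⁻¹ : (m : Vec Bool t) (G : Vec C t) {x : Vec ℕ (mask-size m)} {k : ℕ} →
    Fact G (extend m x) k → Fact (restrict m G) x k
  fact-extend⁻¹ m G {x} (ws , aws , refl , e) = go ws aws x (sym e)
    where
    go : ∀ ws → All (Atom G) ws → ∀ x → extend m x ≡ sumV ws → Fact (restrict m G) x (length ws)
    go []       []         x e =
      fact-subst (restrict m G) (sym (extend-injective m (trans e (sym (extend-𝟘 m))))) refl (fact-𝟘 (restrict m G))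
    go (w ∷ ws) (aw ∷ aws) x e with extend-⊕⁻¹ m x w (sumV ws) e
    ... | w′ , x′ , refl , e′ = fact-subst (restrict m G)
      (extend-injective m (trans (extend-⊕ m w′ x′) (trans (cong (extend m w′ ⊕_) (sym e′)) (sym e)))) refl
      (fact-⊕ (restrict m G) (fact-atom (restrict m G) (atom-extend⁻¹ m G aw)) (go ws aws x′ (sym e′)))

  UL-restrict : (m : Vec Bool t) (G : Vec C t) {d : ℕ} → UL d G → UL d (restrict m G)
  UL-restrict m G ul x k l f f′ = ul (extend m x) k l (fact-extend m G f) (fact-extend m G f′)

  -- F is a basis of a subgroup isomorphic to C_P^t
  Indep : ℕ → Vec C t → Set ℓ
  Indep {t} P F = (∀ i → P ⊗ lookup F i ≈ ε) × (∀ x → Zs F x → ∀ i → P ∣ lookup x i)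

  IndepExists : ℕ → ℕ → Set (c Level.⊔ ℓ)
  IndepExists P k = ∃ λ (F : Vec C k) → Indep P F

  indep-tail : ∀ {P g} {G : Vec C t} → Indep P (g ∷ G) → Indep P G
  indep-tail (p , q) = (p ∘ suc) , λ x zx i → q (0 ∷ x) (≈-trans (identityˡ _) zx) (suc i)

  shorten : ∀ {p s} (Q : ∀ {t} → Vec C t → Set p) → (∀ {t g} {G : Vec C t} → Q (g ∷ G) → Q G) →
    s ≤ t → (G : Vec C t) → Q G → ∃ λ (G′ : Vec C s) → Q G′
  shorten {s = s} Q tail s≤t G q with m≤n⇒∃[o]m+o≡n s≤t
  ... | o , refl = go o s G q
    where
    go : ∀ o s (G : Vec C (s + o)) → Q G → ∃ λ (G′ : Vec C s) → Q G′
    go zero    s G q rewrite +-identityʳ s = G , q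
    go (suc o) s G q rewrite +-suc s o with G
    ... | g ∷ G′ = go o s G′ (tail q)

  indep-shorten : ∀ {P s} → s ≤ t → (G : Vec C t) → Indep P G → ∃ λ (G′ : Vec C s) → Indep P G′
  indep-shorten {P = P} = shorten (Indep P) indep-tail

  ⊗-eval : ∀ P (F : Vec C t) → (∀ i → P ⊗ lookup F i ≈ ε) → ∀ x → P ⊗ eval F x ≈ ε
  ⊗-eval P []      h []      = ⊗-ε P
  ⊗-eval P (f ∷ F) h (k ∷ x) = ≈-trans (×-distrib-+ (k ⊗ f) (eval F x) P) (≈-trans (∙-cong
    (≈-trans (×-assocˡ f P k) (≈-trans (×-congˡ (*-comm P k)) (≈-trans (≈-sym (×-assocˡ f k P)) (≈-trans (×-congʳ k (h zero)) (⊗-ε k)))))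
    (⊗-eval P F (h ∘ suc) x)) (identityˡ ε))

  indep-reflects : ∀ {P} .{{_ : NonZero P}} {F : Vec C t} → Indep P F → ∀ u v → eval F u ≈ eval F v →
    ∀ i → Cong P (lookup u i) (lookup v i)
  indep-reflects {P = P} {F} (Pf , ind) u v e i = add (lookup u i) (lookup v i)
      (subst (P ∣_) (trans (lookup-⊕ u (pred P · v) i) (cong (lookup u i +_) (lookup-· (pred P) v i))) (ind (u ⊕ pred P · v) rel i))
    where
    -- `pred P · v` stands for the inverse of `v`, since `P` annihilates the family.
    rel : Zs F (u ⊕ pred P · v)
    rel = ≈-trans (eval-⊕ F u (pred P · v)) (≈-trans (∙-cong e (eval-· F (pred P) v))
      (≈-trans (×-congˡ {eval F v} (suc-pred P)) (⊗-eval P F Pf v)))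
    add : ∀ a b → P ∣ a + pred P * b → Cong P a b
    add a b (divides q eq) = b , q , (begin
      a + b * P                   ≡⟨ cong (a +_) (trans (*-comm b P) (cong (_* b) (sym (suc-pred P)))) ⟩
      a + (b + pred P * b)        ≡⟨ sh a b (pred P * b) ⟩
      b + (a + pred P * b)        ≡⟨ cong (b +_) eq ⟩
      b + q * P                   ∎)
      where
      open ≡-Reasoning
      sh : ∀ a b c → a + (b + c) ≡ b + (a + c)
      sh = solve-∀

  module Decidable (_≟ᵍ_ : ∀ x y → Dec (x ≈ y)) where

    Zs? : (G : Vec C t) (x : Vec ℕ t) → Dec (Zs G x)
    Zs? G x = eval G x ≟ᵍ ε

    abstract
      -- A proper zero-sum factor lies below `x`, so a finite search either finds one or proves
      -- irreducibility.
      split? : (G : Vec C t) (x : Vec ℕ t) → Zs G x →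
        (∃₂ λ u v → Zs G u × Zs G v × x ≡ u ⊕ v × u ≢ 𝟘 × v ≢ 𝟘) ⊎ (x ≢ 𝟘 → Atom G x)
      split? G x zx
        with search-below {P = λ u → Zs G u × u ≢ 𝟘 × u ≢ x} (λ u → Zs? G u ×-dec ¬? (u ≟ᵛ 𝟘) ×-dec ¬? (u ≟ᵛ x)) x
      ... | inj₁ (u , h , zu , u≢𝟘 , u≢x) with ≤⇒⊑ u x h
      ...   | v , refl = inj₁ (u , v , zu , zs-cancelˡ G u zx zu , refl , u≢𝟘 , λ { refl → u≢x (sym (⊕-identityʳ u)) })
      split? G x zx | inj₂ none = inj₂ λ x≢𝟘 → zx , x≢𝟘 , irr
        where
        irr : ∀ u v → Zs G u → Zs G v → x ≡ u ⊕ v → u ≡ 𝟘 ⊎ v ≡ 𝟘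
        irr u v zu zv e with u ≟ᵛ 𝟘 | u ≟ᵛ x
        ... | yes p | _      = inj₁ p
        ... | no p  | yes refl = inj₂ (⊕-cancelˡ u (trans (sym e) (sym (⊕-identityʳ u))))
        ... | no p  | no q   = ⊥-elim (none u (⊑⇒≤ (v , e)) (zu , p , q))

    Atom? : (G : Vec C t) (x : Vec ℕ t) → Dec (Atom G x)
    Atom? G x with Zs? G x
    ... | no ¬z = no (¬z ∘ proj₁)
    ... | yes z with x ≟ᵛ 𝟘
    ... | yes p = no λ at → proj₁ (proj₂ at) p
    ... | no p with split? G x z
    ... | inj₂ q = yes (q p)
    ... | inj₁ (u , v , zu , zv , e , u≢𝟘 , v≢𝟘) = no λ (_ , _ , irr) → [ u≢𝟘 , v≢𝟘 ]′ (irr u v zu zv e)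

    abstract
      factorize : (G : Vec C t) (x : Vec ℕ t) → Zs G x → ∃ (Fact G x)
      factorize {t} G x = <-rec (λ m → ∀ x → size x ≡ m → Zs G x → ∃ (Fact G x)) step (size x) x refl
        where
        step : ∀ m → (∀ {l} → l < m → ∀ x → size x ≡ l → Zs G x → ∃ (Fact G x)) →
          ∀ x → size x ≡ m → Zs G x → ∃ (Fact G x)
        step m rec x refl zx with x ≟ᵛ 𝟘
        ... | yes refl = 0 , fact-𝟘 G
        ... | no x≢𝟘 with split? G x zx
        ... | inj₂ q = 1 , fact-atom G (q x≢𝟘)
        ... | inj₁ (u , v , zu , zv , refl , u≢𝟘 , v≢𝟘)
          with rec (subst (size u <_) (sym (size-⊕ u v)) (m<m+n (size u) (size-pos v v≢𝟘))) u refl zu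
             | rec (subst (size v <_) (sym (size-⊕ u v)) (m<n+m (size v) (size-pos u u≢𝟘))) v refl zv
        ... | k , f | l , f′ = k + l , fact-⊕ G f f′

-- Minimal numbers and induction on vectors

abstract
  least : {P : ℕ → Set a} → (∀ m → Dec (P m)) → ∀ n → P n → ∃ λ m → P m × m ≤ n × (∀ k → k < m → ¬ P k)
  least {P = P} P? = <-rec (λ n → P n → ∃ λ m → P m × m ≤ n × (∀ k → k < m → ¬ P k)) step
    where
    step : ∀ n → (∀ {k} → k < n → P k → ∃ λ m → P m × m ≤ k × (∀ l → l < m → ¬ P l)) →
      P n → ∃ λ m → P m × m ≤ n × (∀ k → k < m → ¬ P k)
    step n rec pn with anyUpTo? P? n
    ... | no none = n , pn , ≤-refl , λ k k<n pk → none (k , k<n , pk)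
    ... | yes (k , k<n , pk) with rec k<n pk
    ...   | m , pm , m≤k , min = m , pm , ≤-trans m≤k (<⇒≤ k<n) , min

abstract
  -- The Euclidean argument that the least positive element generates a subgroup. It serves for
  -- orders of elements and for leading coefficients of relations.
  least-divides : {P : ℕ → Set a} (o : ℕ) → 0 < o → (∀ k → k < o → ¬ (0 < k × P k)) →
    (∀ m → P (o + m) → P m) → ∀ m → P m → o ∣ m
  least-divides {P = P} o 0<o min sub = <-rec (λ m → P m → o ∣ m) step
    where
    step : ∀ m → (∀ {k} → k < m → P k → o ∣ k) → P m → o ∣ m
    step zero    rec pm = o ∣0
    step (suc m) rec pm with o ≤? suc m
    ... | no o≰m = ⊥-elim (min (suc m) (≰⇒> o≰m) (s≤s z≤n , pm))
    ... | yes o≤m with m≤n⇒∃[o]m+o≡n o≤m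
    ...   | k , e = subst (o ∣_) e (∣m∣n⇒∣m+n ∣-refl
      (rec (subst (k <_) e (m<n+m k 0<o)) (sub k (subst P (sym e) pm))))

vec-ind : (P : Vec ℕ t → Set a) → P 𝟘 → (∀ i x → P x → P (single i 1 ⊕ x)) → ∀ x → P x
vec-ind {t} P p𝟘 pstep x = go (size x) x refl
  where
  go : ∀ m x → size x ≡ m → P x
  go zero    x e = subst P (sym (size-0 x e)) p𝟘
  go (suc m) x e with nonzero-coordinate x (λ { refl → case trans (sym e) (size-𝟘 t) of λ () })
  ... | i , p with single-⊑ i 1 x p
  ... | y , refl = pstep i y (go m y
        (suc-injective (trans (cong (_+ size y) (sym (size-single i 1))) (trans (sym (size-⊕ (single i 1) y)) e))))

abstract
  max-coordinate : (x : Vec ℕ (suc t)) → ∃ λ i → ∀ j → lookup x j ≤ lookup x i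
  max-coordinate (a ∷ []) = zero , λ { zero → ≤-refl }
  max-coordinate (a ∷ x@(_ ∷ _)) with max-coordinate x
  ... | i , h with a ≤? lookup x i
  ... | yes p = suc i , λ { zero → p ; (suc j) → h j }
  ... | no ¬p = zero , λ { zero → ≤-refl ; (suc j) → ≤-trans (h j) (<⇒≤ (≰⇒> ¬p)) }

abstract
  half-up : ∀ o → ∃ λ x → o ≤ 2 * x × 2 * x ≤ suc o
  half-up zero = 0 , z≤n , z≤n
  half-up (suc zero) = 1 , s≤s z≤n , ≤-refl
  half-up (suc (suc o)) with half-up o
  ... | x , p , q = suc x , subst (2 + o ≤_) (sym (*-suc 2 x)) (s≤s (s≤s p)) ,
    subst (_≤ 3 + o) (sym (*-suc 2 x)) (s≤s (s≤s q))

indicator : Vec ℕ t → Vec ℕ t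
indicator = Vec.map (λ { zero → 0 ; (suc _) → 1 })

lookup-indicator-0 : (x : Vec ℕ t) (i : Fin t) → lookup x i ≡ 0 → lookup (indicator x) i ≡ 0
lookup-indicator-0 (zero ∷ x) zero    e = refl
lookup-indicator-0 (_    ∷ x) (suc i) e = lookup-indicator-0 x i e

lookup-indicator-≤1 : (x : Vec ℕ t) (i : Fin t) → lookup (indicator x) i ≤ 1
lookup-indicator-≤1 (zero  ∷ x) zero    = z≤n
lookup-indicator-≤1 (suc _ ∷ x) zero    = ≤-refl
lookup-indicator-≤1 (_     ∷ x) (suc i) = lookup-indicator-≤1 x i

⊑-indicator : ∀ n (x : Vec ℕ t) → (∀ i → lookup x i ≤ n) → x ⊑ n · indicator x
⊑-indicator n x h = ≤⇒⊑ _ _ (go x h)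
  where
  go : ∀ {t} (x : Vec ℕ t) → (∀ i → lookup x i ≤ n) → ∀ i → lookup x i ≤ lookup (n · indicator x) i
  go (zero  ∷ x) h zero    = z≤n
  go (suc k ∷ x) h zero    = subst (suc k ≤_) (sym (*-identityʳ n)) (h zero)
  go (_     ∷ x) h (suc i) = go x (h ∘ suc) i

-- Orders of elements and weights of sequences

module Weights {c ℓ : Level} (𝔾 : AbelianGroup c ℓ)
  (_≟ᵍ_ : ∀ x y → Dec (AbelianGroup._≈_ 𝔾 x y))
  (n : ℕ) (0<n : 0 < n)
  (exponent : ∀ g → AbelianGroup._≈_ 𝔾 (Families._⊗_ 𝔾 n g) (AbelianGroup.ε 𝔾)) where
  open Families 𝔾
  open Decidable _≟ᵍ_

  abstract
    private
      order : ∀ g → ∃ λ m → (0 < m × m ⊗ g ≈ ε) × m ≤ n × (∀ k → k < m → ¬ (0 < k × k ⊗ g ≈ ε))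
      order g = least (λ m → (0 <? m) ×-dec ((m ⊗ g) ≟ᵍ ε)) n (0<n , exponent g)

    ord : C → ℕ
    ord g = proj₁ (order g)

    ord-pos : ∀ g → 0 < ord g
    ord-pos g = proj₁ (proj₁ (proj₂ (order g)))

    ord-⊗ : ∀ g → ord g ⊗ g ≈ ε
    ord-⊗ g = proj₂ (proj₁ (proj₂ (order g)))

    ord-∣ : ∀ g m → m ⊗ g ≈ ε → ord g ∣ m
    ord-∣ g = least-divides (ord g) (ord-pos g) (proj₂ (proj₂ (proj₂ (order g))))
      λ m e → begin
        m ⊗ g                 ≈⟨ identityˡ _ ⟨
        ε ∙ m ⊗ g             ≈⟨ ∙-congʳ (ord-⊗ g) ⟨
        ord g ⊗ g ∙ m ⊗ g     ≈⟨ ×-homo-+ g (ord g) m ⟨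
        (ord g + m) ⊗ g       ≈⟨ e ⟩
        ε                     ∎
      where open ≈R

    -- normalised so that wt is n times the cross number
    weight : C → ℕ
    weight g = quotient (ord-∣ g n (exponent g))

    weight-ord : ∀ g → weight g * ord g ≡ n
    weight-ord g = sym (_∣_.equality (ord-∣ g n (exponent g)))

    weight-pos : ∀ g → 0 < weight g
    weight-pos g with weight g | weight-ord g
    ... | zero  | e = ⊥-elim (<-irrefl e 0<n)
    ... | suc _ | _ = s≤s z≤n

    ord≤n : ∀ g → ord g ≤ n
    ord≤n g = proj₁ (proj₂ (proj₂ (order g)))

  weighted : Vec C t → Vec ℕ t → Vec ℕ t
  weighted = zipWith λ g k → k * weight g

  wt : Vec C t → Vec ℕ t → ℕ
  wt G x = size (weighted G x)

  -- Exponent vector of the product of the powers `(g ^ ord g) ^ x_g`, a sequence with an evident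
  -- factorization of length `size x`.
  ordered : Vec C t → Vec ℕ t → Vec ℕ t
  ordered = zipWith λ g k → k * ord g

  wt-⊕ : (G : Vec C t) (x y : Vec ℕ t) → wt G (x ⊕ y) ≡ wt G x + wt G y
  wt-⊕ []      []      []      = refl
  wt-⊕ (g ∷ G) (k ∷ x) (l ∷ y) = trans (cong₂ _+_ (*-distribʳ-+ (weight g) k l) (wt-⊕ G x y))
    (sh (k * weight g) (l * weight g) (wt G x) (wt G y))
    where
    sh : ∀ a b c d → (a + b) + (c + d) ≡ (a + c) + (b + d)
    sh = solve-∀

  wt-𝟘 : (G : Vec C t) → wt G 𝟘 ≡ 0
  wt-𝟘 []      = refl
  wt-𝟘 (g ∷ G) = wt-𝟘 G

  wt-· : (G : Vec C t) (k : ℕ) (x : Vec ℕ t) → wt G (k · x) ≡ k * wt G x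
  wt-· G zero    x = trans (cong (wt G) (0·x x)) (wt-𝟘 G)
  wt-· G (suc k) x = trans (cong (wt G) (suc· k x)) (trans (wt-⊕ G x (k · x)) (cong (wt G x +_) (wt-· G k x)))

  wt-single : (G : Vec C t) (i : Fin t) (k : ℕ) → wt G (single i k) ≡ k * weight (lookup G i)
  wt-single (g ∷ G) zero    k = trans (cong (k * weight g +_) (wt-𝟘 G)) (+-identityʳ _)
  wt-single (g ∷ G) (suc i) k = wt-single G i k

  wt-restrict : (m : Vec Bool t) (G : Vec C t) (x : Vec ℕ (mask-size m)) →
    wt G (extend m x) ≡ wt (restrict m G) x
  wt-restrict []          []      []      = refl
  wt-restrict (true  ∷ m) (g ∷ G) (k ∷ x) = cong (k * weight g +_) (wt-restrict m G x)
  wt-restrict (false ∷ m) (g ∷ G) x       = wt-restrict m G x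

  size≤wt : (G : Vec C t) (x : Vec ℕ t) → size x ≤ wt G x
  size≤wt []      []      = z≤n
  size≤wt (g ∷ G) (k ∷ x) = +-mono-≤ (m≤m*n k (weight g) {{>-nonZero (weight-pos g)}}) (size≤wt G x)

  wt≤fact : (G : Vec C t) (μ : ℕ) {x : Vec ℕ t} {ws : List (Vec ℕ t)} → All (λ w → μ ≤ wt G w) ws →
    sumV ws ≡ x → length ws * μ ≤ wt G x
  wt≤fact G μ []       refl = z≤n
  wt≤fact G μ {ws = w ∷ ws} (p ∷ ps) refl = subst (μ + length ws * μ ≤_) (sym (wt-⊕ G w _))
    (+-mono-≤ p (wt≤fact G μ ps refl))

  fact≤wt : (G : Vec C t) (μ : ℕ) {x : Vec ℕ t} {ws : List (Vec ℕ t)} → All (λ w → wt G w ≤ μ) ws →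
    sumV ws ≡ x → wt G x ≤ length ws * μ
  fact≤wt G μ []       refl = ≤-reflexive (wt-𝟘 G)
  fact≤wt G μ {ws = w ∷ ws} (p ∷ ps) refl = subst (_≤ μ + length ws * μ) (sym (wt-⊕ G w _))
    (+-mono-≤ p (fact≤wt G μ ps refl))

  wt≡fact : (G : Vec C t) (μ : ℕ) {x : Vec ℕ t} {ws : List (Vec ℕ t)} → All (λ w → wt G w ≡ μ) ws →
    sumV ws ≡ x → length ws * μ ≡ wt G x
  wt≡fact G μ ps e = ≤-antisym (wt≤fact G μ (All.map (≤-reflexive ∘ sym) ps) e)
    (fact≤wt G μ (All.map ≤-reflexive ps) e)

  base : (G : Vec C t) (i : Fin t) → Vec ℕ t
  base G i = single i (ord (lookup G i))

  wt-base : (G : Vec C t) (i : Fin t) → wt G (base G i) ≡ n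
  wt-base G i = trans (wt-single G i _) (trans (*-comm (ord (lookup G i)) _) (weight-ord (lookup G i)))

  base≢𝟘 : (G : Vec C t) (i : Fin t) → base G i ≢ 𝟘
  base≢𝟘 G i e = <-irrefl (trans (sym (lookup-𝟘 i)) (trans (sym (cong (λ v → lookup v i) e)) (lookup-single i _)))
    (ord-pos (lookup G i))

  zs-base : (G : Vec C t) (i : Fin t) → Zs G (base G i)
  zs-base G i = ≈-trans (eval-single G i _) (ord-⊗ (lookup G i))

  atom-base : (G : Vec C t) (i : Fin t) → Atom G (base G i)
  atom-base {t} G i = zs-base G i , base≢𝟘 G i , irr
    where
    o = ord (lookup G i)
    part : ∀ u v → base G i ≡ u ⊕ v → u ≡ single i (lookup u i)
    part u v e = vec-ext h
      where
      h : ∀ j → lookup u j ≡ lookup (single i (lookup u i)) j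
      h j with i Fin.≟ j
      ... | yes refl = sym (lookup-single i _)
      ... | no i≢j = trans
        (n≤0⇒n≡0 (subst (lookup u j ≤_) (lookup-single-≢ i j o i≢j) (⊑⇒≤ (v , e) j)))
        (sym (lookup-single-≢ i j _ i≢j))
    irr : ∀ u v → Zs G u → Zs G v → base G i ≡ u ⊕ v → u ≡ 𝟘 ⊎ v ≡ 𝟘
    irr u v zu zv e with lookup u i in eq
    ... | zero  = inj₁ (trans (part u v e) (trans (cong (single i) eq) (vec-ext h)))
      where
      h : ∀ j → lookup (single i 0) j ≡ lookup 𝟘 j
      h j with i Fin.≟ j
      ... | yes refl = trans (lookup-single i 0) (sym (lookup-𝟘 i))
      ... | no i≢j   = trans (lookup-single-≢ i j 0 i≢j) (sym (lookup-𝟘 j))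
    ... | suc k = inj₂ (⊕-cancelˡ u (trans (sym e) (trans (sym u≡base) (sym (⊕-identityʳ u)))))
      where
      o∣ : o ∣ lookup u i
      o∣ = ord-∣ _ _ (≈-trans (≈-sym (eval-single G i (lookup u i)))
             (subst (λ w → eval G w ≈ ε) (part u v e) zu))
      o≤ : o ≤ lookup u i
      o≤ = ∣⇒≤ {{subst NonZero (sym eq) _}} o∣
      ≤o : lookup u i ≤ o
      ≤o = subst (lookup u i ≤_) (lookup-single i o) (⊑⇒≤ (v , e) i)
      u≡base : u ≡ base G i
      u≡base = trans (part u v e) (cong (single i) (≤-antisym ≤o o≤))

  atom-base-or-< : (G : Vec C t) {x : Vec ℕ t} → Atom G x → ∀ i → x ≡ base G i ⊎ lookup x i < ord (lookup G i)
  atom-base-or-< G {x} at i with ord (lookup G i) ≤? lookup x i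
  ... | no ¬p = inj₂ (≰⇒> ¬p)
  ... | yes p = inj₁ (sym (atom-min G at (zs-base G i) (base≢𝟘 G i) (single-⊑ i _ x p)))

  atom-coordinate : (G : Vec C t) {x : Vec ℕ t} → Atom G x → ∀ i → lookup x i ≤ ord (lookup G i)
  atom-coordinate G at i with atom-base-or-< G at i
  ... | inj₁ refl = ≤-reflexive (lookup-single i _)
  ... | inj₂ p    = <⇒≤ p

  atom-off-n : (G : Vec C t) {x : Vec ℕ t} → Atom G x → wt G x ≢ n → ∀ i → lookup x i < ord (lookup G i)
  atom-off-n G at ≢n i with atom-base-or-< G at i
  ... | inj₁ refl = ⊥-elim (≢n (wt-base G i))
  ... | inj₂ p    = p

  ordered-⊕ : (G : Vec C t) (x y : Vec ℕ t) → ordered G (x ⊕ y) ≡ ordered G x ⊕ ordered G y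
  ordered-⊕ []      []      []      = refl
  ordered-⊕ (g ∷ G) (k ∷ x) (l ∷ y) = cong₂ _∷_ (*-distribʳ-+ (ord g) k l) (ordered-⊕ G x y)

  ordered-𝟘 : (G : Vec C t) → ordered G 𝟘 ≡ 𝟘
  ordered-𝟘 []      = refl
  ordered-𝟘 (g ∷ G) = cong (0 ∷_) (ordered-𝟘 G)

  ordered-single : (G : Vec C t) (i : Fin t) (k : ℕ) → ordered G (single i k) ≡ single i (k * ord (lookup G i))
  ordered-single (g ∷ G) zero    k = cong (_ ∷_) (ordered-𝟘 G)
  ordered-single (g ∷ G) (suc i) k = cong (0 ∷_) (ordered-single G i k)

  ordered-base : (G : Vec C t) (i : Fin t) → ordered G (single i 1) ≡ base G i
  ordered-base G i = trans (ordered-single G i 1) (cong (single i) (*-identityˡ _))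

  fact-ordered : (G : Vec C t) (x : Vec ℕ t) → Fact G (ordered G x) (size x)
  fact-ordered {t} G = vec-ind (λ x → Fact G (ordered G x) (size x))
    (fact-subst G (sym (ordered-𝟘 G)) (sym (size-𝟘 t)) (fact-𝟘 G))
    λ i x f → fact-subst G
      (sym (trans (ordered-⊕ G (single i 1) x) (cong (_⊕ ordered G x) (ordered-base G i))))
      (trans (cong (_+ size x) (sym (size-single i 1))) (sym (size-⊕ (single i 1) x)))
      (fact-⊕ G (fact-atom G (atom-base G i)) f)

  ordered-weighted : (G : Vec C t) (x : Vec ℕ t) → ordered G (weighted G x) ≡ n · x
  ordered-weighted []      []      = refl
  ordered-weighted (g ∷ G) (k ∷ x) = cong₂ _∷_
    (trans (*-assoc k (weight g) (ord g)) (trans (cong (k *_) (weight-ord g)) (*-comm k n)))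
    (ordered-weighted G x)

  fact-n· : (G : Vec C t) (x : Vec ℕ t) → Fact G (n · x) (wt G x)
  fact-n· G x = fact-subst G (ordered-weighted G x) refl (fact-ordered G (weighted G x))

  -- The sequence `x ^ n` has length `n` as a power of the atom `x`, and length `wt x` when each
  -- `g ^ n` is split into `n / ord g` copies of `g ^ ord g`.
  wt-cong : (G : Vec C t) {d : ℕ} → UL d G → {x : Vec ℕ t} → Atom G x → Cong d (wt G x) n
  wt-cong G ul {x} at = ul (n · x) (wt G x) n (fact-n· G x)
    (fact-subst G refl (*-identityʳ n) (fact-· G n (fact-atom G at)))

  -- A single element that forms an atom has order 1, so the atom is its `g ^ ord g` and weighs `n`.
  2≤wt : (G : Vec C t) {x : Vec ℕ t} → Atom G x → wt G x ≢ n → 2 ≤ wt G x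
  2≤wt {t} G {x} at@(zx , x≢𝟘 , _) ≢n = ≤-trans (≰⇒> small) (size≤wt G x)
    where
    small : ¬ size x ≤ 1
    small p with nonzero-coordinate x x≢𝟘
    ... | i , q with single-⊑ i 1 x q
    ... | y , refl = <⇒≱ (atom-off-n G at ≢n i) (≤-trans (∣⇒≤ (ord-∣ _ 1 1g≈ε)) (subst (1 ≤_) (sym (lookup-⊕ (single i 1) y i))
            (≤-trans (≤-reflexive (sym (lookup-single i 1))) (m≤m+n _ _))))
      where
      y≡𝟘 : y ≡ 𝟘
      y≡𝟘 = size-0 y (n≤0⇒n≡0 (s≤s⁻¹ (subst (_≤ 1) (trans (size-⊕ (single i 1) y) (cong (_+ size y) (size-single i 1))) p)))
      1g≈ε : 1 ⊗ lookup G i ≈ ε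
      1g≈ε = ≈-trans (≈-sym (eval-single G i 1))
        (subst (λ v → eval G v ≈ ε) (trans (cong (single i 1 ⊕_) y≡𝟘) (⊕-identityʳ _)) zx)

-- Atoms of weight below the exponent

module SmallAtoms {c ℓ : Level} (𝔾 : AbelianGroup c ℓ)
  (_≟ᵍ_ : ∀ x y → Dec (AbelianGroup._≈_ 𝔾 x y))
  (n : ℕ) (0<n : 0 < n)
  (exponent : ∀ g → AbelianGroup._≈_ 𝔾 (Families._⊗_ 𝔾 n g) (AbelianGroup.ε 𝔾))
  (d : ℕ) (n≤2d+1 : n ≤ suc (2 * d)) where
  open Families 𝔾
  open Decidable _≟ᵍ_
  open Weights 𝔾 _≟ᵍ_ n 0<n exponent

  -- The weight falls short of `n` by a positive multiple of `d`. Twice `d` is impossible, since the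
  -- weight is at least 2 and `n ≤ 2 d + 1`.
  small-wt : (G : Vec C t) → UL d G → {x : Vec ℕ t} → Atom G x → wt G x < n → wt G x + d ≡ n
  small-wt G ul {x} at x<n with cong-< (wt-cong G ul at) x<n
  ... | zero  , e = sym (trans e (cong (wt G x +_) (+-identityʳ d)))
  ... | suc j , e = ⊥-elim (<-irrefl refl (begin-strict
    n                               ≤⟨ n≤2d+1 ⟩
    suc (2 * d)                     <⟨ ≤-refl ⟩
    2 + 2 * d                       ≤⟨ +-mono-≤ (2≤wt G at (<⇒≢ x<n)) (*-monoˡ-≤ d (s≤s (s≤s (z≤n {j})))) ⟩
    wt G x + suc (suc j) * d        ≡⟨ e ⟨
    n                               ∎))
    where open ≤-Reasoning

  -- With (x + 1) copies of a small atom, at least one full g ^ ord g can be split off;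
  -- all atoms having weight at least μ then forces a length too short by less than d.
  module _ (G : Vec C t) (ul : UL d G) {A : Vec ℕ t} (at : Atom G A) (A<n : wt G A < n) where

    private
      μ = wt G A

    μ+d≡n : μ + d ≡ n
    μ+d≡n = small-wt G ul at A<n

    0<d : 0 < d
    0<d = n≢0⇒n>0 λ d≡0 → <-irrefl (trans (sym (+-identityʳ μ)) (subst (λ e → μ + e ≡ n) d≡0 μ+d≡n)) A<n

    μ≤wt : {x : Vec ℕ t} → Atom G x → μ ≤ wt G x
    μ≤wt {x} atx with wt G x <? n
    ... | yes p = ≤-reflexive (+-cancelʳ-≡ d μ _ (trans μ+d≡n (sym (small-wt G ul atx p))))
    ... | no ¬p = ≤-trans (<⇒≤ A<n) (≮⇒≥ ¬p)

    fact-μ : {x : Vec ℕ t} {k : ℕ} → Fact G x k → k * μ ≤ wt G x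
    fact-μ (ws , aws , refl , e) = wt≤fact G μ (All.map μ≤wt aws) e

    no-small-multiple : ∀ x i → ord (lookup G i) ≤ x * lookup A i → ¬ (2 * x ≤ suc n)
    no-small-multiple x i o≤ 2x≤ with single-⊑ i (ord (lookup G i)) (x · A) (subst (ord (lookup G i) ≤_) (sym (lookup-· x A i)) o≤)
    ... | R , e with factorize G R (zs-cancelˡ G (base G i) (subst (λ v → eval G v ≈ ε) e (zs-· G x (proj₁ at))) (zs-base G i))
    ... | λ′ , fR = contra
      where
      open ≤-Reasoning
      xμ : x * μ ≡ n + wt G R
      xμ = trans (sym (wt-· G x A)) (trans (cong (wt G) e) (trans (wt-⊕ G (base G i) R) (cong (_+ wt G R) (wt-base G i))))
      lt : suc λ′ < x
      lt = *-cancelʳ-< μ (suc λ′) x (begin-strict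
        suc λ′ * μ    <⟨ +-mono-<-≤ A<n (fact-μ fR) ⟩
        n + wt G R    ≡⟨ xμ ⟨
        x * μ         ∎)
      gap : suc λ′ + d ≤ x
      gap = cong-gap (ul (x · A) (suc λ′) x (fact-subst G (sym e) refl (fact-⊕ G (fact-atom G (atom-base G i)) fR))
        (fact-subst G refl (*-identityʳ x) (fact-· G x (fact-atom G at)))) lt
      -- Because `x ≤ d + 1`, the gap forces `λ′ = 0` and `x = d + 1`. Then `A ^ (d + 1)` is exactly
      -- `g ^ ord g`, and `(d + 1) μ = n = μ + d` leaves `d μ = d`, contrary to `μ ≥ 2`.
      2x≤2d+2 : 2 * x ≤ 2 * suc d
      2x≤2d+2 = ≤-trans 2x≤ (≤-trans (s≤s n≤2d+1) (≤-reflexive (sym (*-suc 2 d))))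
      x≤ : x ≤ suc d
      x≤ = *-cancelˡ-≤ 2 2x≤2d+2
      λ′≡0 : λ′ ≡ 0
      λ′≡0 = n≤0⇒n≡0 (+-cancelʳ-≤ d λ′ 0 (s≤s⁻¹ (≤-trans gap x≤)))
      x≡ : x ≡ suc d
      x≡ = ≤-antisym x≤ (≤-trans (s≤s (m≤n+m d λ′)) gap)
      R≡𝟘 : wt G R ≡ 0
      R≡𝟘 = trans (cong (wt G) (fact-0 G fR λ′≡0)) (wt-𝟘 G)
      xμ≡n : suc d * μ ≡ n
      xμ≡n = trans (cong (_* μ) (sym x≡)) (trans xμ (trans (cong (n +_) R≡𝟘) (+-identityʳ n)))
      contra : ⊥
      contra = <-irrefl refl (begin-strict
        d * 1          <⟨ *-monoʳ-< d {{>-nonZero 0<d}} (2≤wt G at (<⇒≢ A<n)) ⟩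
        d * μ          ≡⟨ +-cancelˡ-≡ μ _ _ (trans xμ≡n (sym μ+d≡n)) ⟩
        d              ≡⟨ *-identityʳ d ⟨
        d * 1          ∎)

    -- If an element occurred twice in `A`, then half of its order, rounded up, would be enough
    -- copies of `A` to contain its full power.
    coordinate≤1 : ∀ i → lookup A i ≤ 1
    coordinate≤1 i with lookup A i ≤? 1
    ... | yes p = p
    ... | no ¬p with half-up (ord (lookup G i))
    ... | x , o≤ , ≤o = ⊥-elim (no-small-multiple x i
      (≤-trans o≤ (≤-trans (≤-reflexive (*-comm 2 x)) (*-monoʳ-≤ x (≰⇒> ¬p))))
      (≤-trans ≤o (s≤s (ord≤n _))))

    -- Weight at least 2 means order at most `n / 2`, so that `x = ord g` copies are few enough for
    -- `no-small-multiple`.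
    weight≡1 : ∀ i → 0 < lookup A i → weight (lookup G i) ≡ 1
    weight≡1 i 0<Ai with weight (lookup G i) ≤? 1
    ... | yes p = ≤-antisym p (weight-pos _)
    ... | no ¬p = ⊥-elim (no-small-multiple (ord g) i
      (≤-trans (≤-reflexive (sym (*-identityʳ (ord g)))) (*-monoʳ-≤ (ord g) 0<Ai))
      (m≤n⇒m≤1+n (≤-trans (*-monoˡ-≤ (ord g) (≰⇒> ¬p)) (≤-reflexive (weight-ord g)))))
      where g = lookup G i

  -- Atoms of weight below `n` are squarefree, so containment of supports already gives
  -- divisibility.
  small-⊑ : (G : Vec C t) → UL d G → {x y : Vec ℕ t} → Atom G x → wt G x < n →
    (∀ i → 0 < lookup x i → 0 < lookup y i) → x ⊑ y
  small-⊑ G ul {x} {y} at lt h = ≤⇒⊑ x y λ i → go i (coordinate≤1 G ul at lt i) (h i)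
    where
    go : ∀ i → lookup x i ≤ 1 → (0 < lookup x i → 0 < lookup y i) → lookup x i ≤ lookup y i
    go i p q with lookup x i
    ... | zero  = z≤n
    ... | suc k = ≤-trans p (q (s≤s z≤n))

  -- The situation after restriction to the support of a light atom, which thereby becomes the
  -- product `𝟙` of all members.
  module FullAtom (G : Vec C (suc t)) (ul : UL d G) (at : Atom G 𝟙) (lt : wt G 𝟙 < n) where

    weights≡1 : ∀ i → weight (lookup G i) ≡ 1
    weights≡1 i = weight≡1 G ul at lt i (subst (0 <_) (sym (lookup-𝟙 i)) (s≤s z≤n))

    ords≡n : ∀ i → ord (lookup G i) ≡ n
    ords≡n i = trans (sym (+-identityʳ _)) (trans (cong (_* ord (lookup G i)) (sym (weights≡1 i))) (weight-ord _))

    wt≡size : ∀ x → wt G x ≡ size x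
    wt≡size x = cong size (vec-ext {x = weighted G x} {x} λ i → trans (VecP.lookup-zipWith (λ g k → k * weight g) i G x)
      (trans (cong (lookup x i *_) (weights≡1 i)) (*-identityʳ (lookup x i))))

    t+d<n : suc t + d ≡ n
    t+d<n = trans (cong (_+ d) (sym (trans (wt≡size 𝟙) (size-𝟙 (suc t))))) (μ+d≡n G ul at lt)

    t≤d : t ≤ d
    t≤d = +-cancelʳ-≤ (suc d) t d (begin
      t + suc d        ≡⟨ +-suc t d ⟩
      suc t + d        ≡⟨ t+d<n ⟩
      n                ≤⟨ n≤2d+1 ⟩
      suc (2 * d)      ≡⟨ cong suc (cong (d +_) (+-identityʳ d)) ⟩
      suc (d + d)      ≡⟨ +-suc d d ⟨
      d + suc d        ∎)
      where open ≤-Reasoning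

    -- A light atom would divide the atom `𝟙` and thus equal it, although it misses the member `i`.
    n≤wt-proper : ∀ {x} → Atom G x → ∀ i → lookup x i ≡ 0 → n ≤ wt G x
    n≤wt-proper {x} atx i xi≡0 with wt G x <? n
    ... | no ¬p = ≮⇒≥ ¬p
    ... | yes p with atom-min G at (proj₁ atx) (proj₁ (proj₂ atx))
                       (small-⊑ G ul atx p λ j _ → subst (0 <_) (sym (lookup-𝟙 j)) (s≤s z≤n))
    ... | refl with trans (sym (lookup-𝟙 i)) xi≡0
    ... | ()

    proper-fact : ∀ {x k} i → lookup x i ≡ 0 → Fact G x k → k * n ≤ wt G x
    proper-fact i e (ws , aws , refl , eq) = wt≤fact G n
      (All.zipWith (λ (aw , z) → n≤wt-proper aw i z) (aws , zero-coordinate i eq e)) eq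

    -- compare x with its complement inside n · (support of x)
    wt-proper : ∀ {x} → Atom G x → ∀ i → lookup x i ≡ 0 → wt G x ≡ n
    wt-proper {x} atx i xi≡0
      with ⊑-indicator n x (λ j → ≤-trans (atom-coordinate G atx j) (ord≤n _))
    ... | y , e
      with factorize G y (zs-cancelˡ G x (subst (λ v → eval G v ≈ ε) e (fact-zs G (fact-n· G (indicator x)))) (proj₁ atx))
    ... | k , fy = ≤-antisym x≤n (n≤wt-proper atx i xi≡0)
      where
      open ≤-Reasoning
      sz = size (indicator x)
      total : wt G x + wt G y ≡ n * sz
      total = trans (sym (wt-⊕ G x y)) (trans (cong (wt G) (sym e)) (trans (wt-· G n (indicator x)) (cong (n *_) (wt≡size (indicator x)))))
      yi≡0 : lookup y i ≡ 0
      yi≡0 = m+n≡0⇒n≡0 (lookup x i) (trans (sym (lookup-⊕ x y i)) (trans (cong (λ v → lookup v i) (sym e))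
        (trans (lookup-· n (indicator x) i) (trans (cong (n *_) (lookup-indicator-0 x i xi≡0)) (*-zeroʳ n)))))
      1+k≤s : suc k ≤ sz
      1+k≤s = *-cancelʳ-≤ (suc k) sz n {{>-nonZero 0<n}} (begin
        n + k * n          ≤⟨ +-mono-≤ (n≤wt-proper atx i xi≡0) (proper-fact i yi≡0 fy) ⟩
        wt G x + wt G y    ≡⟨ total ⟩
        n * sz              ≡⟨ *-comm n sz ⟩
        sz * n              ∎)
      s≤t : sz ≤ t
      s≤t = s≤s⁻¹ (begin
        suc sz                                    ≡⟨ +-comm 1 sz ⟩
        sz + 1                                    ≡⟨ cong (sz +_) (size-single i 1) ⟨
        sz + size (single i 1)                    ≡⟨ size-⊕ (indicator x) (single i 1) ⟨
        size (indicator x ⊕ single i 1)          ≤⟨ ⊑-size {x = indicator x ⊕ single i 1} {𝟙} (≤⇒⊑ (indicator x ⊕ single i 1) 𝟙 h) ⟩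
        size (𝟙 {suc t})                         ≡⟨ size-𝟙 (suc t) ⟩
        suc t                                    ∎)
        where
        h : ∀ j → lookup (indicator x ⊕ single i 1) j ≤ lookup 𝟙 j
        h j rewrite lookup-⊕ (indicator x) (single i 1) j | lookup-𝟙 j with i Fin.≟ j
        ... | yes refl rewrite lookup-indicator-0 x i xi≡0 | lookup-single i 1 = ≤-refl
        ... | no i≢j   rewrite lookup-single-≢ i j 1 i≢j | +-identityʳ (lookup (indicator x) j) = lookup-indicator-≤1 x j
      -- A gap of `d` does not fit below `sz ≤ t ≤ d`, so the two lengths agree. With equally many
      -- factors as `n`-fold powers, no factor can weigh more than `n`.
      1+k≡s : suc k ≡ sz
      1+k≡s with suc k ≟ sz
      ... | yes p = p
      ... | no p  = ⊥-elim (<-irrefl refl (begin-strict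
        t              ≤⟨ t≤d ⟩
        d              <⟨ m<n+m d (s≤s z≤n) ⟩
        suc k + d      ≤⟨ cong-gap (ul (n · indicator x) (suc k) sz
                            (fact-subst G (sym e) refl (fact-⊕ G (fact-atom G atx) fy))
                            (fact-subst G refl (wt≡size _) (fact-n· G (indicator x)))) (≤∧≢⇒< 1+k≤s p) ⟩
        sz              ≤⟨ s≤t ⟩
        t              ∎))
      x≤n : wt G x ≤ n
      x≤n = +-cancelʳ-≤ (k * n) _ _ (begin
        wt G x + k * n     ≤⟨ +-monoʳ-≤ (wt G x) (proper-fact i yi≡0 fy) ⟩
        wt G x + wt G y    ≡⟨ total ⟩
        n * sz              ≡⟨ *-comm n sz ⟩
        sz * n              ≡⟨ cong (_* n) 1+k≡s ⟨
        n + k * n          ∎)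

    proper-fact-≡ : ∀ {x k} i → lookup x i ≡ 0 → Fact G x k → k * n ≡ wt G x
    proper-fact-≡ i e (ws , aws , refl , eq) = wt≡fact G n
      (All.zipWith (λ (aw , z) → wt-proper aw i z) (aws , zero-coordinate i eq e)) eq

    -- Complement x inside (max x) · 𝟙.
    proper-atom : ∀ {x} → Atom G x → ∀ i → lookup x i ≡ 0 → ∃ λ j → x ≡ base G j
    proper-atom {x} atx@(zx , x≢𝟘 , _) i xi≡0 with max-coordinate x
    ... | j , mx with atom-base-or-< G atx j
    ... | inj₁ e = j , e
    ... | inj₂ m<o
      with ≤⇒⊑ x (lookup x j · 𝟙) (λ k → subst (lookup x k ≤_) (sym (trans (lookup-· (lookup x j) 𝟙 k)
             (trans (cong (lookup x j *_) (lookup-𝟙 k)) (*-identityʳ _)))) (mx k))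
    ... | y , e
      with factorize G y (zs-cancelˡ G x (subst (λ v → eval G v ≈ ε) e (zs-· G (lookup x j) (proj₁ at))) zx)
    ... | k , fy = ⊥-elim contra
      where
      m = lookup x j
      m<n : m < n
      m<n = subst (m <_) (ords≡n j) m<o
      yj≡0 : lookup y j ≡ 0
      yj≡0 = +-cancelˡ-≡ m _ _ (trans (sym (lookup-⊕ x y j)) (trans (cong (λ v → lookup v j) (sym e))
        (trans (lookup-· m 𝟙 j) (trans (cong (m *_) (lookup-𝟙 j)) (trans (*-identityʳ m) (sym (+-identityʳ m)))))))
      total : suc k * n ≡ m * suc t
      total = trans (cong₂ _+_ (sym (wt-proper atx i xi≡0)) (proper-fact-≡ j yj≡0 fy))
        (trans (sym (wt-⊕ G x y)) (trans (cong (wt G) (sym e)) (trans (wt-· G m 𝟙)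
        (cong (m *_) (trans (wt≡size 𝟙) (size-𝟙 (suc t)))))))
      open ≤-Reasoning
      0<m : 0 < m
      0<m with nonzero-coordinate x x≢𝟘
      ... | l , p = ≤-trans p (mx l)
      lt′ : suc k < m
      lt′ = *-cancelʳ-< n (suc k) m (begin-strict
        suc k * n      ≡⟨ total ⟩
        m * suc t      <⟨ *-monoʳ-< m {{>-nonZero 0<m}} (subst (suc t <_) t+d<n (m<m+n (suc t) (0<d G ul at lt))) ⟩
        m * n          ∎)
      -- Eliminating `k` from `(k + 1) n = m (t + 1)`, `t + 1 = n - d` and the congruence `mq`
      -- leaves `m = (q + 1) n`, too large for a multiplicity below `n`.
      module _ (q : ℕ) (mq : m ≡ suc k + suc q * d) where
        eq₁ : suc k * n + m * d ≡ suc k * n + (suc q * n) * d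
        eq₁ = begin-equality
          suc k * n + m * d                  ≡⟨ cong (_+ m * d) total ⟩
          m * suc t + m * d                  ≡⟨ *-distribˡ-+ m (suc t) d ⟨
          m * (suc t + d)                    ≡⟨ cong₂ _*_ mq t+d<n ⟩
          (suc k + suc q * d) * n            ≡⟨ sh (suc k) (suc q) d n ⟩
          suc k * n + (suc q * n) * d        ∎
          where
          sh : ∀ k q d n → (k + q * d) * n ≡ k * n + (q * n) * d
          sh = solve-∀
        m≡ : m ≡ suc q * n
        m≡ = *-cancelʳ-≡ m (suc q * n) d {{>-nonZero (0<d G ul at lt)}} (+-cancelˡ-≡ (suc k * n) _ _ eq₁)
        multiple : ⊥
        multiple = <⇒≱ m<n (subst (n ≤_) (sym m≡) (m≤n*m n (suc q)))
      contra : ⊥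
      contra = let (q , mq) = cong-< (ul (m · 𝟙) (suc k) m (fact-subst G (sym e) refl (fact-⊕ G (fact-atom G atx) fy))
                     (fact-subst G refl (*-identityʳ m) (fact-· G m (fact-atom G at)))) lt′ in multiple q mq

    -- A relation on `G′` factors into atoms that miss `g`, and by `proper-atom` these are only the
    -- powers `g_i ^ n`.
    indep-proper : ∀ {g G′} → G ≡ g ∷ G′ → Indep n G′
    indep-proper {g} {G′} refl = (λ i → exponent _) , λ x zx i → dvd x zx i
      where
      dvd : ∀ x → Zs G′ x → ∀ i → n ∣ lookup x i
      dvd x zx i with factorize G (0 ∷ x) (≈-trans (identityˡ _) zx)
      ... | k , (ws , aws , _ , e) = subst (λ v → n ∣ lookup v (suc i)) e
            (all∣ ws (All.zipWith (λ (aw , z) → proper-atom aw zero z) (aws , zero-coordinate zero e refl)))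
        where
        base∣ : ∀ j i → n ∣ lookup (base G j) i
        base∣ j i with j Fin.≟ i
        ... | yes refl = subst (n ∣_) (sym (trans (lookup-single i _) (ords≡n i))) ∣-refl
        ... | no j≢i   = subst (n ∣_) (sym (lookup-single-≢ j i _ j≢i)) (n ∣0)
        all∣ : ∀ ws → All (λ w → ∃ λ j → w ≡ base G j) ws → n ∣ lookup (sumV ws) (suc i)
        all∣ []       []                = subst (n ∣_) (sym (lookup-𝟘 {suc t} (suc i))) (n ∣0)
        all∣ (w ∷ ws) ((j , refl) ∷ ps) = subst (n ∣_) (sym (lookup-⊕ w (sumV ws) (suc i)))
          (∣m∣n⇒∣m+n (base∣ j (suc i)) (all∣ ws ps))

  small-atom-indep : (G : Vec C t) → UL d G → {x : Vec ℕ t} → Atom G x → wt G x < n →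
    ∃ λ k → suc k + d ≡ n × ∃ λ (F : Vec C k) → Indep n F
  small-atom-indep {t} G ul {x} at lt =
    go (mask-size m) (restrict m G) (UL-restrict m G ul) (restrict m x) ones
      (atom-extend⁻¹ m G (subst (Atom G) (sym (extend-support x)) at))
      (subst (_< n) (trans (cong (wt G) (sym (extend-support x))) (wt-restrict m G _)) lt)
    where
    m = support x
    at′ : Atom (restrict m G) (restrict m x)
    at′ = atom-extend⁻¹ m G (subst (Atom G) (sym (extend-support x)) at)
    lt′ : wt (restrict m G) (restrict m x) < n
    lt′ = subst (_< n) (trans (cong (wt G) (sym (extend-support x))) (wt-restrict m G _)) lt
    ones : restrict m x ≡ 𝟙
    ones = vec-ext λ i → trans
      (≤-antisym (coordinate≤1 (restrict m G) (UL-restrict m G ul) at′ lt′ i) (restrict-support-pos x i))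
      (sym (lookup-𝟙 i))
    go : ∀ s (G′ : Vec C s) → UL d G′ → ∀ y → y ≡ 𝟙 → Atom G′ y → wt G′ y < n →
      ∃ λ k → suc k + d ≡ n × ∃ λ (F : Vec C k) → Indep n F
    go zero    G′       ul′ y refl at lt = ⊥-elim (proj₁ (proj₂ at) refl)
    go (suc k) (g ∷ G′) ul′ y refl at lt = k , t+d<n , G′ , indep-proper refl
      where open FullAtom (g ∷ G′) ul′ at lt

-- Divisibility and minimal covers

private
  -- The witness is `c / gcd c v`, which is coprime to `v / gcd c v` and exceeds 1 because `c` does
  -- not divide `v`.
  ∣-reduce′ : ∀ {c v} → 0 < c → ¬ c ∣ v → ∃ λ P → 2 ≤ P × (∀ x → c ∣ x * v → P ∣ x)
  ∣-reduce′ {c} {v} 0<c c∤v = P , 2≤P , λ x cx → coprime-divisor {n = v′} coprime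
      (*-cancelʳ-∣ w (subst₂ _∣_ c≡ (trans (cong (x *_) v≡) (trans (sym (*-assoc x v′ w)) (cong (_* w) (*-comm x v′)))) cx))
    where
    w = gcd c v
    w∣c = gcd[m,n]∣m c v
    w∣v = gcd[m,n]∣n c v
    P = quotient w∣c
    v′ = quotient w∣v
    c≡ : c ≡ P * w
    c≡ = _∣_.equality w∣c
    v≡ : v ≡ v′ * w
    v≡ = _∣_.equality w∣v
    instance
      w≢0 : NonZero w
      w≢0 = ≢-nonZero (gcd[m,n]≢0 c v (inj₁ λ e → <-irrefl (sym e) 0<c))
    coprime : Coprime P v′
    coprime {i} (i∣P , i∣v′) = ∣1⇒≡1 (*-cancelʳ-∣ w (subst (i * w ∣_) (sym (*-identityˡ w))
      (gcd-greatest (subst (i * w ∣_) (sym c≡) (*-monoˡ-∣ w i∣P)) (subst (i * w ∣_) (sym v≡) (*-monoˡ-∣ w i∣v′)))))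
    2≤P : 2 ≤ P
    2≤P with P | c≡
    ... | zero        | e = ⊥-elim (<-irrefl (sym e) 0<c)
    ... | suc zero    | e = ⊥-elim (c∤v (subst (_∣ v) (sym (trans e (+-identityʳ w))) w∣v))
    ... | suc (suc _) | _ = s≤s (s≤s z≤n)

abstract
  ∣-reduce : ∀ {c v} → 0 < c → ¬ c ∣ v → ∃ λ P → 2 ≤ P × (∀ x → c ∣ x * v → P ∣ x)
  ∣-reduce = ∣-reduce′

clear : Fin t → Vec ℕ t → Vec ℕ t
clear zero    (_ ∷ x) = 0 ∷ x
clear (suc i) (k ∷ x) = k ∷ clear i x

clear-split : (i : Fin t) (x : Vec ℕ t) → x ≡ single i (lookup x i) ⊕ clear i x
clear-split zero    (k ∷ x) = cong₂ _∷_ (sym (+-identityʳ k)) (sym (⊕-identityˡ x))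
clear-split (suc i) (k ∷ x) = cong (k ∷_) (clear-split i x)

lookup-clear : (i : Fin t) (x : Vec ℕ t) → lookup (clear i x) i ≡ 0
lookup-clear zero    (_ ∷ x) = refl
lookup-clear (suc i) (_ ∷ x) = lookup-clear i x

lookup-clear-≢ : (i j : Fin t) (x : Vec ℕ t) → i ≢ j → lookup (clear i x) j ≡ lookup x j
lookup-clear-≢ zero    zero    x       i≢j = ⊥-elim (i≢j refl)
lookup-clear-≢ zero    (suc j) (_ ∷ x) i≢j = refl
lookup-clear-≢ (suc i) zero    (_ ∷ x) i≢j = refl
lookup-clear-≢ (suc i) (suc j) (_ ∷ x) i≢j = lookup-clear-≢ i j x (i≢j ∘ cong suc)

∣-vector : ∀ P (x : Vec ℕ t) → (∀ i → P ∣ lookup x i) → ∃ λ y → x ≡ P · y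
∣-vector P []      h = [] , refl
∣-vector P (k ∷ x) h with h zero | ∣-vector P x (h ∘ suc)
... | divides q e | y , e′ = q ∷ y , cong₂ _∷_ (trans e (*-comm q P)) e′

abstract
  -- Factors are discarded while coordinate `i` stays at least `o`; in the remaining `I` no factor
  -- can be spared. The number `m` bounds the rounds.
  cover : ∀ {p} {P : Vec ℕ t → Set p} (i : Fin t) (o : ℕ) → ∀ m ws → length ws ≤ m → All P ws → o ≤ lookup (sumV ws) i →
    ∃₂ λ I rest → All P I × All P rest × sumV ws ≡ sumV I ⊕ sumV rest × o ≤ lookup (sumV I) i ×
      All (λ w → lookup (sumV I) i < o + lookup w i) I
  cover i o m ws len ps o≤ with All.all? (λ w → lookup (sumV ws) i <? o + lookup w i) ws
  ... | yes q = ws , [] , ps , [] , sym (⊕-identityʳ _) , o≤ , q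
  ... | no ¬q with find (AllP.¬All⇒Any¬ (λ w → lookup (sumV ws) i <? o + lookup w i) ws ¬q)
  ... | w , w∈ , ¬lt with MemP.∈-∃++ w∈
  cover i o zero    ws () ps o≤ | no ¬q | w , w∈ , ¬lt | [] , zs , refl
  cover i o zero    ws () ps o≤ | no ¬q | w , w∈ , ¬lt | _ ∷ _ , zs , refl
  cover {P = P} i o (suc m) ws len ps o≤ | no ¬q | w , w∈ , ¬lt | ys , zs , refl
    with AllP.++⁻ ys ps
  ... | pys , pw ∷ pzs with cover i o m (ys ++ zs) len′ (AllP.++⁺ pys pzs) o≤′
    where
    len′ : length (ys ++ zs) ≤ m
    len′ = s≤s⁻¹ (subst (_≤ suc m) (trans (ListP.length-++ ys) (trans (+-suc (length ys) (length zs))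
      (cong suc (sym (ListP.length-++ ys))))) len)
    split : lookup (sumV (ys ++ w ∷ zs)) i ≡ lookup w i + lookup (sumV (ys ++ zs)) i
    split = trans (cong (λ v → lookup v i) (trans (sumV-++ ys (w ∷ zs)) (trans (⊕-swap (sumV ys) w (sumV zs))
      (cong (w ⊕_) (sym (sumV-++ ys zs)))))) (lookup-⊕ w _ i)
    o≤′ : o ≤ lookup (sumV (ys ++ zs)) i
    o≤′ = +-cancelˡ-≤ (lookup w i) _ _ (≤-trans (≤-reflexive (+-comm (lookup w i) o))
      (≤-trans (≮⇒≥ ¬lt) (≤-reflexive split)))
  ... | I , rest , pI , prest , e , oI , min = I , w ∷ rest , pI , pw ∷ prest ,
    trans (sumV-++ ys (w ∷ zs)) (trans (⊕-swap (sumV ys) w (sumV zs))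
      (trans (cong (w ⊕_) (trans (sym (sumV-++ ys zs)) e)) (⊕-swap w (sumV I) (sumV rest)))) ,
    oI , min

length≤lookup : ∀ {i : Fin t} c {ws} → All (λ w → c ≤ lookup w i) ws → length ws * c ≤ lookup (sumV ws) i
length≤lookup c []       = z≤n
length≤lookup {i = i} c {w ∷ ws} (p ∷ ps) = subst (c + length ws * c ≤_) (sym (lookup-⊕ w (sumV ws) i)) (+-mono-≤ p (length≤lookup c ps))

-- Lattices of relations

module Relations {c ℓ : Level} (𝔾 : AbelianGroup c ℓ)
  (_≟ᵍ_ : ∀ x y → Dec (AbelianGroup._≈_ 𝔾 x y))
  (n : ℕ) (0<n : 0 < n)
  (exponent : ∀ g → AbelianGroup._≈_ 𝔾 (Families._⊗_ 𝔾 n g) (AbelianGroup.ε 𝔾)) where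
  open Families 𝔾
  open Decidable _≟ᵍ_
  open Weights 𝔾 _≟ᵍ_ n 0<n exponent

  zs-ordered : (G : Vec C t) (x : Vec ℕ t) → Zs G (ordered G x)
  zs-ordered G x = fact-zs G (fact-ordered G x)

  -- Represents the inverse: `-g` is written as `(ord g - 1) g`, which keeps the exponents natural.
  negated : Vec C t → Vec ℕ t → Vec ℕ t
  negated = zipWith λ g k → k * pred (ord g)

  ⊕-negated : (G : Vec C t) (x : Vec ℕ t) → x ⊕ negated G x ≡ ordered G x
  ⊕-negated []      []      = refl
  ⊕-negated (g ∷ G) (k ∷ x) = cong₂ _∷_
    (trans (sym (*-suc k (pred (ord g)))) (cong (k *_) (suc-pred (ord g) {{>-nonZero (ord-pos g)}})))
    (⊕-negated G x)

  negated-⊕ : (G : Vec C t) (x y : Vec ℕ t) → negated G (x ⊕ y) ≡ negated G x ⊕ negated G y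
  negated-⊕ []      []      []      = refl
  negated-⊕ (g ∷ G) (k ∷ x) (l ∷ y) = cong₂ _∷_ (*-distribʳ-+ (pred (ord g)) k l) (negated-⊕ G x y)

  negated-𝟘 : (G : Vec C t) → negated G 𝟘 ≡ 𝟘
  negated-𝟘 []      = refl
  negated-𝟘 (g ∷ G) = cong (0 ∷_) (negated-𝟘 G)

  lookup-negated : (G : Vec C t) (x : Vec ℕ t) (i : Fin t) →
    lookup (negated G x) i ≡ lookup x i * pred (ord (lookup G i))
  lookup-negated G x i = VecP.lookup-zipWith _ i G x

  zs-negated : (G : Vec C t) {x : Vec ℕ t} → Zs G x → Zs G (negated G x)
  zs-negated G {x} zx = zs-cancelˡ G x (subst (Zs G) (sym (⊕-negated G x)) (zs-ordered G x)) zx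

  -- Reduction modulo the orders leaves only the relations below `ordered G 𝟙`, a range that can be
  -- searched.
  reduced : Vec C t → Vec ℕ t → Vec ℕ t
  reduced []      []      = []
  reduced (g ∷ G) (k ∷ x) = _%_ k (ord g) {{>-nonZero (ord-pos g)}} ∷ reduced G x

  reduced-split : (G : Vec C t) (x : Vec ℕ t) → ∃ λ q → x ≡ ordered G q ⊕ reduced G x
  reduced-split []      []      = [] , refl
  reduced-split (g ∷ G) (k ∷ x) with reduced-split G x
  ... | q , e = _/_ k (ord g) {{>-nonZero (ord-pos g)}} ∷ q ,
    cong₂ _∷_ (trans (m≡m%n+[m/n]*n k (ord g) {{>-nonZero (ord-pos g)}}) (+-comm _ (_/_ k (ord g) {{>-nonZero (ord-pos g)}} * ord g))) e

  reduced-≤ : (G : Vec C t) (x : Vec ℕ t) (i : Fin t) → lookup (reduced G x) i ≤ lookup (ordered G 𝟙) i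
  reduced-≤ (g ∷ G) (k ∷ x) zero    = subst (_%_ k (ord g) {{>-nonZero (ord-pos g)}} ≤_) (sym (+-identityʳ (ord g)))
    (<⇒≤ (m%n<n k (ord g) {{>-nonZero (ord-pos g)}}))
  reduced-≤ (g ∷ G) (k ∷ x) (suc i) = reduced-≤ G x i

  zs-reduced : (G : Vec C t) {x : Vec ℕ t} → Zs G x → Zs G (reduced G x)
  zs-reduced G {x} zx with reduced-split G x
  ... | q , e = zs-cancelˡ G (ordered G q) (subst (Zs G) e zx) (zs-ordered G q)

  lookup-ordered : (G : Vec C t) (x : Vec ℕ t) (i : Fin t) →
    lookup (ordered G x) i ≡ lookup x i * ord (lookup G i)
  lookup-ordered G x i = VecP.lookup-zipWith _ i G x

  wt-ordered : (G : Vec C t) (x : Vec ℕ t) → wt G (ordered G x) ≡ size x * n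
  wt-ordered []      []      = refl
  wt-ordered (g ∷ G) (k ∷ x) = trans (cong₂ _+_
    (trans (*-assoc k (ord g) (weight g)) (cong (k *_) (trans (*-comm (ord g) (weight g)) (weight-ord g))))
    (wt-ordered G x)) (sym (*-distribʳ-+ n k (size x)))

  atom-≤-ordered : (G : Vec C t) {x : Vec ℕ t} → Atom G x → ∀ i → lookup x i ≤ lookup (ordered G 𝟙) i
  atom-≤-ordered G {x} at i = subst (lookup x i ≤_)
    (sym (trans (lookup-ordered G 𝟙 i) (trans (cong (_* ord (lookup G i)) (lookup-𝟙 i)) (+-identityʳ (ord (lookup G i)))))) (atom-coordinate G at i)

  Divisible : ℕ → Vec C t → Set ℓ
  Divisible P E = ∀ x → Zs E x → ∀ i → P ∣ lookup x i

  Spanned : Vec C t → C → Set ℓ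
  Spanned E f = ∃ λ y → eval E y ≈ f

  private
    spanned-∙ : (E : Vec C t) (k : ℕ) {f h : C} → Spanned E f → Spanned E h → Spanned E (k ⊗ f ∙ h)
    spanned-∙ E k (y , ey) (z , ez) =
      k · y ⊕ z , ≈-trans (eval-⊕ E (k · y) z) (∙-cong (≈-trans (eval-· E k y) (×-congʳ k ey)) ez)

    spanned-eval : ∀ {t s} (E : Vec C t) (F : Vec C s) → (∀ j → Spanned E (lookup F j)) → ∀ x → Spanned E (eval F x)
    spanned-eval E []      sp []      = 𝟘 , eval-𝟘 E
    spanned-eval E (f ∷ F) sp (k ∷ x) = spanned-∙ E k (sp zero) (spanned-eval E F (sp ∘ suc) x)

    -- P times a basis of the relations in row echelon form, divided by P
    echelon-step : (P : ℕ) (e : C) (E : Vec C t) → Divisible P (e ∷ E) →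
      (F : Vec C t) → Indep P F → (∀ j → Spanned E (lookup F j)) →
      ∃ λ (F : Vec C (suc t)) → Indep P F × (∀ j → Spanned (e ∷ E) (lookup F j))
    echelon-step P e E dv F (F-ord , F-ind) F-sp = f ∷ F , (ords , ind) , sp
      where
      -- The leading coefficients of relations. Since the tail may be reduced modulo the orders,
      -- membership is decidable, and the least positive coefficient `m` divides all others.
      Q : ℕ → Set ℓ
      Q k = ∃ λ y → Zs (e ∷ E) (k ∷ y)
      Q? : ∀ k → Dec (Q k)
      Q? k = [ (λ (y , _ , z) → yes (y , z)) ,
               (λ none → no λ (y , z) → none (reduced E y) (reduced-≤ E y) (lift y z)) ]′
               (search-below (λ y → Zs? (e ∷ E) (k ∷ y)) (ordered E 𝟙))
        where
        lift : ∀ y → Zs (e ∷ E) (k ∷ y) → Zs (e ∷ E) (k ∷ reduced E y)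
        lift y z = let (q , eq) = reduced-split E y in
          zs-cancelˡ (e ∷ E) (0 ∷ ordered E q) {k ∷ reduced E y} (subst (λ v → Zs (e ∷ E) (k ∷ v)) eq z)
            (≈-trans (identityˡ _) (zs-ordered E q))
      lst = least (λ m → (0 <? m) ×-dec Q? m) n (0<n , 𝟘 , ≈-trans (∙-cong (exponent e) (eval-𝟘 E)) (identityˡ ε))
      m = proj₁ lst
      0<m = proj₁ (proj₁ (proj₂ lst))
      y₀ = proj₁ (proj₂ (proj₁ (proj₂ lst)))
      zy₀ = proj₂ (proj₂ (proj₁ (proj₂ lst)))
      m∣ : ∀ k → Q k → m ∣ k
      m∣ = least-divides m 0<m (proj₂ (proj₂ (proj₂ lst))) λ k (y , z) → y ⊕ negated E y₀ ,
        zs-cancelˡ (e ∷ E) (m ∷ y₀) {k ∷ (y ⊕ negated E y₀)} (subst (λ v → Zs (e ∷ E) (m + k ∷ v)) (⊕-swap y y₀ (negated E y₀))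
          (≈-trans (∙-congˡ (eval-⊕ E y (y₀ ⊕ negated E y₀))) (≈-trans (∙-congˡ (∙-congˡ
            (subst (Zs E) (sym (⊕-negated E y₀)) (zs-ordered E y₀)))) (≈-trans (∙-congˡ (identityʳ _)) z)))) zy₀
      divided = ∣-vector P (m ∷ y₀) (dv (m ∷ y₀) zy₀)
      q = proj₁ divided
      f = eval (e ∷ E) q
      Pf : P ⊗ f ≈ ε
      Pf = ≈-trans (≈-sym (eval-· (e ∷ E) P q)) (subst (Zs (e ∷ E)) (proj₂ divided) zy₀)
      ords : ∀ i → P ⊗ lookup (f ∷ F) i ≈ ε
      ords zero    = Pf
      ords (suc i) = F-ord i
      sp : ∀ j → Spanned (e ∷ E) (lookup (f ∷ F) j)
      sp zero    = q , ≈-refl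
      sp (suc j) = let (y , ey) = F-sp j in 0 ∷ y , ≈-trans (identityˡ _) ey
      ind : ∀ x → Zs (f ∷ F) x → ∀ i → P ∣ lookup x i
      ind (k ∷ x) z = λ { zero → P∣k ; (suc i) → F-ind x zx i }
        where
        w = spanned-eval E F F-sp x
        rel : Zs (e ∷ E) (k · q ⊕ (0 ∷ proj₁ w))
        rel = ≈-trans (eval-⊕ (e ∷ E) (k · q) (0 ∷ proj₁ w)) (≈-trans (∙-cong (eval-· (e ∷ E) k q)
                (≈-trans (identityˡ _) (proj₂ w))) z)
        -- Here `f` is the value of `(m , y₀) / P` and `m = P m′`. A relation with coefficient `k`
        -- at `f` gives one over `e ∷ E` with leading coefficient `k m′`; as `m` divides this, `P`
        -- divides `k`.
        q≡ : ∀ q → m ∷ y₀ ≡ P · q → Zs (e ∷ E) (k · q ⊕ (0 ∷ proj₁ w)) → P ∣ k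
        q≡ (m′ ∷ q′) eq zz = *-cancelʳ-∣ m′ {{≢-nonZero m′≢0}} (subst (_∣ k * m′) m≡ (m∣ (k * m′)
            (k · q′ ⊕ proj₁ w , subst (λ v → Zs (e ∷ E) (v ∷ (k · q′ ⊕ proj₁ w))) (+-identityʳ (k * m′)) zz)))
          where
          m≡ : m ≡ P * m′
          m≡ = VecP.∷-injectiveˡ eq
          m′≢0 : m′ ≢ 0
          m′≢0 m′≡0 = <-irrefl (sym (trans m≡ (trans (cong (P *_) m′≡0) (*-zeroʳ P)))) 0<m
        P∣k : P ∣ k
        P∣k = q≡ q (proj₂ divided) rel
        zx : Zs F x
        zx = begin
          eval F x               ≈⟨ identityˡ _ ⟨
          ε ∙ eval F x           ≈⟨ ∙-congʳ kf ⟨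
          k ⊗ f ∙ eval F x       ≈⟨ z ⟩
          ε                      ∎
          where
          open ≈R
          kf : k ⊗ f ≈ ε
          kf = ≈-trans (×-congˡ (_∣_.equality P∣k)) (≈-trans (≈-sym (×-assocˡ f (quotient P∣k) P))
                 (≈-trans (×-congʳ (quotient P∣k) Pf) (⊗-ε (quotient P∣k))))

    echelon : (P : ℕ) (E : Vec C t) → Divisible P E → ∃ λ (F : Vec C t) → Indep P F × (∀ j → Spanned E (lookup F j))
    echelon P []      dv = [] , ((λ ()) , λ { [] _ () }) , λ ()
    echelon P (e ∷ E) dv =
      let (F , ind , sp) = echelon P E (λ x zx i → dv (0 ∷ x) (≈-trans (identityˡ _) zx) (suc i)) in
      echelon-step P e E dv F ind sp

  abstract
    -- The relation lattice `Λ` has full rank and lies in `P ℤ^t`. Take the values of `b / P` for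
    -- `b` in a basis of `Λ`: they are annihilated by `P`, and a combination of them vanishes only
    -- if the same combination of the `b / P` lies in `Λ`, that is, only with coefficients divisible
    -- by `P`.
    divisible⇒indep : (P : ℕ) (E : Vec C t) → Divisible P E → ∃ λ (F : Vec C t) → Indep P F
    divisible⇒indep P E dv = let (F , ind , _) = echelon P E dv in F , ind

∣-fold-gcd : (o : ℕ) (f : Vec ℕ t → ℕ) (xs : List (Vec ℕ t)) → ∀ x → x ∈ xs → foldr (λ y c → gcd (f y) c) o xs ∣ f x
∣-fold-gcd o f (y ∷ xs) x (here refl) = gcd[m,n]∣m (f y) _
∣-fold-gcd o f (y ∷ xs) x (there x∈) = ∣-trans (gcd[m,n]∣n (f y) _) (∣-fold-gcd o f xs x x∈)

fold-gcd-∣ : (o : ℕ) (f : Vec ℕ t → ℕ) (xs : List (Vec ℕ t)) → foldr (λ y c → gcd (f y) c) o xs ∣ o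
fold-gcd-∣ o f []       = ∣-refl
fold-gcd-∣ o f (y ∷ xs) = ∣-trans (gcd[m,n]∣n (f y) _) (fold-gcd-∣ o f xs)

fold-gcd-closed : ∀ {p} (P : ℕ → Set p) (o : ℕ) (f : Vec ℕ t → ℕ) → P o → (∀ x → P (f x)) →
  (∀ a b → P a → P b → P (gcd a b)) → (xs : List (Vec ℕ t)) → P (foldr (λ y c → gcd (f y) c) o xs)
fold-gcd-closed P o f Po Pf Pg []       = Po
fold-gcd-closed P o f Po Pf Pg (y ∷ xs) = Pg (f y) _ (Pf y) (fold-gcd-closed P o f Po Pf Pg xs)

-- A heavy atom of minimal support

module MinimalSupport {c ℓ : Level} (𝔾 : AbelianGroup c ℓ)
  (_≟ᵍ_ : ∀ x y → Dec (AbelianGroup._≈_ 𝔾 x y))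
  (n : ℕ) (0<n : 0 < n)
  (exponent : ∀ g → AbelianGroup._≈_ 𝔾 (Families._⊗_ 𝔾 n g) (AbelianGroup.ε 𝔾))
  (d : ℕ) (s : ℕ) (g : AbelianGroup.Carrier 𝔾) (E : Vec (AbelianGroup.Carrier 𝔾) s)
  (ul : Families.UL 𝔾 d (g ∷ E))
  (lcn : ∀ {x} → Families.Atom 𝔾 (g ∷ E) x → n ≤ Weights.wt 𝔾 _≟ᵍ_ n 0<n exponent (g ∷ E) x)
  (minimal : ∀ {x} → Families.Atom 𝔾 (g ∷ E) x → ∀ i → lookup x i ≡ 0 →
    Weights.wt 𝔾 _≟ᵍ_ n 0<n exponent (g ∷ E) x ≡ n) where
  open Families 𝔾
  open Decidable _≟ᵍ_
  open Weights 𝔾 _≟ᵍ_ n 0<n exponent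
  open Relations 𝔾 _≟ᵍ_ n 0<n exponent

  private
    G : Vec C (suc s)
    G = g ∷ E
    o = ord g

  -- Compare A with its complement in the product of all g ^ ord g.
  support-size : ∀ {A} → Atom G A → n < wt G A → suc d ≤ s
  support-size {A} at n<A = s≤s⁻¹ (≤-trans (+-monoˡ-≤ d (s≤s 0<λ)) gap)
    where
    open ≤-Reasoning
    A⊑O : A ⊑ ordered G 𝟙
    A⊑O = ≤⇒⊑ A (ordered G 𝟙) (atom-≤-ordered G at)
    A′ = proj₁ A⊑O
    e = proj₂ A⊑O
    fac = factorize G A′ (zs-cancelˡ G A {A′} (subst (Zs G) e (zs-ordered G 𝟙)) (proj₁ at))
    λ′ = proj₁ fac
    fA′ = proj₂ fac
    bound : λ′ * n ≤ wt G A′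
    bound = let (ws , aws , len , eq) = fA′ in
      subst (λ k → k * n ≤ wt G A′) len (wt≤fact G n (All.map lcn aws) eq)
    total : wt G A + wt G A′ ≡ suc s * n
    total = trans (sym (wt-⊕ G A A′)) (trans (cong (wt G) (sym e)) (trans (wt-ordered G 𝟙) (cong (_* n) (size-𝟙 (suc s)))))
    lt : suc λ′ < suc s
    lt = *-cancelʳ-< n (suc λ′) (suc s) (begin-strict
      n + λ′ * n            <⟨ +-mono-<-≤ n<A bound ⟩
      wt G A + wt G A′      ≡⟨ total ⟩
      suc s * n             ∎)
    gap : suc λ′ + d ≤ suc s
    gap = cong-gap (ul (ordered G 𝟙) (suc λ′) (suc s) (fact-subst G (sym e) refl (fact-⊕ G (fact-atom G at) fA′))
      (fact-subst G refl (size-𝟙 (suc s)) (fact-ordered G 𝟙))) lt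
    -- The complement is nonempty, because `A` contains `g` fewer than `ord g` times.
    0<λ : 0 < λ′
    0<λ = n≢0⇒n>0 λ λ≡0 → <-irrefl
      (trans (sym (⊕-identityʳ A ∶ zero)) (trans (cong (λ v → lookup (A ⊕ v) zero) (sym (fact-0 G fA′ λ≡0)))
        (trans (cong (λ v → lookup v zero) (sym e)) (trans (lookup-ordered G 𝟙 zero) (+-identityʳ o)))))
      (atom-off-n G at (λ eq → <-irrefl (sym eq) n<A) zero)
      where
      _∶_ : {x y : Vec ℕ (suc s)} → x ≡ y → (i : Fin (suc s)) → lookup x i ≡ lookup y i
      refl ∶ i = refl

  -- For products of atoms of weight exactly `n`, weight and length determine each other. Relations
  -- that miss a member are always of this kind.
  Good : Vec ℕ (suc s) → Set ℓ
  Good x = ∃ λ ws → All (λ w → Atom G w × wt G w ≡ n) ws × sumV ws ≡ x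

  good-𝟘 : Good 𝟘
  good-𝟘 = [] , [] , refl

  good-⊕ : ∀ {x y} → Good x → Good y → Good (x ⊕ y)
  good-⊕ (us , pu , refl) (vs , pv , refl) = us ++ vs , AllP.++⁺ pu pv , sumV-++ us vs

  good-proper : ∀ {x} i → Zs G x → lookup x i ≡ 0 → Good x
  good-proper {x} i zx xi≡0 = let (_ , ws , aws , _ , e) = factorize G x zx in
    ws , All.zipWith (λ (aw , z) → aw , minimal aw i z) (aws , zero-coordinate i e xi≡0) , e

  good-ordered : ∀ x → Good (ordered G x)
  good-ordered = vec-ind (λ x → Good (ordered G x)) (subst Good (sym (ordered-𝟘 G)) good-𝟘)
    λ i x gx → subst Good (sym (trans (ordered-⊕ G (single i 1) x) (cong (_⊕ ordered G x) (ordered-base G i))))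
      (good-⊕ (base G i ∷ [] , (atom-base G i , wt-base G i) ∷ [] , ⊕-identityʳ (base G i)) gx)

  good⇒fact : ∀ {x} → Good x → ∃ λ k → Fact G x k × k * n ≡ wt G x
  good⇒fact (ws , pw , e) = length ws , (ws , All.map proj₁ pw , refl , e) , wt≡fact G n (All.map proj₂ pw) e

  good-zs : ∀ {x} → Good x → Zs G x
  good-zs gx = fact-zs G (proj₁ (proj₂ (good⇒fact gx)))

  -- The residues modulo `ord g` realised at `g` by sequences that are good together with their
  -- inverses. They form a subgroup of ℤ / ord g containing the values of all relations that miss a
  -- member.
  R : ℕ → Set ℓ
  R v = ∃ λ U → Good U × Good (negated G U) × Cong o (lookup U zero) v

  R-0 : R 0
  R-0 = 𝟘 , good-𝟘 , subst Good (sym (negated-𝟘 G)) good-𝟘 , cong-refl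

  R-+ : ∀ {u v} → R u → R v → R (u + v)
  R-+ {u} {v} (U , gU , nU , cU) (V , gV , nV , cV) = U ⊕ V , good-⊕ gU gV ,
    subst Good (sym (negated-⊕ G U V)) (good-⊕ nU nV) ,
    subst (λ k → Cong o k (u + v)) (sym (lookup-⊕ U V zero)) (cong-+ cU cV)

  R-* : ∀ k {v} → R v → R (k * v)
  R-* zero    r = R-0
  R-* (suc k) r = R-+ r (R-* k r)

  R-cong : ∀ {u v} → Cong o u v → R u → R v
  R-cong c (U , gU , nU , cU) = U , gU , nU , cong-trans cU c

  R-proper : ∀ x i → Zs G x → lookup x i ≡ 0 → R (lookup x zero)
  R-proper x i zx xi≡0 = x , good-proper {x} i zx xi≡0 ,
    good-proper {negated G x} i (zs-negated G {x} zx) (trans (lookup-negated G x i) (cong (_* pred (ord (lookup G i))) xi≡0)) , cong-refl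

  o-1 : ℕ
  o-1 = pred o

  o≡ : suc o-1 ≡ o
  o≡ = suc-pred o {{>-nonZero (ord-pos g)}}

  neg-cong : ∀ x → Cong o (x + o-1 * x) 0
  neg-cong x = 0 , x , trans (+-identityʳ _) (trans (cong (_* x) o≡) (*-comm o x))

  -- Bézout's identity, with `o - 1` in the part of -1 modulo `o`.
  R-gcd : ∀ a b → R a → R b → R (gcd a b)
  R-gcd a b ra rb = go (Bézout.identity (gcd-GCD a b))
    where
    -- if w + y b ≡ x a then w ≡ x a + (o - 1) y b
    step : ∀ w x y {a b} → R a → R b → w + y * b ≡ x * a → R w
    step w x y {a} {b} ra rb e = R-cong (cong-trans (cong-≡ (trans (cong (_+ o-1 * (y * b)) (sym e)) (+-assoc w _ _)))
      (subst (Cong o (w + (y * b + o-1 * (y * b)))) (+-identityʳ w) (cong-+ cong-refl (neg-cong (y * b)))))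
      (R-+ (R-* x ra) (R-* o-1 (R-* y rb)))
    go : Bézout.Identity (gcd a b) a b → R (gcd a b)
    go (Bézout.+- x y e) = step (gcd a b) x y ra rb e
    go (Bézout.-+ x y e) = step (gcd a b) y x rb ra e

  private
    proper? : ∀ x → Dec (Zs G x × ∃ λ i → lookup x i ≡ 0)
    proper? x = Zs? G x ×-dec FinP.any? (λ i → lookup x i ≟ 0)

    val′ : ∀ x → Dec (Zs G x × ∃ λ i → lookup x i ≡ 0) → ℕ
    val′ x (yes _) = lookup x zero
    val′ x (no _)  = 0

    val : Vec ℕ (suc s) → ℕ
    val x = val′ x (proper? x)

    R-val : ∀ x → R (val x)
    R-val x = go (proper? x)
      where
      go : (D : Dec (Zs G x × ∃ λ i → lookup x i ≡ 0)) → R (val′ x D)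
      go (yes (zx , i , xi≡0)) = R-proper x i zx xi≡0
      go (no _)                = R-0

    val-proper : ∀ x → Zs G x → ∀ i → lookup x i ≡ 0 → val x ≡ lookup x zero
    val-proper x zx i xi≡0 = go (proper? x)
      where
      go : (D : Dec (Zs G x × ∃ λ i → lookup x i ≡ 0)) → val′ x D ≡ lookup x zero
      go (yes _) = refl
      go (no ¬p) = ⊥-elim (¬p (zx , i , xi≡0))

    candidates : List (Vec ℕ (suc s))
    candidates = below (ordered G 𝟙)

  abstract
    -- Generator of the group of values at `g` of relations that miss a member. Reduction modulo the
    -- orders makes finitely many candidates sufficient, other candidates contribute 0, and starting
    -- from `o` accounts for the modulus.
    γ : ℕ
    γ = foldr (λ y c → gcd (val y) c) o candidates

    γ∣o : γ ∣ o
    γ∣o = fold-gcd-∣ o val candidates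

    R-γ : R γ
    R-γ = fold-gcd-closed R o val (R-cong (1 , 0 , refl) R-0) R-val R-gcd candidates

    γ∣val : ∀ x → x ∈ candidates → γ ∣ val x
    γ∣val = ∣-fold-gcd o val candidates

  γ∣proper : ∀ x → Zs G x → ∀ i → lookup x i ≡ 0 → γ ∣ lookup x zero
  γ∣proper x zx i xi≡0 = subst (γ ∣_) (sym (trans (cong (λ v → lookup v zero) e) (lookup-⊕ (ordered G q) x′ zero)))
    (∣m∣n⇒∣m+n (subst (γ ∣_) (sym (lookup-ordered G q zero)) (∣-trans γ∣o (n∣m*n (lookup q zero))))
      (subst (γ ∣_) (val-proper x′ (zs-reduced G {x} zx) i x′i≡0)
        (γ∣val x′ (below-complete x′ (ordered G 𝟙) (reduced-≤ G x)))))
    where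
    x′ = reduced G x
    q = proj₁ (reduced-split G x)
    e : x ≡ ordered G q ⊕ x′
    e = proj₂ (reduced-split G x)
    x′i≡0 : lookup x′ i ≡ 0
    x′i≡0 = m+n≡0⇒n≡0 (lookup (ordered G q) i) (trans (sym (lookup-⊕ (ordered G q) x′ i))
      (trans (cong (λ v → lookup v i) (sym e)) xi≡0))

  0<γ : 0 < γ
  0<γ = n≢0⇒n>0 λ γ≡0 → <-irrefl (sym (0∣⇒≡0 (subst (_∣ o) γ≡0 γ∣o))) (ord-pos g)

  -- If some relation has coordinate at g outside γℤ, then the relations among the other members are all divisible.
  divisible-case : ∀ {B} → Zs G B → ¬ γ ∣ lookup B zero → ∃ λ P → 2 ≤ P × IndepExists P s
  divisible-case {B} zB ¬∣ = let (P , 2≤P , h) = ∣-reduce 0<γ ¬∣ in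
    P , 2≤P , divisible⇒indep P E λ x zx j → h (lookup x j) (key x zx j)
    where
    key : ∀ x → Zs E x → ∀ j → γ ∣ lookup x j * lookup B zero
    key x zx j = subst (γ ∣_) y₀ (γ∣proper (clear (suc j) y)
        (zs-cancelˡ G (single (suc j) (lookup y (suc j))) {clear (suc j) y} (subst (Zs G) (clear-split (suc j) y) zy) zsingle)
        (suc j) (lookup-clear (suc j) y))
      where
      xj = lookup x j
      bj = lookup B (suc j)
      oj = ord (lookup E j)
      -- The combination `x_j B - b_j x` has at member `j` a multiple of its order, which can be
      -- cleared. The rest misses `j`, so `γ` divides its coordinate at `g`, which is `x_j` times
      -- that of `B`.
      y = xj · B ⊕ bj · negated G (0 ∷ x)
      zy : Zs G y
      zy = zs-⊕ G {xj · B} {bj · negated G (0 ∷ x)} (zs-· G xj {B} zB) (zs-· G bj {negated G (0 ∷ x)} (zs-negated G {0 ∷ x} (≈-trans (identityˡ (eval E x)) zx)))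
      yj : lookup y (suc j) ≡ (bj * xj) * oj
      yj = trans (lookup-⊕ (xj · B) (bj · negated G (0 ∷ x)) (suc j)) (trans (cong₂ _+_ (lookup-· xj B (suc j))
        (trans (lookup-· bj (negated G (0 ∷ x)) (suc j)) (cong (bj *_) (lookup-negated G (0 ∷ x) (suc j)))))
        (trans (sh xj bj (pred oj)) (cong (bj * xj *_) (suc-pred oj {{>-nonZero (ord-pos (lookup E j))}}))))
        where
        sh : ∀ x b p → x * b + b * (x * p) ≡ b * x * suc p
        sh = solve-∀
      zsingle : Zs G (single (suc j) (lookup y (suc j)))
      zsingle = ≈-trans (eval-single G (suc j) _) (≈-trans (×-congˡ yj)
        (≈-trans (≈-sym (×-assocˡ (lookup E j) (bj * xj) oj)) (≈-trans (×-congʳ (bj * xj) (ord-⊗ (lookup E j))) (⊗-ε (bj * xj)))))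
      y₀ : lookup (clear (suc j) y) zero ≡ xj * lookup B zero
      y₀ = trans (lookup-clear-≢ (suc j) zero y (λ ()))
        (trans (lookup-⊕ (xj · B) (bj · negated G (0 ∷ x)) zero) (trans (cong₂ _+_ (lookup-· xj B zero)
          (trans (lookup-· bj (negated G (0 ∷ x)) zero) (*-zeroʳ bj))) (+-identityʳ _)))

  module _ (γ∣atoms : ∀ {B} → Atom G B → γ ∣ lookup B zero) where

    -- `U` is chosen with the negative of the coordinate of `A` at `g`, modulo `o`. Then `A U`
    -- consists of copies of `g ^ o` and a part missing `g`, hence is good. Multiplying also by the
    -- good inverse of `U` turns the multiplier into a product of powers `g_i ^ ord g_i`.
    good-multiple : ∀ {A} → Atom G A → ∃ λ U → Good U × Good (A ⊕ U) × Good (A ⊕ ordered G U)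
    good-multiple {A} at = U , gU , gAU , subst Good (trans (⊕-assoc A U (negated G U)) (cong (A ⊕_) (⊕-negated G U))) (good-⊕ gAU nU)
      where
      v = lookup A zero
      r : R (o-1 * v)
      r = subst (λ k → R (o-1 * k)) (sym (_∣_.equality (γ∣atoms at))) (R-* o-1 (R-* (quotient (γ∣atoms at)) R-γ))
      U = proj₁ r
      gU = proj₁ (proj₂ r)
      nU = proj₁ (proj₂ (proj₂ r))
      AU = A ⊕ U
      o∣ : o ∣ lookup AU zero
      o∣ = cong-0⇒∣ (subst (λ k → Cong o k 0) (sym (lookup-⊕ A U zero))
        (cong-trans (cong-+ (cong-refl {k = v}) (proj₂ (proj₂ (proj₂ r)))) (neg-cong v)))
      q = quotient o∣
      head≡ : single zero (lookup AU zero) ≡ ordered G (single zero q)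
      head≡ = trans (cong (single zero) (_∣_.equality o∣)) (sym (ordered-single G zero q))
      gAU : Good AU
      gAU = subst Good (sym (clear-split zero AU)) (good-⊕ (subst Good (sym head≡) (good-ordered (single zero q)))
        (good-proper {clear zero AU} zero (zs-cancelˡ G (single zero (lookup AU zero)) {clear zero AU}
          (subst (Zs G) (clear-split zero AU) (zs-⊕ G {A} {U} (proj₁ at) (good-zs gU)))
          (subst (Zs G) (sym head≡) (zs-ordered G (single zero q)))) (lookup-clear zero AU)))

    -- Multiplication by `U` yields lengths `k + 1` and `l` with `l n = wt A + k n > (k + 1) n`;
    -- these differ by at least `d`.
    big-atom : ∀ {A} → Atom G A → n < wt G A → n * suc d ≤ wt G A
    big-atom {A} at n<A =
      let (U , gU , gAU , _) = good-multiple at ; (k , fU , wU) = good⇒fact gU ; (l , fAU , wAU) = good⇒fact gAU in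
      gap U k l fU wU fAU wAU
      where
      gap : ∀ U k l → Fact G U k → k * n ≡ wt G U → Fact G (A ⊕ U) l → l * n ≡ wt G (A ⊕ U) → n * suc d ≤ wt G A
      gap U k l fU wU fAU wAU = +-cancelʳ-≤ (wt G U) _ _ (begin
        n * suc d + wt G U             ≡⟨ cong (n * suc d +_) wU ⟨
        n * suc d + k * n              ≡⟨ sh n d k ⟩
        (suc k + d) * n                ≤⟨ *-monoˡ-≤ n (cong-gap (ul (A ⊕ U) (suc k) l (fact-⊕ G (fact-atom G at) fU) fAU) k<l) ⟩
        l * n                          ≡⟨ wAU ⟩
        wt G (A ⊕ U)                   ≡⟨ wt-⊕ G A U ⟩
        wt G A + wt G U                ∎)
        where
        open ≤-Reasoning
        sh : ∀ n d k → n * suc d + k * n ≡ (suc k + d) * n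
        sh = solve-∀
        k<l : suc k < l
        k<l = *-cancelʳ-< n (suc k) l (begin-strict
          n + k * n                <⟨ +-monoˡ-< (k * n) n<A ⟩
          wt G A + k * n           ≡⟨ cong (wt G A +_) wU ⟩
          wt G A + wt G U          ≡⟨ wt-⊕ G A U ⟨
          wt G (A ⊕ U)             ≡⟨ wAU ⟨
          l * n                    ∎)

    ⊑-sum : ∀ {w : Vec ℕ (suc s)} {ws} → w ∈ ws → w ⊑ sumV ws
    ⊑-sum {ws = _ ∷ ws} (here refl) = sumV ws , refl
    ⊑-sum {w} {v ∷ ws} (there w∈) = let (r , e) = ⊑-sum w∈ in v ⊕ r , trans (cong (v ⊕_) e) (⊕-swap v w r)

    -- A minimal subproduct I covering g_i ^ ord g_i, with quotient N having a bad factor B, is long and meets g_i at least twice everywhere.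
    long-cover : ∀ i I N → All (λ w → Atom G w × wt G w ≡ n) I → sumV I ≡ base G i ⊕ N →
      All (λ w → lookup (sumV I) i < ord (lookup G i) + lookup w i) I →
      ∀ {vs B} → All (Atom G) vs → sumV vs ≡ N → B ∈ vs → wt G B ≢ n → 3 + 2 * d ≤ n
    long-cover i I N pI eN minI {vs} {B} avs evs B∈ B≢n = ≤-trans (bound I long two minI) (ord≤n (lookup G i))
      where
      oi v : ℕ
      oi = ord (lookup G i)
      v = lookup N i
      atB : Atom G B
      atB = All.lookup avs B∈
      0<v : 0 < v
      0<v = n≢0⇒n>0 λ v≡0 → B≢n (minimal atB i (All.lookup (zero-coordinate i evs v≡0) B∈))
      Ii : lookup (sumV I) i ≡ oi + v
      Ii = trans (cong (λ v → lookup v i) eN) (trans (lookup-⊕ (base G i) N i) (cong (_+ v) (lookup-single i oi)))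
      two : All (λ w → 2 ≤ lookup w i) I
      two = All.map (λ {w} lt → ≤-trans (s≤s 0<v) (+-cancelˡ-< oi v (lookup w i) (subst (_< oi + lookup w i) Ii lt))) minI
      B≤N : wt G B ≤ wt G N
      B≤N = let (r , er) = subst (B ⊑_) evs (⊑-sum B∈) in
        subst (wt G B ≤_) (sym (trans (cong (wt G) er) (wt-⊕ G B r))) (m≤m+n (wt G B) (wt G r))
      -- By `big-atom` the bad factor weighs at least `n (d + 1)`; together with `g_i ^ ord g_i`
      -- this takes `d + 2` atoms of weight `n`.
      long : 2 + d ≤ length I
      long = *-cancelʳ-≤ (2 + d) (length I) n {{>-nonZero 0<n}} (begin
        (2 + d) * n                   ≡⟨ cong (n +_) (*-comm (suc d) n) ⟩
        n + n * suc d                 ≤⟨ +-monoʳ-≤ n (big-atom atB (≤∧≢⇒< (lcn atB) (B≢n ∘ sym))) ⟩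
        n + wt G B                    ≤⟨ +-monoʳ-≤ n B≤N ⟩
        n + wt G N                    ≡⟨ cong (_+ wt G N) (wt-base G i) ⟨
        wt G (base G i) + wt G N      ≡⟨ wt-⊕ G (base G i) N ⟨
        wt G (base G i ⊕ N)           ≡⟨ cong (wt G) eN ⟨
        wt G (sumV I)                 ≡⟨ wt≡fact G n (All.map proj₂ pI) refl ⟨
        length I * n                  ∎)
        where open ≤-Reasoning
      -- Without one of its atoms, `I` still has `d + 1` atoms that contain `g_i` at least twice
      -- each, but together fewer than `ord g_i` times.
      bound : ∀ I → 2 + d ≤ length I → All (λ w → 2 ≤ lookup w i) I → All (λ w → lookup (sumV I) i < oi + lookup w i) I →
        3 + 2 * d ≤ oi
      bound (w ∷ I′) long (_ ∷ two′) (lt ∷ _) = begin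
        3 + 2 * d                      ≡⟨ cong suc (sh d) ⟩
        suc (suc d * 2)                ≤⟨ s≤s (*-monoˡ-≤ 2 (s≤s⁻¹ long)) ⟩
        suc (length I′ * 2)            ≤⟨ s≤s (length≤lookup 2 two′) ⟩
        suc (lookup (sumV I′) i)       ≤⟨ +-cancelʳ-< (lookup w i) (lookup (sumV I′) i) oi
                                           (subst (_< oi + lookup w i) (trans (lookup-⊕ w (sumV I′) i) (+-comm (lookup w i) _)) lt) ⟩
        oi                             ∎
        where
        open ≤-Reasoning
        sh : ∀ d → 2 + 2 * d ≡ suc d * 2
        sh = solve-∀

    -- The factor `g_i ^ ord g_i` is cut out of a minimal subproduct `I` that covers it, leaving
    -- `N`. If all factors of `N` weigh `n`, then `X` is good again; otherwise a bad factor forces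
    -- `I` to be long.
    descent-step : ∀ X i → (Good X → 3 + 2 * d ≤ n) → Good (base G i ⊕ X) → 3 + 2 * d ≤ n
    descent-step X i rec (ws , pw , e) =
      let (I , rest , pI , prest , eI , oI , minI) = cover i (ord (lookup G i)) (length ws) ws ≤-refl pw covered
          (N , eN) = single-⊑ i (ord (lookup G i)) (sumV I) oI
          (_ , vs , avs , _ , evs) = factorize G N (zs-cancelˡ G (base G i) {N} (subst (Zs G) eN (good-zs (I , pI , refl))) (zs-base G i))
      in conclude I rest N vs pI prest eN minI avs evs
           (⊕-cancelˡ (base G i) (trans (sym e) (trans eI (trans (cong (_⊕ sumV rest) eN) (⊕-assoc (base G i) N (sumV rest))))))
      where
      covered : ord (lookup G i) ≤ lookup (sumV ws) i
      covered = subst₂ _≤_ (lookup-single i (ord (lookup G i))) (cong (λ v → lookup v i) (sym e)) (⊑⇒≤ {x = base G i} {base G i ⊕ X} (X , refl) i)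
      conclude : ∀ I rest N vs → All (λ w → Atom G w × wt G w ≡ n) I → All (λ w → Atom G w × wt G w ≡ n) rest →
        sumV I ≡ base G i ⊕ N → All (λ w → lookup (sumV I) i < ord (lookup G i) + lookup w i) I →
        All (Atom G) vs → sumV vs ≡ N → X ≡ N ⊕ sumV rest → 3 + 2 * d ≤ n
      conclude I rest N vs pI prest eN minI avs evs eX with All.all? (λ w → wt G w ≟ n) vs
      ... | yes all = rec (subst Good (sym eX) (good-⊕ (vs , All.zip (avs , all) , evs) (rest , prest , refl)))
      ... | no ¬all = let (B , B∈ , B≢n) = find (AllP.¬All⇒Any¬ (λ w → wt G w ≟ n) vs ¬all) in
                      long-cover i I N pI eN minI avs evs B∈ B≢n

    -- Removing the powers `g_i ^ ord g_i` one after the other would finally make the atom `A`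
    -- itself good, that is, of weight `n`.
    descent : ∀ {A} → Atom G A → n < wt G A → ∀ J → Good (A ⊕ ordered G J) → 3 + 2 * d ≤ n
    descent {A} at n<A = vec-ind (λ J → Good (A ⊕ ordered G J) → 3 + 2 * d ≤ n)
      (λ gA → let (k , fA , wA) = good⇒fact (subst Good (trans (cong (A ⊕_) (ordered-𝟘 G)) (⊕-identityʳ A)) gA) in
        ⊥-elim (<-irrefl (sym (trans (sym wA) (trans (cong (_* n) (atom-fact G at fA)) (*-identityˡ n)))) n<A))
      λ i J rec g → descent-step (A ⊕ ordered G J) i rec (subst Good (trans (cong (A ⊕_)
        (trans (ordered-⊕ G (single i 1) J) (cong (_⊕ ordered G J) (ordered-base G i)))) (⊕-swap A (base G i) (ordered G J))) g)

  minimal-support : ∀ {A} → Atom G A → n < wt G A →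
    3 + 2 * d ≤ n ⊎ ∃ λ P → 2 ≤ P × IndepExists P (suc d)
  minimal-support {A} at n<A =
    [ (λ (B , _ , atB , ¬∣) → let (P , 2≤P , F , ind) = divisible-case {B} (proj₁ atB) ¬∣ in
        inj₂ (P , 2≤P , indep-shorten (support-size at n<A) F ind)) ,
      (λ none → inj₁ (let h = γ∣atoms none ; (U , _ , _ , gd) = good-multiple h at in descent h at n<A U gd)) ]′
    (search-below (λ B → Atom? G B ×-dec ¬? (γ ∣? lookup B zero)) (ordered G 𝟙))
    where
    γ∣atoms : (∀ u → (∀ i → lookup u i ≤ lookup (ordered G 𝟙) i) → ¬ (Atom G u × ¬ γ ∣ lookup u zero)) →
      ∀ {B} → Atom G B → γ ∣ lookup B zero
    γ∣atoms none {B} atB with γ ∣? lookup B zero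
    ... | yes p = p
    ... | no ¬p = ⊥-elim (none B (atom-≤-ordered G atB) (atB , ¬p))

-- Weights and elasticity for large differences

module Structure {c ℓ : Level} (𝔾 : AbelianGroup c ℓ)
  (_≟ᵍ_ : ∀ x y → Dec (AbelianGroup._≈_ 𝔾 x y))
  (n : ℕ) (0<n : 0 < n)
  (exponent : ∀ g → AbelianGroup._≈_ 𝔾 (Families._⊗_ 𝔾 n g) (AbelianGroup.ε 𝔾)) where
  open Families 𝔾
  open Decidable _≟ᵍ_
  open Weights 𝔾 _≟ᵍ_ n 0<n exponent
  open Relations 𝔾 _≟ᵍ_ n 0<n exponent

  Exceptional : ℕ → Set (c Level.⊔ ℓ)
  Exceptional d = 3 + 2 * d ≤ n ⊎ ∃ λ P → 2 ≤ P × IndepExists P (suc d)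

  private
    restrict-atom : (G : Vec C t) {A : Vec ℕ t} → Atom G A → Atom (restrict (support A) G) (restrict (support A) A)
    restrict-atom G {A} at = atom-extend⁻¹ (support A) G (subst (Atom G) (sym (extend-support A)) at)

    restrict-wt : (G : Vec C t) (A : Vec ℕ t) → wt G A ≡ wt (restrict (support A) G) (restrict (support A) A)
    restrict-wt G A = trans (cong (wt G) (sym (extend-support A))) (wt-restrict (support A) G (restrict (support A) A))

    Claim : ℕ → ℕ → Set (c Level.⊔ ℓ)
    Claim d t = ∀ (G : Vec C t) → UL d G → ∀ A → Atom G A → n < wt G A → (∀ i → 0 < lookup A i) →
      (∃ λ B → Atom G B × wt G B < n) ⊎ Exceptional d

    -- Well-founded induction on the number of members. In the absence of light atoms, an atom of
    -- weight other than `n` that misses a member is heavy, and one restricts to its support. If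
    -- there is no such atom, `MinimalSupport` applies.
    claim : ∀ d t → Claim d t
    claim d = <-rec (Claim d) step
      where
      step : ∀ t → (∀ {s} → s < t → Claim d s) → Claim d t
      step zero    rec [] ul [] at n<A full = ⊥-elim (proj₁ (proj₂ at) refl)
      step (suc s) rec G@(g ∷ E) ul A at n<A full =
        [ (λ (B , _ , r) → inj₁ (B , r)) ,
          (λ none₁ → [ (λ (B , _ , atB , (i , Bi≡0) , B≢n) → descend none₁ B atB i Bi≡0 B≢n) ,
                       (λ none₂ → inj₂ (finish none₁ none₂)) ]′
            (search-below (λ B → Atom? G B ×-dec FinP.any? (λ i → lookup B i ≟ 0) ×-dec ¬? (wt G B ≟ n)) (ordered G 𝟙))) ]′
        (search-below (λ B → Atom? G B ×-dec (wt G B <? n)) (ordered G 𝟙))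
        where
        None₁ None₂ : Set ℓ
        None₁ = ∀ u → (∀ i → lookup u i ≤ lookup (ordered G 𝟙) i) → ¬ (Atom G u × wt G u < n)
        None₂ = ∀ u → (∀ i → lookup u i ≤ lookup (ordered G 𝟙) i) → ¬ (Atom G u × (∃ λ i → lookup u i ≡ 0) × wt G u ≢ n)
        lcn : None₁ → ∀ {x} → Atom G x → n ≤ wt G x
        lcn none₁ {x} atx = ≮⇒≥ λ lt → none₁ x (atom-≤-ordered G atx) (atx , lt)
        minimal : None₂ → ∀ {x} → Atom G x → ∀ i → lookup x i ≡ 0 → wt G x ≡ n
        minimal none₂ {x} atx i xi≡0 with wt G x ≟ n
        ... | yes p = p
        ... | no ¬p = ⊥-elim (none₂ x (atom-≤-ordered G atx) (atx , (i , xi≡0) , ¬p))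
        descend : None₁ → ∀ B → Atom G B → ∀ i → lookup B i ≡ 0 → wt G B ≢ n →
          (∃ λ B → Atom G B × wt G B < n) ⊎ Exceptional d
        descend none₁ B atB i Bi≡0 B≢n =
          [ (λ (D , atD , lt) → inj₁ (extend m D , atom-extend m G atD , subst (_< n) (sym (wt-restrict m G D)) lt)) , inj₂ ]′
          (rec (mask-size-support-< B i Bi≡0) (restrict m G) (UL-restrict m G ul) (restrict m B) (restrict-atom G atB)
            (subst (n <_) (restrict-wt G B) (≤∧≢⇒< (lcn none₁ atB) (B≢n ∘ sym))) (restrict-support-pos B))
          where m = support B
        finish : None₁ → None₂ → Exceptional d
        finish none₁ none₂ = MinimalSupport.minimal-support 𝔾 _≟ᵍ_ n 0<n exponent d s g E ul (lcn none₁) (minimal none₂) at n<A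

  heavy-atom : (d : ℕ) (G : Vec C t) → UL d G → ∀ A → Atom G A → n < wt G A →
    (∃ λ B → Atom G B × wt G B < n × (∀ i → 0 < lookup B i → 0 < lookup A i)) ⊎ Exceptional d
  heavy-atom d G ul A at n<A =
    [ (λ (B , atB , lt) → inj₁ (extend m B , atom-extend m G atB , subst (_< n) (sym (wt-restrict m G B)) lt ,
        extend-support-pos A B)) , inj₂ ]′
    (claim d (mask-size m) (restrict m G) (UL-restrict m G ul) (restrict m A) (restrict-atom G at)
      (subst (n <_) (restrict-wt G A) n<A) (restrict-support-pos A))
    where m = support A

  module _ (d : ℕ) (n≤2d+1 : n ≤ suc (2 * d)) (no-indep : ∀ P → 2 ≤ P → ¬ IndepExists P (suc d)) where
    open SmallAtoms 𝔾 _≟ᵍ_ n 0<n exponent d n≤2d+1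

    not-exceptional : ¬ Exceptional d
    not-exceptional (inj₁ p) = <-irrefl refl (≤-trans (≤-trans (n≤1+n _) p) n≤2d+1)
    not-exceptional (inj₂ (P , 2≤P , ind)) = no-indep P 2≤P ind

    -- Inside the support of a heavy atom there would be a light one. Being squarefree it divides
    -- the heavy atom, hence equals it.
    wt≤n : (G : Vec C t) → UL d G → ∀ {A} → Atom G A → wt G A ≤ n
    wt≤n G ul {A} at with wt G A ≤? n
    ... | yes p = p
    ... | no ¬p = [ (λ (B , atB , B<n , h) → ⊥-elim (¬p (<⇒≤ (subst (λ v → wt G v < n)
                      (atom-min G at (proj₁ atB) (proj₁ (proj₂ atB)) (small-⊑ G ul atB B<n h)) B<n)))) ,
                    (λ e → ⊥-elim (not-exceptional e)) ]′
                  (heavy-atom d G ul A at (≰⇒> ¬p))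

    -- As no atom weighs more than `n`, a longer factorization cannot consist of atoms of weight `n`
    -- alone. It contains a light atom, whose weight `k + 1 = n - d` is the minimum; comparing the
    -- weights of the two factorizations bounds `q / p`.
    large-distance : ∀ {p q} → HasLengths d p q → p < q →
      ∃ λ k → 1 ≤ k × suc k + d ≡ n × q * suc k ≤ p * n × IndepExists n k
    large-distance (_ , G , ul , x , (us , aus , refl , eu) , (vs , avs , refl , ev)) p<q with All.all? (λ w → wt G w ≟ n) vs
    ... | yes all = ⊥-elim (<⇒≱ p<q (*-cancelʳ-≤ (length vs) (length us) n {{>-nonZero 0<n}}
            (≤-trans (≤-reflexive (wt≡fact G n all ev)) (fact≤wt G n (All.map (wt≤n G ul) aus) eu))))
    ... | no ¬all with find (AllP.¬All⇒Any¬ (λ w → wt G w ≟ n) vs ¬all)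
    ... | A , A∈ , A≢n with ≤∧≢⇒< (wt≤n G ul (All.lookup avs A∈)) A≢n
    ... | A<n with small-atom-indep G ul (All.lookup avs A∈) A<n
    ... | k , e , ind = k , s≤s⁻¹ (subst (2 ≤_) μ≡ (2≤wt G atA A≢n)) , e ,
          ≤-trans (≤-trans (≤-reflexive (cong (length vs *_) (sym μ≡))) (fact-μ G ul atA A<n (vs , avs , refl , ev)))
            (fact≤wt G n (All.map (wt≤n G ul) aus) eu) , ind
      where
      atA = All.lookup avs A∈
      μ≡ : wt G A ≡ suc k
      μ≡ = +-cancelʳ-≡ d (wt G A) (suc k) (trans (small-wt G ul atA A<n) (sym e))

cong-≤ : ∀ {d k l} → Cong d k l → k ≤ l → ∃ λ j → l ≡ k + j * d
cong-≤ {d} {k} {l} c k≤l with k ≟ l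
... | yes refl = 0 , sym (+-identityʳ k)
... | no k≢l = let (j , e) = cong-< c (≤∧≢⇒< k≤l k≢l) in suc j , e

-- two lengths k, l computed from the same x by n k = |x| + d v, where v is determined modulo n
cong-from-count : ∀ {n d} x {k l v w} → 0 < n → n * k ≡ x + d * v → n * l ≡ x + d * w → Cong n v w → Cong d k l
cong-from-count {n} {d} x {k} {l} {v} {w} 0<n ek el (a , b , e) = a , b ,
  *-cancelˡ-≡ (k + a * d) (l + b * d) n {{>-nonZero 0<n}} (begin
    n * (k + a * d)            ≡⟨ sh₁ n k a d ⟩
    n * k + d * (a * n)        ≡⟨ cong (_+ d * (a * n)) ek ⟩
    x + d * v + d * (a * n)    ≡⟨ sh₂ x d v (a * n) ⟩
    x + d * (v + a * n)        ≡⟨ cong (λ y → x + d * y) e ⟩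
    x + d * (w + b * n)        ≡⟨ sh₂ x d w (b * n) ⟨
    x + d * w + d * (b * n)    ≡⟨ cong (_+ d * (b * n)) el ⟨
    n * l + d * (b * n)        ≡⟨ sh₁ n l b d ⟨
    n * (l + b * d)            ∎)
  where
  open ≡-Reasoning
  sh₁ : ∀ n k a d → n * (k + a * d) ≡ n * k + d * (a * n)
  sh₁ = solve-∀
  sh₂ : ∀ x d v y → x + d * v + d * y ≡ x + d * (v + y)
  sh₂ = solve-∀

size-· : ∀ k (x : Vec ℕ t) → size (k · x) ≡ k * size x
size-· k []      = sym (*-zeroʳ k)
size-· k (a ∷ x) = trans (cong (k * a +_) (size-· k x)) (sym (*-distribˡ-+ k a (size x)))

-- Independent elements together with plus or minus their sum

module IndependentFamilies {c ℓ : Level} (𝔾 : AbelianGroup c ℓ)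
  (_≟ᵍ_ : ∀ x y → Dec (AbelianGroup._≈_ 𝔾 x y))
  (n : ℕ) (0<n : 0 < n)
  (exponent : ∀ g → AbelianGroup._≈_ 𝔾 (Families._⊗_ 𝔾 n g) (AbelianGroup.ε 𝔾))
  (P : ℕ) (2≤P : 2 ≤ P) (s : ℕ) (F : Vec (AbelianGroup.Carrier 𝔾) (suc s)) (indep : Families.Indep 𝔾 P F) where
  open Families 𝔾
  open Decidable _≟ᵍ_
  open Weights 𝔾 _≟ᵍ_ n 0<n exponent

  private
    0<P : 0 < P
    0<P = ≤-trans (s≤s z≤n) 2≤P

    ord≡ : ∀ g → P ⊗ g ≈ ε → (∀ k → k ⊗ g ≈ ε → P ∣ k) → ord g ≡ P
    ord≡ g Pg h = ∣-antisym (ord-∣ g P Pg) (h (ord g) (ord-⊗ g))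

  zs-divisible : ∀ x → (∀ i → P ∣ lookup x i) → Zs F x
  zs-divisible x h = let (q , e) = ∣-vector P x h in
    ≈-trans (subst (λ v → eval F x ≈ eval F v) e ≈-refl) (≈-trans (eval-· F P q) (⊗-eval P F (proj₁ indep) q))

  -- The multiplier `c` is a unit modulo `P`, so that the adjoined element has order `P` as well;
  -- the values used are -1, written `pred P`, and 1.
  module WithSum (c : ℕ) (c-unit : ∀ k → P ∣ k * c → P ∣ k) where
    G : Vec C (suc (suc s))
    G = eval F (c · 𝟙) ∷ F

    private
      eval-G : ∀ a x → eval G (a ∷ x) ≈ eval F (a · (c · 𝟙) ⊕ x)
      eval-G a x = ≈-sym (≈-trans (eval-⊕ F (a · (c · 𝟙)) x) (∙-congʳ (eval-· F a (c · 𝟙))))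

      coordinate : ∀ {t} a (x : Vec ℕ t) i → lookup (a · (c · 𝟙) ⊕ x) i ≡ a * c + lookup x i
      coordinate {t} a x i = trans (lookup-⊕ (a · (c · 𝟙 {t})) x i) (cong (_+ lookup x i) (trans (lookup-· a (c · 𝟙 {t}) i)
        (cong (a *_) (trans (lookup-· c (𝟙 {t}) i) (trans (cong (c *_) (lookup-𝟙 i)) (*-identityʳ c))))))

    zs⇒∣ : ∀ a x → Zs G (a ∷ x) → ∀ i → P ∣ a * c + lookup x i
    zs⇒∣ a x z i = subst (P ∣_) (coordinate {suc s} a x i) (proj₂ indep (a · (c · 𝟙) ⊕ x) (≈-trans (≈-sym (eval-G a x)) z) i)

    ∣⇒zs : ∀ a x → (∀ i → P ∣ a * c + lookup x i) → Zs G (a ∷ x)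
    ∣⇒zs a x h = ≈-trans (eval-G a x) (zs-divisible (a · (c · 𝟙) ⊕ x) λ i → subst (P ∣_) (sym (coordinate {suc s} a x i)) (h i))

    ords : ∀ i → ord (lookup G i) ≡ P
    ords zero    = ord≡ _ (⊗-eval P F (proj₁ indep) (c · 𝟙)) λ k kh → c-unit k (subst (P ∣_) (+-identityʳ (k * c))
      (zs⇒∣ k 𝟘 (≈-trans (∙-congˡ (eval-𝟘 F)) (≈-trans (identityʳ _) kh)) zero))
    ords (suc i) = ord≡ _ (proj₁ indep i) λ k kf → subst (P ∣_) (lookup-single i k)
      (proj₂ indep (single i k) (≈-trans (eval-single F i k) kf) i)

    ordered≡ : ∀ x → ordered G x ≡ P · x
    ordered≡ x = vec-ext {x = ordered G x} {P · x} λ i → trans (VecP.lookup-zipWith _ i G x)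
      (trans (cong (lookup x i *_) (ords i)) (trans (*-comm (lookup x i) P) (sym (lookup-· P x i))))

    fact-P· : ∀ x → Fact G (P · x) (size x)
    fact-P· x = fact-subst G (ordered≡ x) refl (fact-ordered G x)

    atom-≥P : ∀ {x} → Atom G x → ∀ i → P ≤ lookup x i → x ≡ single i P
    atom-≥P {x} at i P≤ = trans (sym (atom-min G at (zs-base G i) (base≢𝟘 G i)
      (single-⊑ i (ord (lookup G i)) x (subst (_≤ lookup x i) (sym (ords i)) P≤)))) (cong (single i) (ords i))

  module MinusSum (d : ℕ) (2+s+d≡P : suc (suc s) + d ≡ P) where
    private
      κ = pred P
      sκ≡P : suc κ ≡ P
      sκ≡P = suc-pred P {{>-nonZero 0<P}}
      k*P : ∀ k → k * κ + k ≡ k * P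
      k*P k = trans (+-comm (k * κ) k) (trans (sym (*-suc k κ)) (cong (k *_) sκ≡P))

    open WithSum κ (λ k h → ∣m+n∣m⇒∣n (subst (P ∣_) (sym (k*P k)) (n∣m*n k)) h)

    private
      congruent : ∀ a x → Zs G (a ∷ x) → ∀ i → Cong P (lookup x i) a
      congruent a x z i = let q = quotient (zs⇒∣ a x z i) in a , q , (begin
          lookup x i + a * P                ≡⟨ cong (lookup x i +_) (k*P a) ⟨
          lookup x i + (a * κ + a)          ≡⟨ sh (lookup x i) (a * κ) a ⟩
          a + (a * κ + lookup x i)          ≡⟨ cong (a +_) (_∣_.equality (zs⇒∣ a x z i)) ⟩
          a + q * P                         ∎)
        where
        open ≡-Reasoning
        sh : ∀ x y a → x + (y + a) ≡ a + (y + x)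
        sh = solve-∀

      congruent₂ : ∀ y → Zs G y → ∀ i → Cong P (lookup y i) (lookup y zero)
      congruent₂ (a ∷ x) z zero    = cong-refl
      congruent₂ (a ∷ x) z (suc i) = congruent a x z i

      zero-divides : ∀ y → Zs G y → ∀ i → lookup y i ≡ 0 → ∀ j → P ∣ lookup y j
      zero-divides y z i e j = cong-0⇒∣ (subst (Cong P (lookup y j)) e
        (cong-trans (congruent₂ y z j) (cong-sym (congruent₂ y z i))))

      zs-𝟙 : Zs G 𝟙
      zs-𝟙 = ∣⇒zs 1 𝟙 λ i → subst (P ∣_) (sym (trans (cong₂ _+_ (*-identityˡ κ) (lookup-𝟙 i)) (trans (+-comm κ 1) sκ≡P))) ∣-refl

      small⇒𝟘 : ∀ u → Zs G u → (∀ i → lookup u i ≤ 1) → ∀ j → lookup u j ≡ 0 → u ≡ 𝟘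
      small⇒𝟘 u zu le j e = vec-ext {x = u} {𝟘} λ i → trans (go i (zero-divides u zu j e i) (le i)) (sym (lookup-𝟘 i))
        where
        go : ∀ i → P ∣ lookup u i → lookup u i ≤ 1 → lookup u i ≡ 0
        go i P∣ ≤1 with lookup u i
        ... | zero  = refl
        ... | suc k = ⊥-elim (<⇒≱ (≤-trans (s≤s ≤1) 2≤P) (∣⇒≤ P∣))

    atom-𝟙 : Atom G 𝟙
    atom-𝟙 = zs-𝟙 , (λ ()) , irr
      where
      irr : ∀ u v → Zs G u → Zs G v → 𝟙 ≡ u ⊕ v → u ≡ 𝟘 ⊎ v ≡ 𝟘
      irr (zero ∷ u)  v zu zv e = inj₁ (small⇒𝟘 (0 ∷ u) zu (λ i → subst (lookup (0 ∷ u) i ≤_) (lookup-𝟙 i) (⊑⇒≤ {x = 0 ∷ u} {𝟙} (v , e) i)) zero refl)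
      irr (suc a ∷ u) (b ∷ v) zu zv e = inj₂ (small⇒𝟘 (b ∷ v) zv
        (λ i → subst (lookup (b ∷ v) i ≤_) (lookup-𝟙 i) (⊑⇒≤ {x = b ∷ v} {𝟙} (suc a ∷ u , trans e (⊕-comm (suc a ∷ u) (b ∷ v))) i)) zero
        (m+n≡0⇒n≡0 a (suc-injective (sym (VecP.∷-injectiveˡ e)))))

    private
      -- The atoms are `𝟙`, with `v = 1`, and the powers `g_i ^ P`, with `v = 0`. Summed over a
      -- factorization, `P` times the length is `size + d v`, where the sequence determines `v`
      -- modulo `P`, and so the length modulo `d`.
      Counted : Vec ℕ (suc (suc s)) → Set
      Counted y = ∃ λ v → P ≡ size y + d * v × Cong P (lookup y zero) v

      counted-𝟙 : Counted 𝟙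
      counted-𝟙 = 1 , trans (sym 2+s+d≡P) (cong₂ _+_ (sym (size-𝟙 (suc (suc s)))) (sym (*-identityʳ d))) , cong-refl

      counted-single : ∀ j → Counted (single j P)
      counted-single j = 0 , sym (trans (cong₂ _+_ (size-single j P) (*-zeroʳ d)) (+-identityʳ P)) , head j
        where
        head : ∀ j → Cong P (lookup (single {suc (suc s)} j P) zero) 0
        head zero    = 0 , 1 , refl
        head (suc j) = cong-refl

      classify : ∀ {y} → Atom G y → Counted y
      classify {y} at = go (FinP.any? (λ i → lookup y i ≟ 0))
        where
        go : Dec (∃ λ i → lookup y i ≡ 0) → Counted y
        go (no none) = subst Counted (atom-min G at zs-𝟙 (λ ()) (≤⇒⊑ 𝟙 y λ i →
          subst (_≤ lookup y i) (sym (lookup-𝟙 i)) (n≢0⇒n>0 λ e → none (i , e)))) counted-𝟙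
        go (yes (i , e)) = let (j , 0<yj) = nonzero-coordinate y (proj₁ (proj₂ at)) in
          subst Counted (sym (atom-≥P at j (∣⇒≤ {{>-nonZero 0<yj}} (zero-divides y (proj₁ at) i e j)))) (counted-single j)

      count : ∀ {ws} → All (Atom G) ws → ∃ λ v → P * length ws ≡ size (sumV ws) + d * v × Cong P (lookup (sumV ws) zero) v
      count [] = 0 , trans (*-zeroʳ P) (sym (cong₂ _+_ (size-𝟘 s) (*-zeroʳ d))) , cong-refl
      count {w ∷ ws} (aw ∷ aws) =
        let (v , e , cv) = classify aw ; (v′ , e′ , cv′) = count aws in v + v′ , (begin
          P * suc (length ws)                                  ≡⟨ *-suc P (length ws) ⟩
          P + P * length ws                                    ≡⟨ cong₂ _+_ e e′ ⟩
          size w + d * v + (size (sumV ws) + d * v′)           ≡⟨ sh (size w) (size (sumV ws)) d v v′ ⟩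
          size w + size (sumV ws) + d * (v + v′)               ≡⟨ cong (_+ d * (v + v′)) (size-⊕ w (sumV ws)) ⟨
          size (w ⊕ sumV ws) + d * (v + v′)                    ∎) ,
          subst (λ k → Cong P k (v + v′)) (sym (lookup-⊕ w (sumV ws) zero)) (cong-+ cv cv′)
        where
        open ≡-Reasoning
        sh : ∀ a b d v w → a + d * v + (b + d * w) ≡ a + b + d * (v + w)
        sh = solve-∀

    -- The `P`-th power of the atom `𝟙` regroups into the `s + 2` powers `g_i ^ P`.
    minus-sum : HasLengths d (suc (suc s)) P
    minus-sum = suc (suc s) , G , uniform , P · 𝟙 , fact-subst G refl (size-𝟙 (suc (suc s))) (fact-P· 𝟙) ,
        fact-subst G refl (*-identityʳ P) (fact-· G P (fact-atom G atom-𝟙))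
      where
      uniform : UL d G
      uniform x k l (us , aus , refl , refl) (vs , avs , refl , e) =
        let (v , ev , cv) = count aus ; (w , ew , cw) = count avs in
        cong-from-count (size (sumV us)) 0<P ev (trans ew (cong (λ y → size y + d * w) e))
          (cong-trans (cong-sym cv) (subst (λ y → Cong P (lookup y zero) w) e cw))

  module PlusSum where
    open WithSum 1 (λ k → subst (P ∣_) (*-identityʳ k))

    private
      -- Write `e₀` for the sum of the independent `e_i`. This additive function is `P` on the atoms
      -- `e_i ^ P` and `P (s + 1)` on all others, which consist of `a` copies of `e₀` and `P - a`
      -- copies of every `e_i`. Thus `φ / P` is a length plus a multiple of `s`.
      φ : Vec ℕ (suc (suc s)) → ℕ
      φ (a ∷ x) = suc s * a + size x

      φ-⊕ : ∀ x y → φ (x ⊕ y) ≡ φ x + φ y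
      φ-⊕ (a ∷ x) (b ∷ y) = trans (cong (suc s * (a + b) +_) (size-⊕ x y)) (sh (suc s) a b (size x) (size y))
        where
        sh : ∀ s a b x y → s * (a + b) + (x + y) ≡ s * a + x + (s * b + y)
        sh = solve-∀

      zs⇒∣′ : ∀ a x → Zs G (a ∷ x) → ∀ i → P ∣ a + lookup x i
      zs⇒∣′ a x z i = subst (λ k → P ∣ k + lookup x i) (*-identityʳ a) (zs⇒∣ a x z i)

      ∣⇒zs′ : ∀ a x → (∀ i → P ∣ a + lookup x i) → Zs G (a ∷ x)
      ∣⇒zs′ a x h = ∣⇒zs a x λ i → subst (λ k → P ∣ k + lookup x i) (sym (*-identityʳ a)) (h i)

      lookup-const : ∀ k (i : Fin (suc s)) → lookup (k · 𝟙) i ≡ k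
      lookup-const k i = trans (lookup-· k 𝟙 i) (trans (cong (k *_) (lookup-𝟙 i)) (*-identityʳ k))

      Counted : Vec ℕ (suc (suc s)) → Set
      Counted y = ∃ λ m → φ y ≡ P * (1 + s * m)

      counted-single : ∀ j → Counted (single j P)
      counted-single zero    = 1 , trans (cong (suc s * P +_) (size-𝟘 (suc s))) (sh s P)
        where
        sh : ∀ s P → (P + s * P) + 0 ≡ P * (1 + s * 1)
        sh = solve-∀
      counted-single (suc j) = 0 , trans (cong₂ _+_ (*-zeroʳ (suc s)) (size-single j P))
        (sym (trans (cong (λ k → P * suc k) (*-zeroʳ s)) (*-identityʳ P)))

      counted-mixed : ∀ a r → a + r ≡ P → Counted (a ∷ (r · 𝟙))
      counted-mixed a r a+r = 1 , trans (cong (suc s * a +_) (trans (size-· r (𝟙 {suc s})) (cong (r *_) (size-𝟙 (suc s)))))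
          (trans (sh s a r) (cong (λ k → k * (1 + s * 1)) a+r))
        where
        sh : ∀ s a r → suc s * a + r * suc s ≡ (a + r) * (1 + s * 1)
        sh = solve-∀

      classify : ∀ a x → Atom G (a ∷ x) → Counted (a ∷ x)
      classify zero x at = let (j , 0<xj) = nonzero-coordinate x (proj₁ (proj₂ at) ∘ cong (0 ∷_)) in
        subst Counted (sym (atom-≥P at (suc j) (∣⇒≤ {{>-nonZero 0<xj}} (zs⇒∣′ 0 x (proj₁ at) j)))) (counted-single (suc j))
      classify a@(suc _) x at = go (P ≤? a)
        where
        go : Dec (P ≤ a) → Counted (a ∷ x)
        go (yes P≤) = subst Counted (sym (atom-≥P at zero P≤)) (counted-single zero)
        go (no P≰)  = subst Counted eq (counted-mixed a r a+r)
          where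
          r = P ∸ a
          a+r : a + r ≡ P
          a+r = m+[n∸m]≡n (<⇒≤ (≰⇒> P≰))
          below-x : ∀ i → lookup (a ∷ (r · 𝟙)) i ≤ lookup (a ∷ x) i
          below-x zero    = ≤-refl
          below-x (suc i) = subst (_≤ lookup x i) (sym (lookup-const r i))
            (+-cancelˡ-≤ a r (lookup x i) (subst (_≤ a + lookup x i) (sym a+r) (∣⇒≤ (zs⇒∣′ a x (proj₁ at) i))))
          eq : a ∷ (r · 𝟙) ≡ a ∷ x
          eq = atom-min G at (∣⇒zs′ a (r · 𝟙) λ i → subst (P ∣_) (sym (trans (cong (a +_) (lookup-const r i)) a+r)) ∣-refl) (λ ())
            (≤⇒⊑ (a ∷ (r · 𝟙)) (a ∷ x) below-x)

      head∷tail : ∀ {t} (w : Vec ℕ (suc t)) → w ≡ Vec.head w ∷ Vec.tail w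
      head∷tail (_ ∷ _) = refl

      count : ∀ {ws} → All (Atom G) ws → ∃ λ m → φ (sumV ws) ≡ P * (length ws + s * m)
      count [] = 0 , trans (cong₂ _+_ (*-zeroʳ (suc s)) (size-𝟘 (suc s))) (sym (trans (cong (P *_) (*-zeroʳ s)) (*-zeroʳ P)))
      count {w ∷ ws} (aw ∷ aws) = let (m , e) = classify (Vec.head w) (Vec.tail w) (subst (Atom G) (head∷tail w) aw) ; (m′ , e′) = count aws in m + m′ ,
          trans (φ-⊕ w (sumV ws)) (trans (cong₂ _+_ (trans (cong φ (head∷tail w)) e) e′) (sh P s m m′ (length ws)))
        where
        sh : ∀ P s m m′ k → P * (1 + s * m) + P * (k + s * m′) ≡ P * (suc k + s * (m + m′))
        sh = solve-∀

      W : Vec ℕ (suc (suc s))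
      W = 1 ∷ (pred P · 𝟙)

      sc≡P : suc (pred P) ≡ P
      sc≡P = suc-pred P {{>-nonZero 0<P}}

      atom-W : Atom G W
      atom-W = ∣⇒zs′ 1 (pred P · 𝟙) (λ i → subst (P ∣_) (sym (trans (cong (1 +_) (lookup-const (pred P) i)) sc≡P)) ∣-refl) ,
        (λ ()) , irr
        where
        zero-head : ∀ u v → Zs G (0 ∷ u) → pred P · 𝟙 ≡ u ⊕ v → 0 ∷ u ≡ 𝟘
        zero-head u v zu e = cong (0 ∷_) (vec-ext {x = u} {𝟘} λ i → trans (go i (zs⇒∣′ 0 u zu i)
          (subst (lookup u i ≤_) (lookup-const (pred P) i) (⊑⇒≤ {x = u} {pred P · 𝟙} (v , e) i))) (sym (lookup-𝟘 i)))
          where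
          go : ∀ i → P ∣ lookup u i → lookup u i ≤ pred P → lookup u i ≡ 0
          go i P∣ le with lookup u i
          ... | zero  = refl
          ... | suc k = ⊥-elim (<⇒≱ (subst (suc k <_) sc≡P (s≤s le)) (∣⇒≤ P∣))
        irr : ∀ u v → Zs G u → Zs G v → W ≡ u ⊕ v → u ≡ 𝟘 ⊎ v ≡ 𝟘
        irr (zero ∷ u)  (b ∷ v) zu zv e = inj₁ (zero-head u v zu (VecP.∷-injectiveʳ e))
        irr (suc a ∷ u) (suc b ∷ v) zu zv e with trans (VecP.∷-injectiveˡ e) (+-suc (suc a) b)
        ... | ()
        irr (suc a ∷ u) (zero ∷ v) zu zv e = inj₂ (zero-head v u zv (trans (VecP.∷-injectiveʳ e) (⊕-comm u v)))

    -- The atom `W` contains `e₀` once and every `e_i` exactly `P - 1` times. Its `P`-th power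
    -- regroups into `e₀ ^ P` and `P - 1` copies of each `e_i ^ P`.
    plus-sum : HasLengths s P (1 + pred P * suc s)
    plus-sum = suc (suc s) , G , uniform , P · W , fact-subst G refl (*-identityʳ P) (fact-· G P (fact-atom G atom-W)) ,
        fact-subst G refl (cong suc (trans (size-· (pred P) (𝟙 {suc s})) (cong (pred P *_) (size-𝟙 (suc s))))) (fact-P· W)
      where
      uniform : UL s G
      uniform x k l (us , aus , refl , refl) (vs , avs , refl , e) =
        let (m , em) = count aus ; (m′ , em′) = count avs in
        m , m′ , trans (cong (k +_) (*-comm m s)) (trans (*-cancelˡ-≡ _ _ P {{>-nonZero 0<P}}
          (trans (sym em) (trans (cong φ (sym e)) em′))) (cong (l +_) (*-comm s m′)))

-- Sequences as lists and as exponent vectors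

module Sequences {c ℓ : Level} (𝔾 : AbelianGroup c ℓ) where
  open Families 𝔾
  module L = Lengths (AbelianGroup.rawMonoid 𝔾)
  open Data.List.Relation.Binary.Permutation.Setoid setoid using (_↭_; ↭-refl; ↭-sym; ↭-trans; ↭-prep; ↭-reflexive) public
  module ↭P = Data.List.Relation.Binary.Permutation.Setoid.Properties setoid

  seq : Vec C t → Vec ℕ t → List C
  seq []      []      = []
  seq (g ∷ G) (k ∷ x) = List.replicate k g ++ seq G x

  σ-seq : (G : Vec C t) (x : Vec ℕ t) → L.σ (seq G x) ≈ eval G x
  σ-seq []      []      = ≈-refl
  σ-seq (g ∷ G) (k ∷ x) = go k
    where
    go : ∀ k → L.σ (List.replicate k g ++ seq G x) ≈ k ⊗ g ∙ eval G x
    go zero    = ≈-trans (σ-seq G x) (≈-sym (identityˡ _))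
    go (suc k) = ≈-trans (∙-congˡ (go k)) (≈-sym (assoc g (k ⊗ g) (eval G x)))

  σ-resp : ∀ {xs ys} → xs ↭ ys → L.σ xs ≈ L.σ ys
  σ-resp = ↭P.foldr-commMonoid isCommutativeMonoid

  length-seq : (G : Vec C t) (x : Vec ℕ t) → length (seq G x) ≡ size x
  length-seq []      []      = refl
  length-seq (g ∷ G) (k ∷ x) = trans (ListP.length-++ (List.replicate k g)) (cong₂ _+_ (ListP.length-replicate k) (length-seq G x))

  seq-𝟘 : (G : Vec C t) → seq G 𝟘 ≡ []
  seq-𝟘 []      = refl
  seq-𝟘 (g ∷ G) = seq-𝟘 G

  seq-[] : (G : Vec C t) (x : Vec ℕ t) → seq G x ≡ [] → x ≡ 𝟘
  seq-[] G x e = size-0 x (trans (sym (length-seq G x)) (cong length e))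

  seq-fromList : (B : List C) → seq (Vec.fromList B) 𝟙 ≡ B
  seq-fromList []      = refl
  seq-fromList (b ∷ B) = cong (b ∷_) (seq-fromList B)

  ↭-[] : ∀ {xs} → xs ↭ [] → xs ≡ []
  ↭-[] {[]}    p = refl
  ↭-[] {_ ∷ _} p with ↭P.xs↭ys⇒|xs|≡|ys| p
  ... | ()

  seq-cons : (G : Vec C t) (i : Fin t) (x : Vec ℕ t) → seq G (single i 1 ⊕ x) ↭ lookup G i ∷ seq G x
  seq-cons (g ∷ G) zero    (k ∷ x) = ↭-reflexive (cong (λ y → g ∷ List.replicate k g ++ seq G y) (⊕-identityˡ x))
  seq-cons (g ∷ G) (suc i) (k ∷ x) = ↭-trans (↭P.++⁺ˡ (List.replicate k g) (seq-cons G i x))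
    (↭P.↭-shift (List.replicate k g) (seq G x))

  seq-⊕ : (G : Vec C t) (x y : Vec ℕ t) → seq G (x ⊕ y) ↭ seq G x ++ seq G y
  seq-⊕ G x y = vec-ind (λ x → seq G (x ⊕ y) ↭ seq G x ++ seq G y)
    (↭-reflexive (trans (cong (seq G) (⊕-identityˡ y)) (cong (_++ seq G y) (sym (seq-𝟘 G)))))
    (λ i x p → ↭-trans (↭-reflexive (cong (seq G) (⊕-assoc (single i 1) x y))) (↭-trans (seq-cons G i (x ⊕ y))
      (↭-trans (↭-prep (lookup G i) p) (↭P.++⁺ʳ (seq G y) (↭-sym (seq-cons G i x)))))) x

  seq-member : (G : Vec C t) (x : Vec ℕ t) {h : C} → Any (h ≈_) (seq G x) → ∃ λ i → 0 < lookup x i × h ≈ lookup G i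
  seq-member []      []          ()
  seq-member (g ∷ G) (zero  ∷ x) p = let (i , q , e) = seq-member G x p in suc i , q , e
  seq-member (g ∷ G) (suc k ∷ x) (here e)  = zero , s≤s z≤n , e
  seq-member (g ∷ G) (suc k ∷ x) (there p) with seq-member (g ∷ G) (k ∷ x) p
  ... | zero  , q , e = zero , s≤s z≤n , e
  ... | suc i , q , e = suc i , q , e

  seq-extract : (G : Vec C t) (x : Vec ℕ t) {h : C} {R : List C} → seq G x ↭ h ∷ R →
    ∃₂ λ i y → x ≡ single i 1 ⊕ y × lookup G i ≈ h × seq G y ↭ R
  seq-extract G x {h} {R} p with seq-member G x (↭P.∈-resp-↭ (↭-sym p) (here ≈-refl))
  ... | i , q , e with single-⊑ i 1 x q
  ... | y , refl = i , y , refl , ≈-sym e ,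
    ↭P.drop-∷ (↭-trans (↭-trans (Data.List.Relation.Binary.Permutation.Setoid.prep e (↭-refl {seq G y}))
      (↭-sym (seq-cons G i y))) p)

  -- Members of `G` may coincide, so `A` does not determine its exponents; they are chosen by
  -- extracting one element at a time.
  seq-split : (G : Vec C t) (x : Vec ℕ t) (A : List C) {R : List C} → seq G x ↭ A ++ R →
    ∃₂ λ a b → x ≡ a ⊕ b × seq G a ↭ A × seq G b ↭ R
  seq-split G x []      p = 𝟘 , x , sym (⊕-identityˡ x) , ↭-reflexive (seq-𝟘 G) , p
  seq-split G x (h ∷ A) p with seq-extract G x p
  ... | i , y , refl , e , q with seq-split G y A q
  ... | a , b , refl , pa , pb = single i 1 ⊕ a , b , sym (⊕-assoc (single i 1) a b) ,
    ↭-trans (seq-cons G i a) (Data.List.Relation.Binary.Permutation.Setoid.prep e pa) , pb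

  zs⇒σ : (G : Vec C t) {x : Vec ℕ t} {A : List C} → seq G x ↭ A → Zs G x → L.ZeroSum A
  zs⇒σ G {x} p z = ≈-trans (≈-sym (σ-resp p)) (≈-trans (σ-seq G x) z)

  σ⇒zs : (G : Vec C t) {x : Vec ℕ t} {A : List C} → seq G x ↭ A → L.ZeroSum A → Zs G x
  σ⇒zs G {x} p z = ≈-trans (≈-sym (σ-seq G x)) (≈-trans (σ-resp p) z)

  seq-𝟘-↭ : (G : Vec C t) {x : Vec ℕ t} {A : List C} → seq G x ↭ A → x ≡ 𝟘 → A ≡ []
  seq-𝟘-↭ G p refl = ↭-[] (↭-trans (↭-sym p) (↭-reflexive (seq-𝟘 G)))

  seq-[]-↭ : (G : Vec C t) {x : Vec ℕ t} {A : List C} → seq G x ↭ A → A ≡ [] → x ≡ 𝟘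
  seq-[]-↭ G {x} p refl = seq-[] G x (↭-[] p)

  atom⇒L : (G : Vec C t) {x : Vec ℕ t} {A : List C} → seq G x ↭ A → Atom G x → L.Atom A
  atom⇒L G {x} {A} p (zx , x≢𝟘 , irr) = zs⇒σ G p zx , x≢𝟘 ∘ seq-[]-↭ G p , irr′
    where
    irr′ : ∀ U V → L.ZeroSum U → L.ZeroSum V → A ↭ U ++ V → U ≡ [] ⊎ V ≡ []
    irr′ U V zU zV q = let (u , v , e , pu , pv) = seq-split G x U (↭-trans p q) in
      [ inj₁ ∘ seq-𝟘-↭ G pu , inj₂ ∘ seq-𝟘-↭ G pv ]′ (irr u v (σ⇒zs G pu zU) (σ⇒zs G pv zV) e)

  L⇒atom : (G : Vec C t) {x : Vec ℕ t} {A : List C} → seq G x ↭ A → L.Atom A → Atom G x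
  L⇒atom G {x} {A} p (zA , A≢[] , irr) = σ⇒zs G p zA , A≢[] ∘ seq-𝟘-↭ G p , irr′
    where
    irr′ : ∀ u v → Zs G u → Zs G v → x ≡ u ⊕ v → u ≡ 𝟘 ⊎ v ≡ 𝟘
    irr′ u v zu zv refl =
      [ inj₁ ∘ seq-[] G u , inj₂ ∘ seq-[] G v ]′
      (irr (seq G u) (seq G v) (zs⇒σ G {u} ↭-refl zu) (zs⇒σ G {v} ↭-refl zv) (↭-trans (↭-sym p) (seq-⊕ G u v)))

  fact⇒∈L : (G : Vec C t) {x : Vec ℕ t} {B : List C} {k : ℕ} → seq G x ↭ B → Fact G x k → k L.∈L B
  fact⇒∈L G {B = B} p (ws , aws , len , refl) = List.map (seq G) ws , AllP.map⁺ (All.map (atom⇒L G ↭-refl) aws) ,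
    trans (ListP.length-map (seq G) ws) len , ↭-trans (↭-sym p) (go ws)
    where
    go : ∀ ws → seq G (sumV ws) ↭ List.concat (List.map (seq G) ws)
    go []       = ↭-reflexive (seq-𝟘 G)
    go (w ∷ ws) = ↭-trans (seq-⊕ G w (sumV ws)) (↭P.++⁺ˡ (seq G w) (go ws))

  ∈L⇒fact : (G : Vec C t) {x : Vec ℕ t} {B : List C} {k : ℕ} → seq G x ↭ B → k L.∈L B → Fact G x k
  ∈L⇒fact G {x} p (As , aAs , refl , q) = go As aAs x (↭-trans p q)
    where
    go : ∀ As → All L.Atom As → ∀ x → seq G x ↭ List.concat As → Fact G x (length As)
    go []       []         x r = fact-subst G (sym (seq-[]-↭ G r refl)) refl (fact-𝟘 G)
    go (A ∷ As) (aA ∷ aAs) x r with seq-split G x A r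
    ... | a , b , refl , pa , pb = fact-⊕ G (fact-atom G (L⇒atom G pa aA)) (go As aAs b pb)

  as-seq : (G : Vec C t) → (∀ g → ∃ λ i → g ≈ lookup G i) → (B : List C) → ∃ λ x → seq G x ↭ B
  as-seq G index []      = 𝟘 , ↭-reflexive (seq-𝟘 G)
  as-seq G index (b ∷ B) = let (i , e) = index b ; (x , p) = as-seq G index B in
    single i 1 ⊕ x , ↭-trans (seq-cons G i x) (Data.List.Relation.Binary.Permutation.Setoid.prep (≈-sym e) p)

-- Transfer of lengths between groups

-- Finite choice under double negation; monotonicity lets the sum of two bounds serve both halves of
-- the masks.
¬¬-mask : ∀ {p} (P : Vec Bool t → ℕ → Set p) → (∀ {m T T′} → T ≤ T′ → P m T → P m T′) →
  (∀ m → ¬ ¬ ∃ (P m)) → ¬ ¬ ∃ λ T → ∀ m → P m T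
¬¬-mask {zero}  P mono h k = h [] λ (T , p) → k (T , λ { [] → p })
¬¬-mask {suc t} P mono h k =
  ¬¬-mask (λ m → P (true ∷ m)) mono (λ m → h (true ∷ m)) λ (T , p) →
  ¬¬-mask (λ m → P (false ∷ m)) mono (λ m → h (false ∷ m)) λ (T′ , p′) →
  k (T + T′ , λ { (true ∷ m) → mono (m≤m+n T T′) (p m) ; (false ∷ m) → mono (m≤n+m T′ T) (p′ m) })

riesz : (a b x r : ℕ) → a + b ≡ x + r →
  ∃₂ λ aX aR → ∃₂ λ bX bR → a ≡ aX + aR × b ≡ bX + bR × x ≡ aX + bX × r ≡ aR + bR
riesz a b x r e with ≤-total a x
... | inj₁ a≤x with m≤n⇒∃[o]m+o≡n a≤x
...   | o , refl = a , 0 , o , r , sym (+-identityʳ a) , +-cancelˡ-≡ a b (o + r) (trans e (+-assoc a o r)) , refl , refl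
riesz a b x r e | inj₂ x≤a with m≤n⇒∃[o]m+o≡n x≤a
...   | o , refl = x , o , 0 , b , refl , refl , sym (+-identityʳ x) , sym (+-cancelˡ-≡ x (o + b) r (trans (sym (+-assoc x o b)) e))

rieszᵛ : (a b x r : Vec ℕ t) → a ⊕ b ≡ x ⊕ r →
  ∃₂ λ aX aR → ∃₂ λ bX bR → a ≡ aX ⊕ aR × b ≡ bX ⊕ bR × x ≡ aX ⊕ bX × r ≡ aR ⊕ bR
rieszᵛ []      []      []      []      e = [] , [] , [] , [] , refl , refl , refl , refl
rieszᵛ (a ∷ u) (b ∷ v) (x ∷ w) (r ∷ z) e with riesz a b x r (VecP.∷-injectiveˡ e) | rieszᵛ u v w z (VecP.∷-injectiveʳ e)
... | aX , aR , bX , bR , refl , refl , refl , refl | uX , uR , vX , vR , refl , refl , refl , refl =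
  aX ∷ uX , aR ∷ uR , bX ∷ vX , bR ∷ vR , refl , refl , refl , refl

-- Discard the factors meeting R; what remains divides X.
record Sieved {t p} (P : Vec ℕ t → Set p) (ws : List (Vec ℕ t)) (X R : Vec ℕ t) : Set p where
  field
    kept removed : List (Vec ℕ t)
    all-kept     : All P kept
    all-removed  : All P removed
    total        : sumV ws ≡ sumV kept ⊕ sumV removed
    lengths      : length ws ≡ length kept + length removed
    kept-⊑       : sumV kept ⊑ X
    few-removed  : length removed ≤ size R

sieve : ∀ {p} {P : Vec ℕ t → Set p} ws → All P ws → ∀ X R → sumV ws ≡ X ⊕ R → Sieved P ws X R
sieve []       []       X R e = record
  { kept = [] ; removed = [] ; all-kept = [] ; all-removed = [] ; total = sym (⊕-identityˡ _) ; lengths = refl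
  ; kept-⊑ = X , sym (⊕-identityˡ X) ; few-removed = z≤n }
sieve (w ∷ ws) (p ∷ ps) X R e with rieszᵛ w (sumV ws) X R e
... | wX , wR , sX , sR , refl , es , refl , refl with sieve ws ps sX sR es | wR ≟ᵛ 𝟘
... | S | yes refl = record
  { kept = wX ⊕ 𝟘 ∷ kept ; removed = removed ; all-kept = p ∷ all-kept ; all-removed = all-removed
  ; total = trans (cong (wX ⊕ 𝟘 ⊕_) total) (sym (⊕-assoc (wX ⊕ 𝟘) (sumV kept) (sumV removed)))
  ; lengths = cong suc lengths
  ; kept-⊑ = proj₁ kept-⊑ , trans (cong (wX ⊕_) (proj₂ kept-⊑)) (trans (sym (⊕-assoc wX (sumV kept) (proj₁ kept-⊑)))
      (cong (λ v → v ⊕ sumV kept ⊕ proj₁ kept-⊑) (sym (⊕-identityʳ wX))))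
  ; few-removed = subst (length removed ≤_) (cong size (sym (⊕-identityˡ sR))) few-removed }
  where open Sieved S
... | S | no wR≢𝟘 = record
  { kept = kept ; removed = wX ⊕ wR ∷ removed ; all-kept = all-kept ; all-removed = p ∷ all-removed
  ; total = trans (cong (wX ⊕ wR ⊕_) total) (⊕-swap (wX ⊕ wR) (sumV kept) (sumV removed))
  ; lengths = trans (cong suc lengths) (sym (+-suc (length kept) (length removed)))
  ; kept-⊑ = ⊑-trans kept-⊑ (wX , ⊕-comm wX sX)
  ; few-removed = subst (suc (length removed) ≤_) (sym (size-⊕ wR sR)) (+-mono-≤ (size-pos wR wR≢𝟘) few-removed) }
  where open Sieved S

large-mask : ℕ → Vec ℕ t → Vec Bool t
large-mask T = Vec.map (T ≤ᵇ_)

large-split : ∀ T (y : Vec ℕ t) → let m = large-mask T y in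
  ∃ λ small → y ≡ extend m (restrict m y) ⊕ small × size small ≤ t * T
large-split T [] = [] , refl , z≤n
large-split T (k ∷ y) with T ≤ᵇ k in eq | large-split T y
... | true  | small , e , le = 0 ∷ small , cong₂ _∷_ (sym (+-identityʳ k)) e , ≤-trans le (m≤n+m _ T)
... | false | small , e , le = k ∷ small , cong (k ∷_) e ,
  +-mono-≤ (<⇒≤ (≰⇒> λ T≤k → subst Data.Bool.T eq (≤⇒≤ᵇ T≤k))) le

large-coordinates : ∀ T (y : Vec ℕ t) i → T ≤ lookup (restrict (large-mask T y) y) i
large-coordinates T (k ∷ y) i with T ≤ᵇ k in eq
large-coordinates T (k ∷ y) zero    | true = ≤ᵇ⇒≤ T k (subst Data.Bool.T (sym eq) _)
large-coordinates T (k ∷ y) (suc i) | true = large-coordinates T y i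
large-coordinates T (k ∷ y) i       | false = large-coordinates T y i

module Transfer {c₁ ℓ₁ c₂ ℓ₂ : Level} (ℍ : AbelianGroup c₁ ℓ₁) (𝕂 : AbelianGroup c₂ ℓ₂)
  (_≟ᵏ_ : ∀ x y → Dec (AbelianGroup._≈_ 𝕂 x y))
  (n : ℕ) (0<n : 0 < n)
  (exponent : ∀ g → AbelianGroup._≈_ 𝕂 (Families._⊗_ 𝕂 n g) (AbelianGroup.ε 𝕂))
  (N : ℕ) (E : Vec (AbelianGroup.Carrier 𝕂) N) (index : ∀ g → ∃ λ i → AbelianGroup._≈_ 𝕂 g (lookup E i))
  (⊆ℒ : AbelianGroup.rawMonoid ℍ ⊆ℒ AbelianGroup.rawMonoid 𝕂) where
  module H = Families ℍ
  open Families 𝕂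
  open Decidable _≟ᵏ_
  open Weights 𝕂 _≟ᵏ_ n 0<n exponent

  private
    module SH = Sequences ℍ
    module SK = Sequences 𝕂

  Uniform : ℕ → Vec ℕ N → Set ℓ₂
  Uniform d y = ∀ k l → Fact E y k → Fact E y l → Cong d k l

  same-lengths : ∀ {t} (G : Vec H.C t) x → H.Zs G x → ∃ λ y → ∀ k → H.Fact G x k ⇔ Fact E y k
  same-lengths G x zx = let (B′ , _ , eqv) = ⊆ℒ (SH.seq G x) (H.≈-trans (SH.σ-seq G x) zx) ; (y , p) = SK.as-seq E index B′ in
    y , λ k → mk⇔
      (λ f → SK.∈L⇒fact E p (Equivalence.to (eqv k) (SH.fact⇒∈L G SH.↭-refl f)))
      (λ f → SH.∈L⇒fact G SH.↭-refl (Equivalence.from (eqv k) (SK.fact⇒∈L E p f)))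

  Threshold : ℕ → Vec Bool N → ℕ → Set ℓ₂
  Threshold d m T = UL d (restrict m E) ⊎
    ∃ λ x → size x ≤ T × ∃₂ λ k l → Fact (restrict m E) x k × Fact (restrict m E) x l × ¬ Cong d k l

  -- Whether a subfamily has uniform lengths is not decided, so a common bound for the sizes of
  -- counterexamples is available only up to double negation.
  threshold : ∀ d → ¬ ¬ ∃ λ T → ∀ m → Threshold d m T
  threshold d = ¬¬-mask (Threshold d) (λ {m} → mono {m}) each
    where
    mono : ∀ {m T T′} → T ≤ T′ → Threshold d m T → Threshold d m T′
    mono T≤ (inj₁ ul)              = inj₁ ul
    mono T≤ (inj₂ (x , le , rest)) = inj₂ (x , ≤-trans le T≤ , rest)
    each : ∀ m → ¬ ¬ ∃ (Threshold d m)
    each m k₀ = k₀ (0 , inj₁ λ x k l fk fl → cong-stable λ ¬c → k₀ (size x , inj₂ (x , ≤-refl , k , l , fk , fl , ¬c)))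
      where
      -- Divisibility of truncated differences decides the congruence, so it is stable.
      cong-stable : ∀ {k l} → ¬ ¬ Cong d k l → Cong d k l
      cong-stable {k} {l} ¬¬c with d ∣? (k ∸ l) | d ∣? (l ∸ k) | ≤-total k l
      ... | _ | yes (divides q e) | inj₁ k≤l = q , 0 , trans (cong (k +_) (sym e)) (trans (m+[n∸m]≡n k≤l) (sym (+-identityʳ l)))
      ... | yes (divides q e) | _ | inj₂ l≤k = 0 , q , trans (+-identityʳ k) (sym (trans (cong (l +_) (sym e)) (m+[n∸m]≡n l≤k)))
      ... | _ | no ¬d | inj₁ k≤l = ⊥-elim (¬¬c λ c → let (j , e) = cong-≤ c k≤l in
              ¬d (divides j (trans (cong (_∸ k) e) (m+n∸m≡n k (j * d)))))
      ... | no ¬d | _ | inj₂ l≤k = ⊥-elim (¬¬c λ c → let (j , e) = cong-≤ (cong-sym c) l≤k in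
              ¬d (divides j (trans (cong (_∸ l) e) (m+n∸m≡n l (j * d)))))

  -- A counterexample of size at most `T` would divide the part of `y` whose multiplicities are at
  -- least `T`. Completing its two factorizations by the same factorization of the rest gives
  -- incongruent lengths of `y`.
  large-UL : ∀ d T y → Uniform d y → Zs E y → Threshold d (large-mask T y) T → UL d (restrict (large-mask T y) E)
  large-UL d T y un zy (inj₁ ul) = ul
  large-UL d T y un zy (inj₂ (x , x≤T , k , l , fk , fl , ¬c)) = ⊥-elim (¬c
      (cong-cancelˡ λ′ (un (λ′ + k) (λ′ + l) (combine fk) (combine fl))))
    where
    m = large-mask T y
    small = proj₁ (large-split T y)
    x⊑ : x ⊑ restrict m y
    x⊑ = ≤⇒⊑ x (restrict m y) λ i → ≤-trans (lookup≤size x i) (≤-trans x≤T (large-coordinates T y i))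
    z : Vec ℕ N
    z = extend m (proj₁ x⊑) ⊕ small
    y≡ : y ≡ extend m x ⊕ z
    y≡ = trans (proj₁ (proj₂ (large-split T y))) (trans (cong (_⊕ small) (trans (cong (extend m) (proj₂ x⊑)) (extend-⊕ m x (proj₁ x⊑))))
      (⊕-assoc (extend m x) (extend m (proj₁ x⊑)) small))
    fac = factorize E z (zs-cancelˡ E (extend m x) {z} (subst (Zs E) y≡ zy) (fact-zs E (fact-extend m E fk)))
    λ′ = proj₁ fac
    combine : ∀ {k} → Fact (restrict m E) x k → Fact E y (λ′ + k)
    combine f = fact-subst E (trans (⊕-comm z (extend m x)) (sym y≡)) refl (fact-⊕ E (proj₂ fac) (fact-extend m E f))

  size-atoms : ∀ {ws} → All (Atom E) ws → size (sumV ws) ≤ length ws * (N * n)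
  size-atoms []                    = ≤-reflexive (size-𝟘 N)
  size-atoms {w ∷ ws} (aw ∷ aws) = subst (_≤ N * n + length ws * (N * n)) (sym (size-⊕ w (sumV ws)))
    (+-mono-≤ (size-bound w n λ i → ≤-trans (atom-coordinate E aw i) (ord≤n (lookup E i))) (size-atoms aws))

  -- Elements of multiplicity below T lie in boundedly many atoms.
  large-part : ∀ T y p q → Fact E y p → Fact E y q → let c = N * T + N * T * (N * n) * (N * n) in
    ∃₂ λ Y p′ → ∃ λ q′ → Fact (restrict (large-mask T y) E) Y p′ × Fact (restrict (large-mask T y) E) Y q′ × p′ ≤ p + c × q ≤ q′ + c
  large-part T y p q (vs , avs , refl , ev) (ws , aws , refl , ew) = Y , length A.kept′ + λ′ , length B.kept , fY , fYq ,
      +-mono-≤ (subst (length A.kept′ ≤_) (sym A.lengths′) (m≤m+n _ _)) (≤-trans λ≤ (m≤n+m κ₂ (N * T))) ,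
      subst (_≤ length B.kept + (N * T + κ₂)) (sym B.lengths)
        (+-monoʳ-≤ (length B.kept) (≤-trans B.few-removed (≤-trans small≤ (m≤m+n (N * T) κ₂))))
    where
    m = large-mask T y
    κ₁ = N * T * (N * n)
    κ₂ = κ₁ * (N * n)
    small = proj₁ (large-split T y)
    y≡ = proj₁ (proj₂ (large-split T y))
    small≤ = proj₂ (proj₂ (large-split T y))
    -- The factorization of length `q` loses the factors that meet the small part. Their product is
    -- `R`, and the others multiply to `Y` over the large part.
    module B = Sieved (sieve ws aws (extend m (restrict m y)) small (trans ew y≡))
    lifted = extend-⊕⁻¹ m (restrict m y) (sumV B.kept) (proj₁ B.kept-⊑) (proj₂ B.kept-⊑)
    Y = proj₁ lifted
    Y≡ : sumV B.kept ≡ extend m Y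
    Y≡ = proj₁ (proj₂ (proj₂ lifted))
    R = sumV B.removed
    R≤ : size R ≤ κ₁
    R≤ = ≤-trans (size-atoms B.all-removed) (*-monoˡ-≤ (N * n) (≤-trans B.few-removed small≤))
    y≡YR : y ≡ extend m Y ⊕ R
    y≡YR = trans (sym ew) (trans B.total (cong (_⊕ R) Y≡))
    fYq : Fact (restrict m E) Y (length B.kept)
    fYq = fact-extend⁻¹ m E (B.kept , B.all-kept , refl , Y≡)
    -- The factorization of length `p` loses the factors that meet `R`. What is then missing from
    -- `Y` has bounded size and is factored anew into boundedly many atoms.
    module A where
      private module S = Sieved (sieve vs avs (extend m Y) R (trans ev y≡YR))
      kept′ = S.kept
      all-kept′ = S.all-kept
      removed′ = S.removed
      lengths′ = S.lengths
      W′ = proj₁ S.kept-⊑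
      few : length removed′ ≤ κ₁
      few = ≤-trans S.few-removed R≤
      Y≡ZW : extend m Y ≡ sumV kept′ ⊕ W′
      Y≡ZW = proj₂ S.kept-⊑
      removed≡ : sumV removed′ ≡ W′ ⊕ R
      removed≡ = ⊕-cancelˡ (sumV kept′) (trans (sym S.total) (trans ev (trans y≡YR (trans (cong (_⊕ R) Y≡ZW) (⊕-assoc (sumV kept′) W′ R)))))
      W′≤ : size W′ ≤ κ₂
      W′≤ = ≤-trans (m≤m+n (size W′) (size R)) (≤-trans (≤-reflexive (trans (sym (size-⊕ W′ R)) (cong size (sym removed≡))))
        (≤-trans (size-atoms S.all-removed) (*-monoˡ-≤ (N * n) few)))
    lifted′ = extend-⊕⁻¹ m Y (sumV A.kept′) A.W′ A.Y≡ZW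
    Z = proj₁ lifted′
    W = proj₁ (proj₂ lifted′)
    Z≡ : sumV A.kept′ ≡ extend m Z
    Z≡ = proj₁ (proj₂ (proj₂ lifted′))
    W≡ : A.W′ ≡ extend m W
    W≡ = proj₂ (proj₂ (proj₂ lifted′))
    fZ : Fact (restrict m E) Z (length A.kept′)
    fZ = fact-extend⁻¹ m E (A.kept′ , A.all-kept′ , refl , Z≡)
    Y≡Z⊕W : Y ≡ Z ⊕ W
    Y≡Z⊕W = extend-injective m (trans A.Y≡ZW (trans (cong₂ _⊕_ Z≡ W≡) (sym (extend-⊕ m Z W))))
    fac = factorize (restrict m E) W (zs-cancelˡ (restrict m E) Z {W} (subst (Zs (restrict m E)) Y≡Z⊕W (fact-zs (restrict m E) fYq))
      (fact-zs (restrict m E) fZ))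
    λ′ = proj₁ fac
    λ≤ : λ′ ≤ κ₂
    λ≤ = ≤-trans (fact-≤-size (restrict m E) (proj₂ fac)) (≤-trans (≤-reflexive (trans (sym (size-extend m W)) (cong size (sym W≡)))) A.W′≤)
    fY : Fact (restrict m E) Y (length A.kept′ + λ′)
    fY = fact-subst (restrict m E) (sym Y≡Z⊕W) refl (fact-⊕ (restrict m E) fZ (proj₂ fac))

  transfer : ∀ d p q → H.HasLengths d p q → ¬ ¬ ∃ λ c → ∀ k → ∃₂ λ p′ q′ → HasLengths d p′ q′ × p′ ≤ k * p + c × k * q ≤ q′ + c
  transfer d p q (_ , G , ul , x , fp , fq) k₀ = threshold d λ (T , th) → k₀ (N * T + N * T * (N * n) * (N * n) , go T th)
    where
    go : ∀ T → (∀ m → Threshold d m T) → ∀ k → ∃₂ λ p′ q′ → HasLengths d p′ q′ ×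
      p′ ≤ k * p + (N * T + N * T * (N * n) * (N * n)) × k * q ≤ q′ + (N * T + N * T * (N * n) * (N * n))
    go T th k = let
        fkp = H.fact-· G k fp
        (y , eqv) = same-lengths G (k · x) (H.fact-zs G fkp)
        fyp = Equivalence.to (eqv (k * p)) fkp
        fyq = Equivalence.to (eqv (k * q)) (H.fact-· G k fq)
        un = λ i j fi fj → ul (k · x) i j (Equivalence.from (eqv i) fi) (Equivalence.from (eqv j) fj)
        m = large-mask T y
        (Y , p′ , q′ , f , f′ , le , le′) = large-part T y (k * p) (k * q) fyp fyq
      in p′ , q′ , (mask-size m , restrict m E , large-UL d T y un (fact-zs E fyp) (th m) , Y , f , f′) , le , le′

-- The homocyclic group and its rank

funToFin-cong : ∀ {m n} {f g : Fin m → Fin n} → (∀ i → f i ≡ g i) → Fin.funToFin f ≡ Fin.funToFin g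
funToFin-cong {zero}  h = refl
funToFin-cong {suc m} h = cong₂ Fin.combine (h zero) (funToFin-cong (h ∘ suc))

functions-≤ : ∀ {P s r} → 2 ≤ P → (φ : (Fin s → Fin P) → (Fin r → Fin P)) →
  (∀ f g → (∀ i → φ f i ≡ φ g i) → ∀ j → f j ≡ g j) → s ≤ r
functions-≤ {P} {s} {r} 2≤P φ inj = ≮⇒≥ λ r<s → <⇒≱ (^-monoʳ-< P 2≤P r<s) (FinP.injective⇒≤ ψ-injective)
  where
  ψ : Fin (P ^ s) → Fin (P ^ r)
  ψ k = Fin.funToFin (φ (Fin.finToFun k))
  ψ-injective : ∀ {k l} → ψ k ≡ ψ l → k ≡ l
  ψ-injective {k} {l} e = trans (sym (FinP.funToFin-finToFin {s} {P} k)) (trans (funToFin-cong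
    (inj (Fin.finToFun k) (Fin.finToFun l) λ i → trans (sym (FinP.finToFun-funToFin (φ (Fin.finToFun k)) i))
      (trans (cong (λ v → Fin.finToFun v i) e) (FinP.finToFun-funToFin (φ (Fin.finToFun l)) i))))
    (FinP.funToFin-finToFin {s} {P} l))

module Homocyclic (n r : ℕ) .{{_ : NonZero n}} where

  0<n : 0 < n
  0<n = >-nonZero⁻¹ n

  mod-cong : ∀ m → Cong n (toℕ (m mod n)) m
  mod-cong m = m / n , 0 , trans (cong (_+ m / n * n) (FinP.toℕ-fromℕ< (m%n<n m n))) (trans (sym (m≡m%n+[m/n]*n m n)) (sym (+-identityʳ m)))

  cong-fin : ∀ {a b : Fin n} → Cong n (toℕ a) (toℕ b) → a ≡ b
  cong-fin {a} {b} c = FinP.toℕ-injective (cong-unique (FinP.toℕ<n a) (FinP.toℕ<n b) c)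

  private
    +ₙ-assoc : ∀ (a b c : Fin n) → (a +ₙ b) +ₙ c ≡ a +ₙ (b +ₙ c)
    +ₙ-assoc a b c = cong-fin (cong-trans (mod-cong _) (cong-trans (cong-+ (mod-cong _) cong-refl)
      (cong-trans (cong-≡ (+-assoc (toℕ a) (toℕ b) (toℕ c))) (cong-sym (cong-trans (mod-cong _) (cong-+ (cong-refl {k = toℕ a}) (mod-cong _)))))))

    +ₙ-identityˡ : ∀ (a : Fin n) → (0 mod n) +ₙ a ≡ a
    +ₙ-identityˡ a = cong-fin (cong-trans (mod-cong _) (cong-+ (mod-cong 0) cong-refl))

    +ₙ-comm : ∀ (a b : Fin n) → a +ₙ b ≡ b +ₙ a
    +ₙ-comm a b = cong (_mod n) (+-comm (toℕ a) (toℕ b))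

    -ₙ_ : Fin n → Fin n
    -ₙ a = (n ∸ toℕ a) mod n

    +ₙ-inverseˡ : ∀ (a : Fin n) → (-ₙ a) +ₙ a ≡ 0 mod n
    +ₙ-inverseˡ a = cong-fin (cong-trans (mod-cong _) (cong-trans (cong-+ (mod-cong _) cong-refl)
      (cong-trans (cong-≡ (m∸n+n≡m (<⇒≤ (FinP.toℕ<n a)))) (cong-trans (0 , 1 , refl) (cong-sym (mod-cong 0))))))

  group : AbelianGroup Level.zero Level.zero
  group = record
    { Carrier = Fin r → Fin n
    ; _≈_ = λ x y → ∀ i → x i ≡ y i
    ; _∙_ = λ x y i → x i +ₙ y i
    ; ε = λ _ → 0 mod n
    ; _⁻¹ = λ x i → -ₙ (x i)
    ; isAbelianGroup = record
      { isGroup = record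
        { isMonoid = record
          { isSemigroup = record
            { isMagma = record
              { isEquivalence = record
                { refl = λ _ → refl
                ; sym = λ p i → sym (p i)
                ; trans = λ p q i → trans (p i) (q i)
                }
              ; ∙-cong = λ p q i → cong₂ _+ₙ_ (p i) (q i)
              }
            ; assoc = λ x y z i → +ₙ-assoc (x i) (y i) (z i)
            }
          ; identity = (λ x i → +ₙ-identityˡ (x i)) , λ x i → trans (+ₙ-comm (x i) (0 mod n)) (+ₙ-identityˡ (x i))
          }
        ; inverse = (λ x i → +ₙ-inverseˡ (x i)) , λ x i → trans (+ₙ-comm (x i) (-ₙ (x i))) (+ₙ-inverseˡ (x i))
        ; ⁻¹-cong = λ p i → cong -ₙ_ (p i)
        }
      ; comm = λ x y i → +ₙ-comm (x i) (y i)
      }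
    }

  open Families group

  _≟ᶜ_ : ∀ x y → Dec (x ≈ y)
  x ≟ᶜ y = FinP.all? (λ i → x i Fin.≟ y i)

  ⊗-cong : ∀ k x i → Cong n (toℕ ((k ⊗ x) i)) (k * toℕ (x i))
  ⊗-cong zero    x i = mod-cong 0
  ⊗-cong (suc k) x i = cong-trans (mod-cong _) (cong-+ cong-refl (⊗-cong k x i))

  exponent : ∀ g → n ⊗ g ≈ ε
  exponent g i = cong-fin (cong-trans (⊗-cong n g i) (cong-trans (0 , toℕ (g i) , trans (+-identityʳ _) (*-comm n (toℕ (g i)))) (cong-sym (mod-cong 0))))

  dot : Vec C t → Vec ℕ t → Fin r → ℕ
  dot []      []      i = 0
  dot (g ∷ G) (k ∷ x) i = k * toℕ (g i) + dot G x i

  eval-cong : (G : Vec C t) (x : Vec ℕ t) (i : Fin r) → Cong n (toℕ (eval G x i)) (dot G x i)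
  eval-cong []      []      i = mod-cong 0
  eval-cong (g ∷ G) (k ∷ x) i = cong-trans (mod-cong _) (cong-+ (⊗-cong k g i) (eval-cong G x i))

  elements : Vec C (n ^ r)
  elements = Vec.tabulate Fin.finToFun

  index : ∀ g → ∃ λ i → g ≈ lookup elements i
  index g = Fin.funToFin g , λ i → trans (sym (FinP.finToFun-funToFin g i))
    (cong (λ f → f i) (sym (VecP.lookup∘tabulate Fin.finToFun (Fin.funToFin g))))

  module _ (2≤n : 2 ≤ n) where
    unit : Fin r → C
    unit j i with i Fin.≟ j
    ... | yes _ = 1 mod n
    ... | no _  = 0 mod n

    units : Vec C r
    units = Vec.tabulate unit

    private
      dot-tabulate : ∀ {t} (f : Fin t → C) (j₀ : Fin t) i → toℕ (f j₀ i) ≡ 1 → (∀ j → j ≢ j₀ → toℕ (f j i) ≡ 0) →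
        ∀ x → dot (Vec.tabulate f) x i ≡ lookup x j₀
      dot-tabulate {suc t} f zero i one zeros (k ∷ x) = trans (cong₂ _+_ (trans (cong (k *_) one) (*-identityʳ k))
          (rest (f ∘ suc) (λ j → zeros (suc j) λ ()) x)) (+-identityʳ k)
        where
        rest : ∀ {t} (f : Fin t → C) → (∀ j → toℕ (f j i) ≡ 0) → ∀ x → dot (Vec.tabulate f) x i ≡ 0
        rest f h []      = refl
        rest f h (k ∷ x) = cong₂ _+_ (trans (cong (k *_) (h zero)) (*-zeroʳ k)) (rest (f ∘ suc) (h ∘ suc) x)
      dot-tabulate {suc t} f (suc j₀) i one zeros (k ∷ x) = cong₂ _+_
        (trans (cong (k *_) (zeros zero λ ())) (*-zeroʳ k))
        (dot-tabulate (f ∘ suc) j₀ i one (λ j j≢ → zeros (suc j) (j≢ ∘ FinP.suc-injective)) x)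

      toℕ-mod-< : ∀ {m} → m < n → toℕ (m mod n) ≡ m
      toℕ-mod-< {m} m<n = cong-unique (FinP.toℕ<n (m mod n)) m<n (mod-cong m)

    units-indep : Indep n units
    units-indep = (λ i → exponent (lookup units i)) , λ x zx i → cong-∣
      (cong-trans (cong-sym (cong-trans (cong-≡ (cong toℕ (zx i))) (mod-cong 0)))
        (cong-trans (eval-cong units x i) (cong-≡ (dot-tabulate unit i i (one i) (λ j j≢ → zeros i j (j≢ ∘ sym)) x))))
      (n ∣0)
      where
      one : ∀ i → toℕ (unit i i) ≡ 1
      one i with i Fin.≟ i
      ... | yes _ = toℕ-mod-< 2≤n
      ... | no ¬p = ⊥-elim (¬p refl)
      zeros : ∀ i j → i ≢ j → toℕ (unit j i) ≡ 0
      zeros i j i≢j with i Fin.≟ j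
      ... | yes p = ⊥-elim (i≢j p)
      ... | no _  = toℕ-mod-< 0<n

  private
    abstract
      -- The `P`-torsion of ℤ / n consists of the elements `q n / P`; since `q < P`, the number `q`
      -- serves as a base-`P` digit.
      torsion-quotient : ∀ P → 0 < P → ∀ z → P ⊗ z ≈ ε → ∀ i → ∃ λ q → q < P × P * toℕ (z i) ≡ q * n
      torsion-quotient P 0<P z Pz i = q , *-cancelʳ-< n q P (subst (_< P * n) e (*-monoʳ-< P {{>-nonZero 0<P}} (FinP.toℕ<n (z i)))) , e
        where
        n∣ : n ∣ P * toℕ (z i)
        n∣ = cong-∣ (cong-trans (cong-sym (cong-trans (cong-≡ (cong toℕ (Pz i))) (mod-cong 0))) (⊗-cong P z i)) (n ∣0)
        q : ℕ
        q = quotient n∣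
        e : P * toℕ (z i) ≡ q * n
        e = _∣_.equality n∣

  -- (multiplicities below P) ↦ (the P-torsion element they represent) is injective, and there are at most P ^ r such elements
  indep-rank : ∀ {P s} → 2 ≤ P → (F : Vec C s) → Indep P F → s ≤ r
  indep-rank {P} {s} 2≤P F indep = functions-≤ 2≤P φ injective
    where
    0<P : 0 < P
    0<P = ≤-trans (s≤s z≤n) 2≤P
    instance
      P≢0 : NonZero P
      P≢0 = >-nonZero 0<P
    element : (Fin s → Fin P) → C
    element f = eval F (Vec.tabulate (toℕ ∘ f))
    quot : ∀ f i → ∃ λ q → q < P × P * toℕ (element f i) ≡ q * n
    quot f = torsion-quotient P 0<P (element f) (⊗-eval P F (proj₁ indep) (Vec.tabulate (toℕ ∘ f)))
    φ : (Fin s → Fin P) → (Fin r → Fin P)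
    φ f i = Fin.fromℕ< (proj₁ (proj₂ (quot f i)))
    same-digit : ∀ {z z′ q q′} (lt : q < P) (lt′ : q′ < P) → P * z ≡ q * n → P * z′ ≡ q′ * n → Fin.fromℕ< lt ≡ Fin.fromℕ< lt′ → z ≡ z′
    same-digit {z} {z′} lt lt′ e e′ eq = *-cancelˡ-≡ z z′ P (trans e (trans (cong (_* n)
      (trans (sym (FinP.toℕ-fromℕ< lt)) (trans (cong toℕ eq) (FinP.toℕ-fromℕ< lt′)))) (sym e′)))
    injective : ∀ f g → (∀ i → φ f i ≡ φ g i) → ∀ j → f j ≡ g j
    injective f g h j = FinP.toℕ-injective (cong-unique (FinP.toℕ<n (f j)) (FinP.toℕ<n (g j))
      (subst₂ (Cong P) (VecP.lookup∘tabulate (toℕ ∘ f) j) (VecP.lookup∘tabulate (toℕ ∘ g) j)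
        (indep-reflects {F = F} indep (Vec.tabulate (toℕ ∘ f)) (Vec.tabulate (toℕ ∘ g))
          (λ i → FinP.toℕ-injective (same-digit (proj₁ (proj₂ (quot f i))) (proj₁ (proj₂ (quot g i)))
            (proj₂ (proj₂ (quot f i))) (proj₂ (proj₂ (quot g i))) (h i))) j)))

-- Prime power factors

-- p is the least divisor ≥ 2 of some number, hence behaves like a prime
least-divisor : ∀ b → 2 ≤ b → ∃ λ p → 2 ≤ p × p ∣ b × (∀ x → p ∣ x ⊎ Coprime p x)
least-divisor b 2≤b with least (λ m → (2 ≤? m) ×-dec (m ∣? b)) b (2≤b , ∣-refl)
... | p , (2≤p , p∣b) , _ , min = p , 2≤p , p∣b , dichotomy
  where
  dichotomy : ∀ x → p ∣ x ⊎ Coprime p x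
  dichotomy x with gcd p x in eq
  ... | 0 = ⊥-elim (<⇒≱ 2≤p (≤-trans (≤-reflexive (0∣⇒≡0 (subst (_∣ p) eq (gcd[m,n]∣m p x)))) z≤n))
  ... | 1 = inj₂ (gcd≡1⇒coprime eq)
  ... | g@(suc (suc _)) with g <? p
  ...   | yes g<p = ⊥-elim (min g g<p (s≤s (s≤s z≤n) , ∣-trans (subst (_∣ p) eq (gcd[m,n]∣m p x)) p∣b))
  ...   | no g≮p  = inj₁ (subst (_∣ x) (≤-antisym (∣⇒≤ {{>-nonZero (≤-trans (s≤s z≤n) 2≤p)}} (subst (_∣ p) eq (gcd[m,n]∣m p x))) (≮⇒≥ g≮p))
                      (subst (_∣ x) eq (gcd[m,n]∣n p x)))

strip : ∀ p → 2 ≤ p → (∀ x → p ∣ x ⊎ Coprime p x) → ∀ m → 0 < m → ∃₂ λ j q → m ≡ p ^ j * q × Coprime p q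
strip p 2≤p dich = <-rec (λ m → 0 < m → ∃₂ λ j q → m ≡ p ^ j * q × Coprime p q) step
  where
  step : ∀ m → (∀ {l} → l < m → 0 < l → ∃₂ λ j q → l ≡ p ^ j * q × Coprime p q) → 0 < m →
    ∃₂ λ j q → m ≡ p ^ j * q × Coprime p q
  step m rec 0<m with dich m
  ... | inj₂ cop = 0 , m , sym (*-identityˡ m) , cop
  ... | inj₁ (divides zero e) = ⊥-elim (<-irrefl (sym e) 0<m)
  ... | inj₁ (divides l@(suc _) refl) with rec (m<m*n l p {{_}} 2≤p) (s≤s z≤n)
  ...   | j , q , e , cop = suc j , q , trans (cong (_* p) e) (sh (p ^ j) q p) , cop
    where
    sh : ∀ x q p → x * q * p ≡ p * x * q
    sh = solve-∀

power-divisor : ∀ {p a} → 2 ≤ p → Coprime p a → ∀ k m → p ^ k ∣ m * a → p ^ k ∣ m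
power-divisor 2≤p cop zero    m h = 1∣ m
power-divisor {p} {a} 2≤p cop (suc k) m h
  with coprime-divisor cop (subst (p ∣_) (*-comm m a) (∣-trans (m∣m*n (p ^ k)) h))
... | divides q refl = subst (p * p ^ k ∣_) (*-comm p q) (*-monoʳ-∣ p (power-divisor 2≤p cop k q
  (*-cancelˡ-∣ p {{>-nonZero (≤-trans (s≤s z≤n) 2≤p)}} (subst (p * p ^ k ∣_) (sh q p a) h))))
  where
  sh : ∀ q p a → q * p * a ≡ p * (q * a)
  sh = solve-∀

power-cancel : ∀ {p a} → Coprime p a → ∀ k m → a ∣ m * p ^ k → a ∣ m
power-cancel cop zero    m h = subst (_ ∣_) (*-identityʳ m) h
power-cancel {p} {a} cop (suc k) m h = power-cancel cop k m
  (coprime-divisor (λ (x , y) → cop (y , x)) (subst (a ∣_) (sh m p (p ^ k)) h))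
  where
  sh : ∀ m p x → m * (p * x) ≡ p * (m * x)
  sh = solve-∀

-- Zero-sum free sequences and the Davenport constant

module ZeroSumFree {c ℓ : Level} (𝔾 : AbelianGroup c ℓ) where
  open Families 𝔾
  open Sequences 𝔾

  -- `LongAtom k` says that the Davenport constant is at least `k`, and `HasZsf k` says that it
  -- exceeds `k`.
  LongAtom : ℕ → Set (c Level.⊔ ℓ)
  LongAtom k = ∃ λ A → L.Atom A × k ≤ length A

  Zsf : Vec C t → Set ℓ
  Zsf S = ∀ x → (∀ i → lookup x i ≤ 1) → Zs S x → x ≡ 𝟘

  HasZsf : ℕ → Set (c Level.⊔ ℓ)
  HasZsf k = ∃ λ (S : Vec C k) → Zsf S

  zsf-tail : ∀ {g} {S : Vec C t} → Zsf (g ∷ S) → Zsf S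
  zsf-tail zsf x x≤1 zx = VecP.∷-injectiveʳ (zsf (0 ∷ x) (λ { zero → z≤n ; (suc i) → x≤1 i }) (≈-trans (identityˡ _) zx))

  long-atom⇒zsf : ∀ {k} → LongAtom (suc k) → HasZsf k
  long-atom⇒zsf (a ∷ A , at , s≤s k≤) = shorten Zsf (λ {_} {g} {S} → zsf-tail {g = g} {S}) k≤ (Vec.fromList A) zsf
    where
    G = Vec.fromList (a ∷ A)
    at𝟙 : Atom G 𝟙
    at𝟙 = L⇒atom G (↭-reflexive (seq-fromList (a ∷ A))) at
    zsf : Zsf (Vec.fromList A)
    zsf x x≤1 zx with x ≟ᵛ 𝟘
    ... | yes p = p
    ... | no x≢𝟘 with atom-min G {𝟙} {0 ∷ x} at𝟙 (≈-trans (identityˡ _) zx) (x≢𝟘 ∘ VecP.∷-injectiveʳ)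
                       (≤⇒⊑ (0 ∷ x) 𝟙 λ i → subst (lookup (0 ∷ x) i ≤_) (sym (lookup-𝟙 i)) (le i))
      where
      le : ∀ i → lookup (0 ∷ x) i ≤ 1
      le zero    = z≤n
      le (suc i) = x≤1 i
    ... | ()

  zsf⇒long-atom : ∀ {k} → HasZsf k → LongAtom (suc k)
  zsf⇒long-atom {k} (S , zsf) = seq G 𝟙 , atom⇒L G ↭-refl at , ≤-reflexive (sym (trans (length-seq G 𝟙) (size-𝟙 (suc k))))
    where
    G : Vec C (suc k)
    G = eval S 𝟙 ⁻¹ ∷ S
    at : Atom G 𝟙
    at = ≈-trans (∙-congʳ (×-homo-1 _)) (inverseˡ (eval S 𝟙)) , (λ ()) , irr
      where
      le : ∀ (u v : Vec ℕ (suc k)) → 𝟙 ≡ u ⊕ v → ∀ i → lookup u i ≤ 1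
      le u v e i = subst (lookup u i ≤_) (lookup-𝟙 i) (⊑⇒≤ {x = u} {𝟙} (v , e) i)
      irr : ∀ u v → Zs G u → Zs G v → 𝟙 ≡ u ⊕ v → u ≡ 𝟘 ⊎ v ≡ 𝟘
      irr (zero ∷ u) v zu zv e = inj₁ (cong (0 ∷_) (zsf u (le (0 ∷ u) v e ∘ suc) (≈-trans (≈-sym (identityˡ _)) zu)))
      irr (suc a ∷ u) (zero ∷ v) zu zv e = inj₂ (cong (0 ∷_) (zsf v (le (0 ∷ v) (suc a ∷ u) (trans e (⊕-comm (suc a ∷ u) (0 ∷ v))) ∘ suc) (≈-trans (≈-sym (identityˡ _)) zv)))
      irr (suc a ∷ u) (suc b ∷ v) zu zv e with trans (VecP.∷-injectiveˡ e) (cong suc (+-suc a b))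
      ... | ()

  -- if w has length 1 it is the class 0, which cancels from both factorizations
  two-lengths : (G : Vec C t) {x : Vec ℕ t} {m : ℕ} → 3 ≤ m → Fact G x 2 → Fact G x m → ∃ λ a → Atom G a × m ≤ size a
  two-lengths G {m = m} 3≤m (a ∷ b ∷ [] , (ata ∷ atb ∷ []) , _ , refl) (ws , aws , refl , e) with All.all? (λ w → 2 ≤? size w) ws
  -- If all factors have at least two elements, then `a` and `b` have at least `2 m` elements
  -- together, so one of them has `m`.
  ... | yes all with length ws ≤? size a | length ws ≤? size b
  ...   | yes p | _ = a , ata , p
  ...   | _ | yes p = b , atb , p
  ...   | no p | no q = ⊥-elim (<⇒≱ (+-mono-< (≰⇒> p) (≰⇒> q)) (begin
      length ws + length ws          ≡⟨ sh (length ws) ⟩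
      length ws * 2                  ≤⟨ sizes ws all ⟩
      size (sumV ws)                 ≡⟨ cong size (trans e (cong (a ⊕_) (⊕-identityʳ b))) ⟩
      size (a ⊕ b)                   ≡⟨ size-⊕ a b ⟩
      size a + size b                ∎))
    where
    open ≤-Reasoning
    sh : ∀ x → x + x ≡ x * 2
    sh = solve-∀
    sizes : ∀ ws → All (λ w → 2 ≤ size w) ws → length ws * 2 ≤ size (sumV ws)
    sizes []       []       = z≤n
    sizes (w ∷ ws) (p ∷ ps) = subst (2 + length ws * 2 ≤_) (sym (size-⊕ w (sumV ws))) (+-mono-≤ p (sizes ws ps))
  two-lengths {t} G 3≤m (a ∷ b ∷ [] , (ata ∷ atb ∷ []) , _ , refl) (ws , aws , refl , e) | no ¬all
    with find (AllP.¬All⇒Any¬ (λ w → 2 ≤? size w) ws ¬all)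
  ... | w , w∈ , ¬2≤ = ⊥-elim contra
    where
    atw : Atom G w
    atw = All.lookup aws w∈
    e′ : sumV ws ≡ a ⊕ b
    e′ = trans e (cong (a ⊕_) (⊕-identityʳ b))
    split = MemP.∈-∃++ w∈
    ys = proj₁ split
    zs = proj₁ (proj₂ split)
    ws≡ : ws ≡ ys ++ w ∷ zs
    ws≡ = proj₂ (proj₂ split)
    rest : sumV ws ≡ w ⊕ sumV (ys ++ zs)
    rest = trans (cong sumV ws≡) (trans (sumV-++ ys (w ∷ zs)) (trans (⊕-swap (sumV ys) w (sumV zs)) (cong (w ⊕_) (sym (sumV-++ ys zs)))))
    len : length ws ≡ suc (length (ys ++ zs))
    len = trans (cong length ws≡) (trans (ListP.length-++ ys) (trans (+-suc (length ys) (length zs)) (cong suc (sym (ListP.length-++ ys)))))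
    finish : ∀ {a b} → Atom G a → Atom G b → a ⊕ b ≡ w ⊕ sumV (ys ++ zs) → w ⊑ a → ⊥
    finish {a} {b} ata atb eq w⊑ with atom-min G ata (proj₁ atw) (proj₁ (proj₂ atw)) w⊑
    ... | refl = <⇒≱ 3≤m (≤-reflexive (trans len (cong suc (atom-fact G atb (ys ++ zs , AllP.++⁺ (proj₁ parts) (All.tail (proj₂ parts)) ,
        refl , sym (⊕-cancelˡ w eq))))))
      where parts = AllP.++⁻ ys (subst (All (Atom G)) ws≡ aws)
    nz = nonzero-coordinate w (proj₁ (proj₂ atw))
    i = proj₁ nz
    v = proj₁ (single-⊑ i 1 w (proj₂ nz))
    w≡ : w ≡ single i 1 ⊕ v
    w≡ = proj₂ (single-⊑ i 1 w (proj₂ nz))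
    v≡𝟘 : v ≡ 𝟘
    v≡𝟘 = size-0 v (n≤0⇒n≡0 (s≤s⁻¹ (≤-trans (≤-reflexive (sym (trans (cong size w≡) (trans (size-⊕ (single i 1) v)
      (cong (_+ size v) (size-single i 1)))))) (s≤s⁻¹ (≰⇒> ¬2≤)))))
    w⊑ : ∀ x → 0 < lookup x i → w ⊑ x
    w⊑ x p = subst (_⊑ x) (sym (trans w≡ (trans (cong (single i 1 ⊕_) v≡𝟘) (⊕-identityʳ _)))) (single-⊑ i 1 x p)
    0<sum : 0 < lookup a i + lookup b i
    0<sum = ≤-trans (proj₂ nz) (≤-trans (⊑⇒≤ {x = w} {sumV ws} (_ , rest) i) (≤-reflexive (trans (cong (λ z → lookup z i) e′) (lookup-⊕ a b i))))
    contra : ⊥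
    contra with lookup a i in eq
    ... | suc _ = finish ata atb (trans (sym e′) rest) (w⊑ a (subst (0 <_) (sym eq) (s≤s z≤n)))
    ... | zero  = finish atb ata (trans (⊕-comm b a) (trans (sym e′) rest)) (w⊑ b (subst (λ z → 0 < z + lookup b i) eq 0<sum))

  private
    pair : C → List C
    pair a = a ∷ a ⁻¹ ∷ []

    σ-++ : ∀ xs ys → L.σ (xs ++ ys) ≈ L.σ xs ∙ L.σ ys
    σ-++ []       ys = ≈-sym (identityˡ _)
    σ-++ (x ∷ xs) ys = ≈-trans (∙-congˡ (σ-++ xs ys)) (≈-sym (assoc x (L.σ xs) (L.σ ys)))

    σ-⁻¹ : ∀ xs → L.σ (List.map _⁻¹ xs) ≈ L.σ xs ⁻¹
    σ-⁻¹ []       = ≈-sym (Algebra.Properties.AbelianGroup.ε⁻¹≈ε 𝔾)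
    σ-⁻¹ (x ∷ xs) = ≈-trans (∙-congˡ (σ-⁻¹ xs)) (Algebra.Properties.AbelianGroup.⁻¹-∙-comm 𝔾 x (L.σ xs))

    zerosum-⁻¹ : ∀ {xs} → L.ZeroSum xs → L.ZeroSum (List.map _⁻¹ xs)
    zerosum-⁻¹ {xs} z = ≈-trans (σ-⁻¹ xs) (≈-trans (⁻¹-cong z) (Algebra.Properties.AbelianGroup.ε⁻¹≈ε 𝔾))

    ⁻¹-↭ : ∀ {xs ys} → xs ↭ ys → List.map _⁻¹ xs ↭ List.map _⁻¹ ys
    ⁻¹-↭ = ↭P.map⁺ setoid ⁻¹-cong

    ⁻¹⁻¹ : ∀ xs → xs ↭ List.map _⁻¹ (List.map _⁻¹ xs)
    ⁻¹⁻¹ []       = ↭-refl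
    ⁻¹⁻¹ (x ∷ xs) = Data.List.Relation.Binary.Permutation.Setoid.prep (≈-sym (Algebra.Properties.AbelianGroup.⁻¹-involutive 𝔾 x)) (⁻¹⁻¹ xs)

    map-[] : ∀ {xs : List C} → List.map _⁻¹ xs ≡ [] → xs ≡ []
    map-[] {[]} e = refl

    atom-⁻¹ : ∀ {A} → L.Atom A → L.Atom (List.map _⁻¹ A)
    atom-⁻¹ {A} (zA , A≢[] , irr) = zerosum-⁻¹ {A} zA , A≢[] ∘ map-[] , λ U V zU zV p →
      [ inj₁ ∘ map-[] , inj₂ ∘ map-[] ]′ (irr (List.map _⁻¹ U) (List.map _⁻¹ V) (zerosum-⁻¹ {U} zU) (zerosum-⁻¹ {V} zV)
        (↭-trans (⁻¹⁻¹ A) (↭-trans (⁻¹-↭ p) (↭-reflexive (ListP.map-++ _⁻¹ U V)))))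

  atom-pair : ∀ {a} → ¬ a ≈ ε → L.Atom (pair a)
  atom-pair {a} a≉ε = ≈-trans (∙-congˡ (identityʳ _)) (inverseʳ a) , (λ ()) , irr
    where
    irr : ∀ U V → L.ZeroSum U → L.ZeroSum V → pair a ↭ U ++ V → U ≡ [] ⊎ V ≡ []
    irr []              V               zU zV p = inj₁ refl
    irr (u ∷ U)         []              zU zV p = inj₂ refl
    irr (u ∷ [])        (v ∷ [])        zU zV p with ↭P.∈-resp-↭ p (here ≈-refl)
    ... | here e         = ⊥-elim (a≉ε (≈-trans e (≈-trans (≈-sym (identityʳ u)) zU)))
    ... | there (here e) = ⊥-elim (a≉ε (≈-trans e (≈-trans (≈-sym (identityʳ v)) zV)))
    irr (u ∷ [])        (v ∷ v′ ∷ V)    zU zV p with ↭P.xs↭ys⇒|xs|≡|ys| p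
    ... | ()
    irr (u ∷ u′ ∷ U)    (v ∷ V)         zU zV p
      with trans (suc-injective (suc-injective (↭P.xs↭ys⇒|xs|≡|ys| p))) (trans (ListP.length-++ U) (+-suc (length U) (length V)))
    ... | ()

  private
    nonzero : ∀ {A} → L.Atom A → 2 ≤ length A → ∀ {a} → a ∈ A → ¬ a ≈ ε
    nonzero {A} (zA , _ , irr) 2≤ {a} a∈ a≈ε with MemP.∈-∃++ a∈
    ... | ys , zs , refl with irr (a ∷ []) (ys ++ zs) (≈-trans (identityʳ a) a≈ε)
            (≈-trans (≈-trans (≈-sym (identityˡ _)) (∙-congʳ (≈-sym a≈ε))) (≈-trans (≈-sym (σ-resp (↭P.↭-shift {v = a} ys zs))) zA))
            (↭P.↭-shift ys zs)
    ...   | inj₁ ()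
    ...   | inj₂ e = <⇒≱ 2≤ (≤-reflexive (trans (ListP.length-++ ys) (trans (+-suc (length ys) (length zs))
              (cong suc (trans (sym (ListP.length-++ ys)) (cong length e))))))

    pairs-↭ : ∀ A → A ++ List.map _⁻¹ A ↭ List.concat (List.map pair A)
    pairs-↭ []      = ↭-refl
    pairs-↭ (a ∷ A) = ↭-prep a (↭-trans (↭P.↭-shift A (List.map _⁻¹ A)) (↭-prep (a ⁻¹) (pairs-↭ A)))

  -- The product of `A` and `-A` regroups into the pairs `a (-a)`. These are atoms, because an atom
  -- with at least two elements does not contain 0.
  atom-times-inverse : ∀ {A} → L.Atom A → 2 ≤ length A →
    L.ZeroSum (A ++ List.map _⁻¹ A) × 2 L.∈L (A ++ List.map _⁻¹ A) × length A L.∈L (A ++ List.map _⁻¹ A)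
  atom-times-inverse {A} at 2≤ =
    ≈-trans (σ-++ A (List.map _⁻¹ A)) (≈-trans (∙-cong (proj₁ at) (zerosum-⁻¹ {A} (proj₁ at))) (identityˡ ε)) ,
    (A ∷ List.map _⁻¹ A ∷ [] , at ∷ atom-⁻¹ at ∷ [] , refl , ↭-reflexive (cong (A ++_) (sym (ListP.++-identityʳ _)))) ,
    (List.map pair A , AllP.map⁺ (All.tabulate λ a∈ → atom-pair (nonzero at 2≤ a∈)) , ListP.length-map pair A , pairs-↭ A)

module _ {c₁ ℓ₁ c₂ ℓ₂ : Level} (ℍ : AbelianGroup c₁ ℓ₁) (𝕂 : AbelianGroup c₂ ℓ₂) where
  private
    module H = ZeroSumFree ℍ
    module K = ZeroSumFree 𝕂
    module SK = Sequences 𝕂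

  long-atom-transfer : AbelianGroup.rawMonoid ℍ ⊆ℒ AbelianGroup.rawMonoid 𝕂 → ∀ {k} → 3 ≤ k → H.LongAtom k → K.LongAtom k
  long-atom-transfer ⊆ℒ 3≤k (A , at , k≤) =
    let (zB , two , long) = H.atom-times-inverse at (≤-trans (s≤s (s≤s z≤n)) (≤-trans 3≤k k≤))
        (B′ , _ , eqv) = ⊆ℒ _ zB
        G = Vec.fromList B′
        p = SK.↭-reflexive (SK.seq-fromList B′)
        (a , ata , m≤) = K.two-lengths G (≤-trans 3≤k k≤) (SK.∈L⇒fact G p (Equivalence.to (eqv 2) two))
                           (SK.∈L⇒fact G p (Equivalence.to (eqv (length A)) long))
    in SK.seq G a , SK.atom⇒L G SK.↭-refl ata , ≤-trans k≤ (≤-trans m≤ (≤-reflexive (sym (SK.length-seq G a))))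

-- a prime power p ^ (j + 1) dividing β exactly divides α only to the power p ^ j
private
  order-split′ : ∀ w a₁ b₁ → 0 < w → 2 ≤ b₁ → Coprime b₁ a₁ →
    ∃₂ λ p j → ∃₂ λ a e → 2 ≤ p × Coprime p a × a₁ * w ≡ a * p ^ j × b₁ * w ≡ p ^ suc j * e
  order-split′ w a₁ b₁ 0<w 2≤b₁ cop with least-divisor b₁ 2≤b₁
  ... | p , 2≤p , divides b₂ refl , dich with strip p 2≤p dich w 0<w
  ... | j , q , refl , cop-q = p , j , q * a₁ , b₂ * q , 2≤p , cop-a , sh₁ a₁ (p ^ j) q , sh₂ b₂ p (p ^ j) q
    where
    not-1 : p ∣ 1 → ⊥
    not-1 d = <⇒≱ 2≤p (∣⇒≤ d)
    cop-a : Coprime p (q * a₁)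
    cop-a = [ (λ d → ⊥-elim (not-1 (∣-reflexive (cop (n∣m*n b₂ , coprime-divisor cop-q d))))) , id ]′ (dich (q * a₁))
    sh₁ : ∀ x y z → x * (y * z) ≡ z * x * y
    sh₁ = solve-∀
    sh₂ : ∀ b p x q → b * p * (x * q) ≡ p * x * (b * q)
    sh₂ = solve-∀

abstract
  order-split : ∀ α β → 0 < α → 0 < β → ¬ β ∣ α →
    ∃₂ λ p j → ∃₂ λ a e → 2 ≤ p × Coprime p a × α ≡ a * p ^ j × β ≡ p ^ suc j * e
  order-split α β 0<α 0<β β∤α with gcd[m,n]∣m α β | gcd[m,n]∣n α β | gcd-greatest {α} {β} | gcd[m,n]≢0 α β (inj₁ λ e → <-irrefl (sym e) 0<α)
  ... | divides a₁ a≡ | divides b₁ b≡ | greatest | w≢0 =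
    subst₂ (λ α β → ∃₂ λ p j → ∃₂ λ a e → 2 ≤ p × Coprime p a × α ≡ a * p ^ j × β ≡ p ^ suc j * e) (sym a≡) (sym b≡)
      (order-split′ (gcd α β) a₁ b₁ (n≢0⇒n>0 w≢0)
        (≤∧≢⇒< (n≢0⇒n>0 λ e → <-irrefl (sym (trans b≡ (cong (_* gcd α β) e))) 0<β)
          λ e → β∤α (divides a₁ (trans a≡ (cong (a₁ *_) (sym (trans b≡ (trans (cong (_* gcd α β) (sym e)) (*-identityˡ _))))))))
        λ {i} (i∣b₁ , i∣a₁) → ∣1⇒≡1 (*-cancelʳ-∣ (gcd α β) {{≢-nonZero w≢0}} (subst (i * gcd α β ∣_) (sym (*-identityˡ _))
          (greatest (subst (i * gcd α β ∣_) (sym a≡) (*-monoˡ-∣ (gcd α β) i∣a₁)) (subst (i * gcd α β ∣_) (sym b≡) (*-monoˡ-∣ (gcd α β) i∣b₁))))))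

-- Decisions and the exponent in an enumerated group

module Finite {c ℓ : Level} (𝔾 : AbelianGroup c ℓ)
  (_≟ᵍ_ : ∀ x y → Dec (AbelianGroup._≈_ 𝔾 x y))
  (N : ℕ) (E : Vec (AbelianGroup.Carrier 𝔾) N) (index : ∀ g → ∃ λ i → AbelianGroup._≈_ 𝔾 g (lookup E i)) where
  open Families 𝔾
  open Decidable _≟ᵍ_
  open ZeroSumFree 𝔾

  private
    idx : C → Fin N
    idx g = proj₁ (index g)

    idx-injective : ∀ {g h} → idx g ≡ idx h → g ≈ h
    idx-injective {g} {h} e = ≈-trans (proj₂ (index g)) (≈-sym (≈-trans (proj₂ (index h)) (reflexive (cong (lookup E) (sym e)))))

    cancelˡ : ∀ x {y z} → x ∙ y ≈ x ∙ z → y ≈ z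
    cancelˡ x = Algebra.Properties.AbelianGroup.∙-cancelˡ 𝔾 x _ _

  eval-resp : {S S′ : Vec C t} → (∀ j → lookup S j ≈ lookup S′ j) → ∀ x → eval S x ≈ eval S′ x
  eval-resp {S = []}    {[]}     h []      = ≈-refl
  eval-resp {S = _ ∷ S} {_ ∷ S′} h (k ∷ x) = ∙-cong (×-congʳ k (h zero)) (eval-resp {S = S} {S′} (h ∘ suc) x)

  any-family? : ∀ {p k} (Q : Vec C k → Set p) → (∀ S → Dec (Q S)) →
    (∀ {S S′} → (∀ j → lookup S j ≈ lookup S′ j) → Q S → Q S′) → Dec (∃ Q)
  any-family? {k = k} Q Q? resp with FinP.any? (λ κ → Q? (family κ))
    where
    family : Fin (N ^ k) → Vec C k
    family κ = Vec.tabulate (lookup E ∘ Fin.finToFun {N} κ)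
  ... | yes (κ , q) = yes (_ , q)
  ... | no none     = no λ (S , q) → none (Fin.funToFin (idx ∘ lookup S) , resp (agree S) q)
    where
    agree : ∀ S j → lookup S j ≈ lookup (Vec.tabulate (lookup E ∘ Fin.finToFun {N} (Fin.funToFin (idx ∘ lookup S)))) j
    agree S j = ≈-trans (proj₂ (index (lookup S j))) (reflexive (trans
      (cong (lookup E) (sym (FinP.finToFun-funToFin (idx ∘ lookup S) j)))
      (sym (VecP.lookup∘tabulate (lookup E ∘ Fin.finToFun {N} (Fin.funToFin (idx ∘ lookup S))) j))))

  zsf? : (S : Vec C t) → Dec (Zsf S)
  zsf? {t} S with search-below (λ x → Zs? S x ×-dec ¬? (x ≟ᵛ 𝟘)) (𝟙 {t})
  ... | inj₁ (x , le , zx , x≢𝟘) = no λ zsf → x≢𝟘 (zsf x (λ i → subst (lookup x i ≤_) (lookup-𝟙 i) (le i)) zx)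
  ... | inj₂ none = yes zsf
    where
    zsf : Zsf S
    zsf x le zx with x ≟ᵛ 𝟘
    ... | yes p = p
    ... | no ¬p = ⊥-elim (none x (λ i → subst (lookup x i ≤_) (sym (lookup-𝟙 i)) (le i)) (zx , ¬p))

  has-zsf? : ∀ k → Dec (HasZsf k)
  has-zsf? k = any-family? Zsf zsf? λ {S} {S′} h zsf x le zx → zsf x le (≈-trans (eval-resp {S = S} {S′} h x) zx)

  -- Once `P` annihilates the family, relations matter only modulo `P`, so coordinates up to `P - 1`
  -- are searched for a nonzero relation.
  indep? : ∀ P → 0 < P → (F : Vec C t) → Dec (Indep P F)
  indep? P 0<P F with FinP.all? (λ i → (P ⊗ lookup F i) ≟ᵍ ε)
  ... | no ¬p = no (¬p ∘ proj₁)
  ... | yes Pf with search-below (λ x → Zs? F x ×-dec ¬? (x ≟ᵛ 𝟘)) (pred P · 𝟙)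
  ...   | inj₁ (x , le , zx , x≢𝟘) = no λ (_ , ind) → let (i , 0<xi) = nonzero-coordinate x x≢𝟘 in
            <⇒≱ (subst (lookup x i <_) (suc-pred P {{>-nonZero 0<P}}) (s≤s (≤-trans (le i)
              (≤-reflexive (trans (lookup-· (pred P) 𝟙 i) (trans (cong (pred P *_) (lookup-𝟙 i)) (*-identityʳ _)))))))
              (∣⇒≤ {{>-nonZero 0<xi}} (ind x zx i))
  ...   | inj₂ none = yes (Pf , ind)
    where
    instance
      P≢0 : NonZero P
      P≢0 = >-nonZero 0<P
    quotients remainders : ∀ {t} → Vec ℕ t → Vec ℕ t
    quotients  = Vec.map (_/ P)
    remainders = Vec.map (_% P)
    divide : ∀ {t} (x : Vec ℕ t) → x ≡ P · quotients x ⊕ remainders x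
    divide []      = refl
    divide (k ∷ x) = cong₂ _∷_ (trans (m≡m%n+[m/n]*n k P) (trans (+-comm (k % P) _) (cong (_+ k % P) (*-comm (k / P) P)))) (divide x)
    ind : ∀ x → Zs F x → ∀ i → P ∣ lookup x i
    ind x zx i with remainders x ≟ᵛ 𝟘
    ... | yes e = subst (P ∣_) (sym (trans (cong (λ v → lookup v i) (trans (divide x) (trans (cong (P · quotients x ⊕_) e) (⊕-identityʳ _))))
                    (lookup-· P (quotients x) i))) (m∣m*n _)
    ... | no ¬e = ⊥-elim (none (remainders x) small (zs-cancelˡ F (P · quotients x) {remainders x} (subst (Zs F) (divide x) zx)
                    (≈-trans (eval-· F P (quotients x)) (⊗-eval P F Pf (quotients x))) , ¬e))
      where
      small : ∀ i → lookup (remainders x) i ≤ lookup (pred P · 𝟙) i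
      small i = subst₂ _≤_ (sym (VecP.lookup-map i (_% P) x)) (sym (trans (lookup-· (pred P) 𝟙 i) (trans (cong (pred P *_) (lookup-𝟙 i)) (*-identityʳ _))))
        (<⇒≤pred (m%n<n (lookup x i) P))

  has-indep? : ∀ P → 0 < P → ∀ k → Dec (IndepExists P k)
  has-indep? P 0<P k = any-family? (Indep P) (indep? P 0<P) λ {S} {S′} h (Pf , ind) →
    (λ i → ≈-trans (×-congʳ P (≈-sym (h i))) (Pf i)) , λ x zx → ind x (≈-trans (eval-resp {S = S} {S′} h x) zx)

  private
    suffix : Vec C t → Fin (suc t) → C
    suffix []      zero    = ε
    suffix (g ∷ S) zero    = g ∙ suffix S zero
    suffix (g ∷ S) (suc i) = suffix S i

    prefix : (S : Vec C t) (j : Fin (suc t)) → ∃ λ x → (∀ i → lookup x i ≤ 1) × suffix S zero ≈ eval S x ∙ suffix S j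
    prefix S       zero    = 𝟘 , (λ i → subst (_≤ 1) (sym (lookup-𝟘 i)) z≤n) , ≈-sym (≈-trans (∙-congʳ (eval-𝟘 S)) (identityˡ _))
    prefix (g ∷ S) (suc j) = let (x , le , e) = prefix S j in 1 ∷ x , (λ { zero → ≤-refl ; (suc i) → le i }) ,
      ≈-trans (∙-congˡ e) (≈-trans (≈-sym (assoc _ _ _)) (∙-congʳ (∙-congʳ (≈-sym (×-homo-1 g)))))

    interval : (S : Vec C t) (i j : Fin (suc t)) → i Fin.< j →
      ∃ λ x → (∀ l → lookup x l ≤ 1) × x ≢ 𝟘 × suffix S i ≈ eval S x ∙ suffix S j
    interval (g ∷ S) zero    (suc j) lt = let (x , le , e) = prefix S j in 1 ∷ x , (λ { zero → ≤-refl ; (suc l) → le l }) , (λ ()) ,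
      ≈-trans (∙-congˡ e) (≈-trans (≈-sym (assoc _ _ _)) (∙-congʳ (∙-congʳ (≈-sym (×-homo-1 g)))))
    interval (g ∷ S) (suc i) (suc j) (s≤s lt) = let (x , le , x≢𝟘 , e) = interval S i j lt in 0 ∷ x ,
      (λ { zero → z≤n ; (suc l) → le l }) , x≢𝟘 ∘ VecP.∷-injectiveʳ , ≈-trans e (∙-congʳ (≈-sym (identityˡ _)))

  -- Pigeonhole on the `k + 1` suffix sums: two equal ones enclose a nonempty zero-sum block.
  zsf-bound : ∀ {k} → HasZsf k → k < N
  zsf-bound {k} (S , zsf) with suc k ≤? N
  ... | yes p = p
  ... | no ¬p with FinP.pigeonhole (≰⇒> ¬p) (idx ∘ suffix S)
  ... | i , j , i<j , e with interval S i j i<j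
  ... | x , le , x≢𝟘 , eq = ⊥-elim (x≢𝟘 (zsf x le (Algebra.Properties.AbelianGroup.∙-cancelʳ 𝔾 (suffix S j) _ _
    (≈-trans (≈-sym eq) (≈-trans (idx-injective e) (≈-sym (identityˡ _)))))))

  private
    -- Each element has a positive annihilator of size at most `N`, which divides `N !`. This
    -- provisional exponent makes orders available before the true exponent is known.
    torsion : ∀ g → (N !) ⊗ g ≈ ε
    torsion g with FinP.pigeonhole (n<1+n N) (λ (k : Fin (suc N)) → idx (toℕ k ⊗ g))
    ... | i , j , i<j , e with m≤n⇒∃[o]m+o≡n i<j
    ... | o , eq = ≈-trans (×-congˡ (_∣_.equality d)) (≈-trans (≈-sym (×-assocˡ g (quotient d) (suc o)))
            (≈-trans (×-congʳ (quotient d) og) (⊗-ε (quotient d))))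
      where
      j≡ : toℕ j ≡ toℕ i + suc o
      j≡ = trans (sym eq) (sym (+-suc (toℕ i) o))
      og : suc o ⊗ g ≈ ε
      og = cancelˡ (toℕ i ⊗ g) (≈-trans (≈-sym (×-homo-+ g (toℕ i) (suc o))) (≈-trans (×-congˡ (sym j≡))
        (≈-trans (≈-sym (idx-injective e)) (≈-sym (identityʳ _)))))
      d : suc o ∣ N !
      d = ∣-trans (m∣m*n (o !)) (m≤n⇒m!∣n! (≤-trans (m≤n+m (suc o) (toℕ i)) (≤-trans (≤-reflexive (sym j≡)) (s≤s⁻¹ (FinP.toℕ<n j)))))

    open Weights 𝔾 _≟ᵍ_ (N !) (1≤n! N) torsion

    ord-resp : ∀ {g h} → g ≈ h → ord g ∣ ord h
    ord-resp {g} {h} e = ord-∣ g (ord h) (≈-trans (×-congʳ (ord h) e) (ord-⊗ h))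

    multiple-ε : ∀ {g m k} → m ∣ k → m ⊗ g ≈ ε → k ⊗ g ≈ ε
    multiple-ε {g} {m} {k} d e = ≈-trans (×-congˡ (_∣_.equality d)) (≈-trans (≈-sym (×-assocˡ g (quotient d) m))
      (≈-trans (×-congʳ (quotient d) e) (⊗-ε (quotient d))))

    -- multiples of g and h of coprime orders a and p ^ (j + 1), where a p ^ j = ord g
    module LargerOrder (g h : C) (p j a e : ℕ) (2≤p : 2 ≤ p) (cop : Coprime p a)
      (og≡ : ord g ≡ a * p ^ j) (oh≡ : ord h ≡ p ^ suc j * e) where
      instance
        e≢0 : NonZero e
        e≢0 = ≢-nonZero λ eq → <-irrefl (sym (trans oh≡ (trans (cong (p ^ suc j *_) eq) (*-zeroʳ (p ^ suc j))))) (ord-pos h)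
        pʲ≢0 : NonZero (p ^ j)
        pʲ≢0 = ≢-nonZero λ eq → <-irrefl (sym (trans og≡ (trans (cong (a *_) eq) (*-zeroʳ a)))) (ord-pos g)
      x y z : C
      x = (p ^ j) ⊗ g
      y = e ⊗ h
      z = x ∙ y
      m : ℕ
      m = ord z
      swap-factors : ∀ a m p → a * m * p ≡ m * (a * p)
      swap-factors = solve-∀
      mz : ∀ k → (k * m) ⊗ x ∙ (k * m) ⊗ y ≈ ε
      mz k = ≈-trans (≈-sym (×-distrib-+ x y (k * m))) (multiple-ε {z} (n∣m*n k) (ord-⊗ z))
      amx : (a * m) ⊗ x ≈ ε
      amx = ≈-trans (×-assocˡ g (a * m) (p ^ j)) (multiple-ε {g} (subst (_∣ a * m * p ^ j) (sym og≡) (divides m (swap-factors a m (p ^ j)))) (ord-⊗ g))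
      amy : (a * m) ⊗ y ≈ ε
      amy = ≈-trans (≈-sym (identityˡ _)) (≈-trans (∙-congʳ (≈-sym amx)) (mz a))
      power∣m : p ^ suc j ∣ m
      power∣m = power-divisor 2≤p cop (suc j) m (*-cancelʳ-∣ e
        (subst₂ _∣_ oh≡ (cong (_* e) (*-comm a m)) (ord-∣ h (a * m * e) (≈-trans (≈-sym (×-assocˡ h (a * m) e)) amy))))
      pmy : (p ^ suc j * m) ⊗ y ≈ ε
      pmy = ≈-trans (×-assocˡ h (p ^ suc j * m) e) (multiple-ε {h} (subst (_∣ p ^ suc j * m * e) (sym oh≡) (divides m (swap-factors (p ^ suc j) m e))) (ord-⊗ h))
      pmx : (p ^ suc j * m) ⊗ x ≈ ε
      pmx = ≈-trans (≈-sym (identityʳ _)) (≈-trans (∙-congˡ (≈-sym pmy)) (mz (p ^ suc j)))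
      a∣mp : a ∣ m * p ^ suc j
      a∣mp = *-cancelʳ-∣ (p ^ j) (subst₂ _∣_ og≡ (cong (_* p ^ j) (*-comm (p ^ suc j) m))
        (ord-∣ g (p ^ suc j * m * p ^ j) (≈-trans (≈-sym (×-assocˡ g (p ^ suc j * m) (p ^ j))) pmx)))
      larger : ord g < ord z
      larger = go power∣m
        where
        go : p ^ suc j ∣ m → ord g < m
        go (divides c m≡) = begin-strict
          ord g                     <⟨ m<m*n (ord g) p {{>-nonZero (ord-pos g)}} 2≤p ⟩
          ord g * p                 ≡⟨ cong (_* p) og≡ ⟩
          a * p ^ j * p             ≡⟨ sh a (p ^ j) p ⟩
          a * p ^ suc j             ≤⟨ *-monoˡ-≤ (p ^ suc j) (∣⇒≤ {{≢-nonZero λ eq → <-irrefl (sym (trans m≡ (cong (_* p ^ suc j) eq))) (ord-pos z)}} a∣c) ⟩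
          c * p ^ suc j             ≡⟨ m≡ ⟨
          m                         ∎
          where
          open ≤-Reasoning
          sh : ∀ a x p → a * x * p ≡ a * (p * x)
          sh = solve-∀
          a∣c : a ∣ c
          a∣c = power-cancel cop (suc j) c (subst (a ∣_) m≡ (power-cancel cop (suc j) m a∣mp))

    abstract
      larger-order : ∀ g h → ¬ ord h ∣ ord g → ∃ λ z → ord g < ord z
      larger-order g h ¬∣ =
        let (p , j , a , e , 2≤p , cop , og≡ , oh≡) = order-split (ord g) (ord h) (ord-pos g) (ord-pos h) ¬∣ in
        LargerOrder.z g h p j a e 2≤p cop og≡ oh≡ , LargerOrder.larger g h p j a e 2≤p cop og≡ oh≡

    -- The element of `Fin k` only witnesses that the family is nonempty.
    maximal : ∀ {k} (F : Vec C k) → Fin k → ∃ λ i → ∀ j → ord (lookup F j) ≤ ord (lookup F i)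
    maximal {suc k} F _ = let (i , mx) = max-coordinate (Vec.map ord F) in
      i , λ j → subst₂ _≤_ (VecP.lookup-map j ord F) (VecP.lookup-map i ord F) (mx j)

    dominating : ∀ g₀ → (∀ g → ord g ≤ ord g₀) → ∀ g → ord g ∣ ord g₀
    dominating g₀ bounded g = go (ord g ∣? ord g₀)
      where
      go : Dec (ord g ∣ ord g₀) → ord g ∣ ord g₀
      go (yes p) = p
      go (no ¬p) = let (z , lt) = larger-order g₀ g ¬p in ⊥-elim (<⇒≱ lt (bounded z))

    exponent-from : ∀ g₀ → (∀ g → ord g ∣ ord g₀) → ∃ λ n → 0 < n × (∀ g → n ⊗ g ≈ ε) × ∃ λ g → Indep n (g ∷ [])
    exponent-from g₀ h = ord g₀ , ord-pos g₀ , (λ g → multiple-ε {g} (h g) (ord-⊗ g)) , g₀ ,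
      (λ { zero → ord-⊗ g₀ }) , λ { (k ∷ []) z zero → ord-∣ g₀ k (≈-trans (≈-sym (identityʳ (k ⊗ g₀))) z) }

  -- An element of maximal order has an order divisible by all others, since `larger-order` would
  -- otherwise produce a larger one. Hence the exponent is attained.
  exponent : ∃ λ n → 0 < n × (∀ g → n ⊗ g ≈ ε) × ∃ λ g → Indep n (g ∷ [])
  exponent = let (i , mx) = maximal E (idx ε) in
    exponent-from (lookup E i) (dominating (lookup E i) λ g →
      ≤-trans (∣⇒≤ {{>-nonZero (ord-pos (lookup E (idx g)))}} (ord-resp (proj₂ (index g)))) (mx (idx g)))

-- Decidable equality and enumeration from sets of lengths

module _ {c ℓ : Level} (𝔾 : AbelianGroup c ℓ) where
  open Families 𝔾
  open ZeroSumFree 𝔾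

  private
    eval-++ : ∀ {t s} (G : Vec C t) (H : Vec C s) (x : Vec ℕ t) (y : Vec ℕ s) → eval (G Vec.++ H) (x Vec.++ y) ≈ eval G x ∙ eval H y
    eval-++ []      H []      y = ≈-sym (identityˡ _)
    eval-++ (g ∷ G) H (k ∷ x) y = ≈-trans (∙-congˡ (eval-++ G H x y)) (≈-sym (assoc _ _ _))

    eval-replicate : ∀ k g (x : Vec ℕ k) → eval (replicate k g) x ≈ size x ⊗ g
    eval-replicate zero    g []      = ≈-refl
    eval-replicate (suc k) g (a ∷ x) = ≈-trans (∙-congˡ (eval-replicate k g x)) (≈-sym (×-homo-+ g a (size x)))

    copies : ∀ k → Vec C t → Vec C (t * k)
    copies k []      = []
    copies k (g ∷ G) = replicate k g Vec.++ copies k G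

    block-sums : ∀ t k (x : Vec ℕ (t * k)) → (∀ i → lookup x i ≤ 1) →
      ∃ λ y → (∀ i → lookup y i ≤ k) × (∀ G → eval (copies {t} k G) x ≈ eval G y) × (y ≡ 𝟘 → x ≡ 𝟘)
    block-sums zero    k []  le = [] , (λ ()) , (λ { [] → ≈-refl }) , λ _ → refl
    block-sums (suc t) k x   le with Vec.splitAt k x
    ... | u , v , refl with block-sums t k v (λ i → subst (_≤ 1) (VecP.lookup-++ʳ u v i) (le (k Fin.↑ʳ i)))
    ... | y , y≤ , ev , y0 = size u ∷ y ,
      (λ { zero → ≤-trans (size-bound u 1 λ i → subst (_≤ 1) (VecP.lookup-++ˡ u v i) (le (i Fin.↑ˡ (t * k)))) (≤-reflexive (*-identityʳ k))
         ; (suc i) → y≤ i }) ,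
      (λ { (g ∷ G) → ≈-trans (eval-++ (replicate k g) (copies k G) u v) (∙-cong (eval-replicate k g u) (ev G)) }) ,
      λ e → trans (cong₂ Vec._++_ (size-0 u (VecP.∷-injectiveˡ e)) (y0 (VecP.∷-injectiveʳ e))) (𝟘-++ k)
      where
      𝟘-++ : ∀ k {s} → 𝟘 {k} Vec.++ 𝟘 {s} ≡ 𝟘
      𝟘-++ zero    = refl
      𝟘-++ (suc k) = cong (0 ∷_) (𝟘-++ k)

  -- Each member is repeated `P - 1` times; in a zero-sum subsequence the multiplicities would be
  -- divisible by `P`, hence zero.
  indep⇒zsf : ∀ {P s} → 0 < P → (F : Vec C s) → Indep P F → HasZsf (s * pred P)
  indep⇒zsf {P} {s} 0<P F (_ , ind) = copies (pred P) F , λ x le zx →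
    let (y , y≤ , ev , y0) = block-sums s (pred P) x le in
    y0 (vec-ext {x = y} {𝟘} λ i → trans (vanish (lookup y i) (y≤ i) (ind y (≈-trans (≈-sym (ev F)) zx) i)) (sym (lookup-𝟘 i)))
    where
    vanish : ∀ k → k ≤ pred P → P ∣ k → k ≡ 0
    vanish zero    _ _ = refl
    vanish (suc k) le d = ⊥-elim (<⇒≱ (subst (suc k <_) (suc-pred P {{>-nonZero 0<P}}) (s≤s le)) (∣⇒≤ d))

  zsf-shorten : ∀ {k l} → l ≤ k → HasZsf k → HasZsf l
  zsf-shorten l≤k (S , zsf) = shorten Zsf (λ {_} {g} {S} → zsf-tail {g = g} {S}) l≤k S zsf

  -- g is zero exactly if g (-g) is not an atom
  pair-lengths⇒dec : ∀ g k → Fact (g ∷ g ⁻¹ ∷ []) 𝟙 k → Dec (g ≈ ε)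
  pair-lengths⇒dec g k (w ∷ [] , at ∷ [] , _ , e) = no λ g≈ε → no-unit (atom-min (g ∷ g ⁻¹ ∷ []) {𝟙} {1 ∷ 0 ∷ []}
      (subst (Atom (g ∷ g ⁻¹ ∷ [])) (trans (sym (⊕-identityʳ w)) e) at)
      (≈-trans (∙-cong (×-homo-1 g) (identityˡ ε)) (≈-trans (identityʳ g) g≈ε)) (λ ()) (0 ∷ 1 ∷ [] , refl))
    where
    no-unit : _≡_ {A = Vec ℕ 2} (1 ∷ 0 ∷ []) (1 ∷ 1 ∷ []) → ⊥
    no-unit ()
  pair-lengths⇒dec g k ((0 ∷ 0 ∷ []) ∷ _ ∷ _ , (_ , ≢𝟘 , _) ∷ _ , _ , e) = ⊥-elim (≢𝟘 refl)
  pair-lengths⇒dec g k ((1 ∷ 0 ∷ []) ∷ _ ∷ _ , (z , _) ∷ _ , _ , e) = yes (≈-trans (≈-sym (identityʳ g))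
    (≈-trans (∙-cong (≈-sym (×-homo-1 g)) (≈-sym (identityˡ ε))) z))
  pair-lengths⇒dec g k ((0 ∷ 1 ∷ []) ∷ _ ∷ _ , (z , _) ∷ _ , _ , e) = yes (≈-trans (≈-sym (identityʳ g))
    (≈-trans (∙-congˡ (≈-sym (≈-trans (≈-sym (≈-trans (identityˡ _) (≈-trans (identityʳ _) (×-homo-1 (g ⁻¹))))) z))) (inverseʳ g)))
  pair-lengths⇒dec g k ((1 ∷ 1 ∷ []) ∷ v ∷ vs , _ ∷ (_ , ≢𝟘 , _) ∷ _ , _ , e) =
    ⊥-elim (≢𝟘 (⊕-𝟘 v (sumV vs) (⊕-cancelˡ (1 ∷ 1 ∷ []) e)))
  pair-lengths⇒dec g k ((suc (suc a) ∷ b ∷ []) ∷ ws , _ , _ , e) with sumV ws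
  pair-lengths⇒dec g k ((suc (suc a) ∷ b ∷ []) ∷ ws , _ , _ , ()) | _ ∷ _ ∷ []
  pair-lengths⇒dec g k ((0 ∷ suc (suc b) ∷ []) ∷ ws , _ , _ , e) with sumV ws
  pair-lengths⇒dec g k ((0 ∷ suc (suc b) ∷ []) ∷ ws , _ , _ , ()) | _ ∷ _ ∷ []
  pair-lengths⇒dec g k ((1 ∷ suc (suc b) ∷ []) ∷ ws , _ , _ , e) with sumV ws
  pair-lengths⇒dec g k ((1 ∷ suc (suc b) ∷ []) ∷ ws , _ , _ , ()) | _ ∷ _ ∷ []

  -- With `g = x - y`, the image of `g (-g)` in `𝕂` can be factorized by search. Its length is also
  -- a length of `g (-g)`, and this tells whether `g` vanishes.
  decidable-equality : ∀ {c₂ ℓ₂} (𝕂 : AbelianGroup c₂ ℓ₂) → (∀ x y → Dec (AbelianGroup._≈_ 𝕂 x y)) →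
    AbelianGroup.rawMonoid 𝔾 ⊆ℒ AbelianGroup.rawMonoid 𝕂 → ∀ x y → Dec (x ≈ y)
  decidable-equality 𝕂 _≟ᵏ_ ⊆ℒ x y = map′
      (λ e → Algebra.Properties.AbelianGroup.x∙y⁻¹≈ε⇒x≈y 𝔾 x y e)
      (λ e → ≈-trans (∙-congʳ e) (inverseʳ y))
      (pair-lengths⇒dec g (proj₁ fac) (SG.∈L⇒fact (g ∷ g ⁻¹ ∷ []) SG.↭-refl
        (Equivalence.from (proj₂ (proj₂ image) (proj₁ fac)) (SK.fact⇒∈L B′ p (proj₂ fac)))))
    where
    module SG = Sequences 𝔾
    module SK = Sequences 𝕂
    g : C
    g = x ∙ y ⁻¹
    image = ⊆ℒ (g ∷ g ⁻¹ ∷ []) (≈-trans (∙-congˡ (identityʳ _)) (inverseʳ g))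
    B′ = Vec.fromList (proj₁ image)
    p : SK.seq B′ 𝟙 SK.↭ proj₁ image
    p = SK.↭-reflexive (SK.seq-fromList (proj₁ image))
    fac = Families.Decidable.factorize 𝕂 _≟ᵏ_ B′ 𝟙 (SK.σ⇒zs B′ p (proj₁ (proj₂ image)))

  fromList-index : ∀ {x : C} {xs} → x ∈ xs → ∃ λ i → x ≡ lookup (Vec.fromList xs) i
  fromList-index (here e)  = zero , e
  fromList-index (there p) = let (i , e) = fromList-index p in suc i , e

  -- a zero-sum free sequence of maximal length has all nonzero inverses among its subsums
  enumerate : (∀ x y → Dec (x ≈ y)) → ∀ δ → HasZsf δ → ¬ HasZsf (suc δ) →
    ∃ λ N → ∃ λ (E : Vec C N) → ∀ g → ∃ λ i → g ≈ lookup E i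
  enumerate _≟ᵍ_ δ (S , zsf) none = length subsums , Vec.fromList subsums , index
    where
    open Decidable _≟ᵍ_
    subsums : List C
    subsums = List.map (λ x → eval S x ⁻¹) (below 𝟙)
    listed : ∀ g a x → (∀ i → lookup (a ∷ x) i ≤ lookup (𝟙 {suc δ}) i) → Zs (g ∷ S) (a ∷ x) → a ∷ x ≢ 𝟘 →
      ∃ λ i → g ≈ lookup (Vec.fromList subsums) i
    listed g zero x le zx ≢𝟘 = ⊥-elim (≢𝟘 (cong (0 ∷_) (zsf x (λ i → subst (lookup x i ≤_) (lookup-𝟙 i) (le (suc i))) (≈-trans (≈-sym (identityˡ _)) zx))))
    listed g (suc (suc _)) x le zx ≢𝟘 = ⊥-elim (<⇒≱ (s≤s (s≤s z≤n)) (le zero))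
    listed g (suc zero) x le zx ≢𝟘 = let (i , e) = fromList-index (MemP.∈-map⁺ (λ x → eval S x ⁻¹) (below-complete x 𝟙 (le ∘ suc))) in
      i , ≈-trans (≈-trans (≈-sym (×-homo-1 g)) (Algebra.Properties.AbelianGroup.inverseˡ-unique 𝔾 (1 ⊗ g) (eval S x) zx)) (reflexive e)
    index : ∀ g → ∃ λ i → g ≈ lookup (Vec.fromList subsums) i
    index g with search-below (λ x → Zs? (g ∷ S) x ×-dec ¬? (x ≟ᵛ 𝟘)) (𝟙 {suc δ})
    ... | inj₁ (a ∷ x , le , zx , ≢𝟘) = listed g a x le zx ≢𝟘
    ... | inj₂ no-relation = ⊥-elim (none (g ∷ S , free))
      where
      free : Zsf (g ∷ S)
      free x le zx with x ≟ᵛ 𝟘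
      ... | yes p = p
      ... | no ¬p = ⊥-elim (no-relation x (λ i → subst (lookup x i ≤_) (sym (lookup-𝟙 i)) (le i)) (zx , ¬p))

-- Passing to powers B ^ k for large k makes the bounded error of the transfer negligible.
module Limit {c₁ ℓ₁ c₂ ℓ₂ : Level} (ℍ : AbelianGroup c₁ ℓ₁) (𝕂 : AbelianGroup c₂ ℓ₂)
  (_≟ᵏ_ : ∀ x y → Dec (AbelianGroup._≈_ 𝕂 x y))
  (n : ℕ) (0<n : 0 < n)
  (exponent : ∀ g → AbelianGroup._≈_ 𝕂 (Families._⊗_ 𝕂 n g) (AbelianGroup.ε 𝕂))
  (N : ℕ) (E : Vec (AbelianGroup.Carrier 𝕂) N) (index : ∀ g → ∃ λ i → AbelianGroup._≈_ 𝕂 g (lookup E i))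
  (ℒ⊆ : AbelianGroup.rawMonoid ℍ ⊆ℒ AbelianGroup.rawMonoid 𝕂) where
  open Families 𝕂 using (HasLengths; IndepExists)

  transferred : ∀ d → n ≤ suc (2 * d) → (∀ P → 2 ≤ P → ¬ IndepExists P (suc d)) →
    ∀ p q → Families.HasLengths ℍ d p q → p < q →
    ¬ ¬ ∃ λ k → 1 ≤ k × suc k + d ≡ n × q * suc k ≤ p * n × IndepExists n k
  transferred d n≤ no-indep p q lengths p<q k₀ =
    Transfer.transfer ℍ 𝕂 _≟ᵏ_ n 0<n exponent N E index ℒ⊆ d p q lengths λ (c , h) → k₀ (go c h)
    where
    open ≤-Reasoning
    go : ∀ c → (∀ k → ∃₂ λ p′ q′ → HasLengths d p′ q′ × p′ ≤ k * p + c × k * q ≤ q′ + c) →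
      ∃ λ k → 1 ≤ k × suc k + d ≡ n × q * suc k ≤ p * n × IndepExists n k
    go c h = let
        (p′ , q′ , lengths′ , p′≤ , ≤q′) = h K
        (k , 1≤k , k+d , elastic , ind) = Structure.large-distance 𝕂 _≟ᵏ_ n 0<n exponent d n≤ no-indep lengths′ (p′<q′ p′ q′ p′≤ ≤q′)
      in k , 1≤k , k+d , ratio p′ q′ k p′≤ ≤q′ elastic (≤-trans (m≤m+n (suc k) d) (≤-reflexive k+d)) , ind
      where
      -- The errors `c` in both lengths cost at most `2 c n` after multiplication by weights up to
      -- `n`. A larger `K` outweighs them, and it also keeps `p′` below `q′`.
      K : ℕ
      K = suc (2 * c * n)
      p′<q′ : ∀ p′ q′ → p′ ≤ K * p + c → K * q ≤ q′ + c → p′ < q′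
      p′<q′ p′ q′ p′≤ ≤q′ = +-cancelʳ-< (2 * c) p′ q′ (begin-strict
        p′ + 2 * c                   <⟨ +-monoʳ-< p′ (s≤s (m≤m*n (2 * c) n {{>-nonZero 0<n}})) ⟩
        p′ + K                       ≤⟨ +-monoˡ-≤ K p′≤ ⟩
        K * p + c + K                ≡⟨ sh K p c ⟩
        K * suc p + c                ≤⟨ +-monoˡ-≤ c (*-monoʳ-≤ K p<q) ⟩
        K * q + c                    ≤⟨ +-monoˡ-≤ c ≤q′ ⟩
        q′ + c + c                   ≡⟨ sh′ q′ c ⟩
        q′ + 2 * c                   ∎)
        where
        sh : ∀ K p c → K * p + c + K ≡ K * suc p + c
        sh = solve-∀
        sh′ : ∀ q c → q + c + c ≡ q + 2 * c
        sh′ = solve-∀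
      ratio : ∀ p′ q′ k → p′ ≤ K * p + c → K * q ≤ q′ + c → q′ * suc k ≤ p′ * n → suc k ≤ n → q * suc k ≤ p * n
      ratio p′ q′ k p′≤ ≤q′ elastic k≤n = ≮⇒≥ λ lt → <-irrefl refl (begin-strict
        2 * c * n + K * (p * n)                <⟨ ≤-refl ⟩
        K + K * (p * n)                        ≡⟨ *-suc K (p * n) ⟨
        K * suc (p * n)                        ≤⟨ *-monoʳ-≤ K lt ⟩
        K * (q * suc k)                        ≡⟨ *-assoc K q (suc k) ⟨
        K * q * suc k                          ≤⟨ *-monoˡ-≤ (suc k) ≤q′ ⟩
        (q′ + c) * suc k                       ≡⟨ *-distribʳ-+ (suc k) q′ c ⟩
        q′ * suc k + c * suc k                 ≤⟨ +-mono-≤ elastic (*-monoʳ-≤ c k≤n) ⟩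
        p′ * n + c * n                         ≤⟨ +-monoˡ-≤ (c * n) (*-monoˡ-≤ n p′≤) ⟩
        (K * p + c) * n + c * n                ≡⟨ sh K p c n ⟩
        2 * c * n + K * (p * n)                ∎)
        where
        sh : ∀ K p c n → (K * p + c) * n + c * n ≡ 2 * c * n + K * (p * n)
        sh = solve-∀

-- From a homocyclic subgroup to an isomorphism

module Isomorphism {c ℓ : Level} (n r : ℕ) .{{_ : NonZero n}} (𝔾 : AbelianGroup c ℓ)
  (_≟ᵍ_ : ∀ x y → Dec (AbelianGroup._≈_ 𝔾 x y))
  (F : Vec (AbelianGroup.Carrier 𝔾) r) (indep : Families.Indep 𝔾 n F)
  (δ : ℕ) (long : ZeroSumFree.HasZsf (Homocyclic.group n r) δ) (short : ¬ ZeroSumFree.HasZsf 𝔾 (suc δ)) where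
  open Families 𝔾
  open ZeroSumFree 𝔾
  module ℂ = Families (Homocyclic.group n r)
  open Homocyclic n r using (0<n; mod-cong; cong-fin)

  private
    residues : ∀ {t} (u v : Vec ℕ t) → (∀ i → Cong n (lookup u i) (lookup v i)) → ∃₂ λ a b → u ⊕ n · a ≡ v ⊕ n · b
    residues []      []      h = [] , [] , refl
    residues (k ∷ u) (l ∷ v) h = let (a , b , e) = h zero ; (x , y , e′) = residues u v (h ∘ suc) in
      a ∷ x , b ∷ y , cong₂ _∷_ (trans (cong (k +_) (*-comm n a)) (trans e (cong (l +_) (*-comm b n)))) e′

    eval-n· : ∀ u a → eval F (u ⊕ n · a) ≈ eval F u
    eval-n· u a = ≈-trans (eval-⊕ F u (n · a)) (≈-trans (∙-congˡ (≈-trans (eval-· F n a) (⊗-eval n F (proj₁ indep) a))) (identityʳ _))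

    eval-resp-cong : ∀ u v → (∀ i → Cong n (lookup u i) (lookup v i)) → eval F u ≈ eval F v
    eval-resp-cong u v h = let (a , b , e) = residues u v h in
      ≈-trans (≈-sym (eval-n· u a)) (≈-trans (reflexive (cong (eval F) e)) (eval-n· v b))

    coords : (Fin r → Fin n) → Vec ℕ r
    coords x = Vec.tabulate (toℕ ∘ x)

    lookup-coords : ∀ x i → lookup (coords x) i ≡ toℕ (x i)
    lookup-coords x = VecP.lookup∘tabulate (toℕ ∘ x)

    ψ : (Fin r → Fin n) → C
    ψ x = eval F (coords x)

    ψ-cong : ∀ {x y} → x ℂ.≈ y → ψ x ≈ ψ y
    ψ-cong {x} {y} e = eval-resp-cong (coords x) (coords y) λ i → cong-≡
      (trans (lookup-coords x i) (trans (cong toℕ (e i)) (sym (lookup-coords y i))))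

    ψ-injective : ∀ {x y} → ψ x ≈ ψ y → x ℂ.≈ y
    ψ-injective {x} {y} e i = cong-fin (cong-trans (cong-≡ (sym (lookup-coords x i)))
      (cong-trans (indep-reflects {F = F} indep (coords x) (coords y) e i) (cong-≡ (lookup-coords y i))))

    ψ-∙ : ∀ x y → ψ (x ℂ.∙ y) ≈ ψ x ∙ ψ y
    ψ-∙ x y = ≈-trans (eval-resp-cong (coords (x ℂ.∙ y)) (coords x ⊕ coords y) λ i →
        cong-trans (cong-≡ (lookup-coords (x ℂ.∙ y) i)) (cong-trans (mod-cong _)
          (cong-≡ (sym (trans (lookup-⊕ (coords x) (coords y) i) (cong₂ _+_ (lookup-coords x i) (lookup-coords y i)))))))
      (eval-⊕ F (coords x) (coords y))

    ψ-ε : ψ ℂ.ε ≈ ε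
    ψ-ε = ≈-trans (eval-resp-cong (coords ℂ.ε) 𝟘 λ i → cong-trans (cong-≡ (lookup-coords ℂ.ε i))
      (cong-trans (mod-cong 0) (cong-≡ (sym (lookup-𝟘 i))))) (eval-𝟘 F)

    ψ-⊗ : ∀ k x → ψ (k ℂ.⊗ x) ≈ k ⊗ ψ x
    ψ-⊗ zero    x = ψ-ε
    ψ-⊗ (suc k) x = ≈-trans (ψ-∙ x (k ℂ.⊗ x)) (∙-congˡ (ψ-⊗ k x))

    ψ-eval : ∀ {t} (S : Vec (Fin r → Fin n) t) x → ψ (ℂ.eval S x) ≈ eval (Vec.map ψ S) x
    ψ-eval []      []      = ψ-ε
    ψ-eval (s ∷ S) (k ∷ x) = ≈-trans (ψ-∙ (k ℂ.⊗ s) (ℂ.eval S x)) (∙-cong (ψ-⊗ k s) (ψ-eval S x))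

    -- An element outside the image could be appended to a longest zero-sum free sequence of the image.
    ψ-surjective : ∀ y → ∃ λ x → y ≈ ψ x
    ψ-surjective y with FinP.any? (λ κ → y ≟ᵍ ψ (Fin.finToFun κ))
    ... | yes (κ , e) = Fin.finToFun κ , e
    ... | no none     = ⊥-elim (short (y ∷ Vec.map ψ S , zsf))
      where
      S = proj₁ long
      outside : ∀ x → ¬ y ≈ ψ x
      outside x e = none (Fin.funToFin x , ≈-trans e (ψ-cong λ i → sym (FinP.finToFun-funToFin x i)))
      zsf : Zsf (y ∷ Vec.map ψ S)
      zsf (zero ∷ x) le z = cong (0 ∷_) (proj₂ long x (le ∘ suc) (ψ-injective (≈-trans (ψ-eval S x)
        (≈-trans (≈-sym (identityˡ _)) (≈-trans z (≈-sym ψ-ε))))))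
      zsf (suc zero ∷ x) le z = ⊥-elim (outside (ℂ.eval S x ℂ.⁻¹) (begin
          y                                                  ≈⟨ ×-homo-1 y ⟨
          1 ⊗ y                                              ≈⟨ Algebra.Properties.AbelianGroup.inverseˡ-unique 𝔾 (1 ⊗ y) (eval (Vec.map ψ S) x) z ⟩
          eval (Vec.map ψ S) x ⁻¹                            ≈⟨ ⁻¹-cong (ψ-eval S x) ⟨
          ψ (ℂ.eval S x) ⁻¹                                  ≈⟨ Algebra.Properties.AbelianGroup.inverseˡ-unique 𝔾 _ _
                                                                 (≈-trans (≈-sym (ψ-∙ (ℂ.eval S x ℂ.⁻¹) (ℂ.eval S x))) (≈-trans (ψ-cong (ℂ.inverseˡ (ℂ.eval S x))) ψ-ε)) ⟨
          ψ (ℂ.eval S x ℂ.⁻¹)                                ∎))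
        where open ≈R
      zsf (suc (suc _) ∷ x) le z = ⊥-elim (<⇒≱ (s≤s (s≤s z≤n)) (le zero))

  isomorphism : ∃ λ f → MonoidMorphisms.IsMonoidIsomorphism (AbelianGroup.rawMonoid 𝔾) (Cⁿʳ n r) f
  isomorphism = f , record
    { isMonoidMonomorphism = record
      { isMonoidHomomorphism = record
        { isMagmaHomomorphism = record
          { isRelHomomorphism = record { cong = λ {x} {y} e → ψ-injective (≈-trans (≈-sym (fψ x)) (≈-trans e (fψ y))) }
          ; homo = λ x y → ψ-injective (≈-trans (≈-sym (fψ (x ∙ y))) (≈-trans (∙-cong (fψ x) (fψ y)) (≈-sym (ψ-∙ (f x) (f y)))))
          }
        ; ε-homo = ψ-injective (≈-trans (≈-sym (fψ ε)) (≈-sym ψ-ε))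
        }
      ; injective = λ {x} {y} e → ≈-trans (fψ x) (≈-trans (ψ-cong e) (≈-sym (fψ y)))
      }
    ; surjective = λ x → ψ x , λ {z} e → ψ-injective (≈-trans (≈-sym (fψ z)) e)
    }
    where
    f : C → Fin r → Fin n
    f y = proj₁ (ψ-surjective y)
    fψ : ∀ y → y ≈ ψ (f y)
    fψ y = proj₂ (ψ-surjective y)

-- The six nonzero vectors of 𝔽₂³ other than (1,1,1), each taken twice, have factorizations of lengths 3, 5 and 6.
module SixPoints {c ℓ : Level} (𝔾 : AbelianGroup c ℓ)
  (F : Vec (AbelianGroup.Carrier 𝔾) 3) (indep : Families.Indep 𝔾 2 F) where
  open Families 𝔾

  private
    points : Vec (Vec ℕ 3) 6
    points = (1 ∷ 0 ∷ 0 ∷ []) ∷ (0 ∷ 1 ∷ 0 ∷ []) ∷ (0 ∷ 0 ∷ 1 ∷ []) ∷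
             (1 ∷ 1 ∷ 0 ∷ []) ∷ (0 ∷ 1 ∷ 1 ∷ []) ∷ (1 ∷ 0 ∷ 1 ∷ []) ∷ []

    combine : Vec (Vec ℕ 3) t → Vec ℕ t → Vec ℕ 3
    combine []      []      = 𝟘
    combine (m ∷ M) (k ∷ x) = k · m ⊕ combine M x

    eval-combine : ∀ {t} (M : Vec (Vec ℕ 3) t) x → eval (Vec.map (eval F) M) x ≈ eval F (combine M x)
    eval-combine []      []      = ≈-sym (eval-𝟘 F)
    eval-combine (m ∷ M) (k ∷ x) = ≈-sym (≈-trans (eval-⊕ F (k · m) (combine M x))
      (∙-cong (eval-· F k m) (≈-sym (eval-combine M x))))

    Even : Vec ℕ 6 → Set
    Even x = ∀ i → 2 ∣ lookup (combine points x) i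

    even? : ∀ x → Dec (Even x)
    even? x = FinP.all? (λ i → 2 ∣? lookup (combine points x) i)

  six : Vec C 6
  six = Vec.map (eval F) points

  private
    zs⇒even : ∀ {x} → Zs six x → Even x
    zs⇒even {x} z = proj₂ indep (combine points x) (≈-trans (≈-sym (eval-combine points x)) z)

    even⇒zs : ∀ {x} → Even x → Zs six x
    even⇒zs {x} h = let (q , e) = ∣-vector 2 (combine points x) h in
      ≈-trans (eval-combine points x) (≈-trans (reflexive (cong (eval F) e)) (≈-trans (eval-· F 2 q) (⊗-eval 2 F (proj₁ indep) q)))

    Splits : Vec ℕ 6 → Vec ℕ 6 → Set
    Splits w u = Even u × u ≢ 𝟘 × u ≢ w

    splits? : ∀ w u → Dec (Splits w u)
    splits? w u = even? u ×-dec ¬? (u ≟ᵛ 𝟘) ×-dec ¬? (u ≟ᵛ w)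

    -- The implicit arguments are settled by evaluation: relations are exactly the vectors with even
    -- coordinates sums, and all vectors below `w` are inspected.
    atom : ∀ w {_ : True (even? w)} {_ : True (¬? (w ≟ᵛ 𝟘))} {_ : True (All.all? (λ u → ¬? (splits? w u)) (below w))} → Atom six w
    atom w {ev} {w≢𝟘} {none} = even⇒zs {w} (toWitness ev) , toWitness w≢𝟘 , irr
      where
      irr : ∀ u v → Zs six u → Zs six v → w ≡ u ⊕ v → u ≡ 𝟘 ⊎ v ≡ 𝟘
      irr u v zu zv e with u ≟ᵛ 𝟘 | u ≟ᵛ w
      ... | yes p | _        = inj₁ p
      ... | no p  | yes refl = inj₂ (⊕-cancelˡ u (trans (sym e) (sym (⊕-identityʳ u))))
      ... | no p  | no q     = ⊥-elim (All.lookup (toWitness none) (below-complete u w (⊑⇒≤ {x = u} {w} (v , e))) (zs⇒even {u} zu , p , q))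

  lengths-3 : Fact six (2 · 𝟙) 3
  lengths-3 = _ , atom (1 ∷ 1 ∷ 0 ∷ 0 ∷ 1 ∷ 1 ∷ []) ∷ atom (1 ∷ 0 ∷ 1 ∷ 1 ∷ 1 ∷ 0 ∷ []) ∷ atom (0 ∷ 1 ∷ 1 ∷ 1 ∷ 0 ∷ 1 ∷ []) ∷ [] , refl , refl

  lengths-5 : Fact six (2 · 𝟙) 5
  lengths-5 = _ , atom (1 ∷ 1 ∷ 0 ∷ 1 ∷ 0 ∷ 0 ∷ []) ∷ atom (1 ∷ 1 ∷ 0 ∷ 1 ∷ 0 ∷ 0 ∷ []) ∷ atom (0 ∷ 0 ∷ 2 ∷ 0 ∷ 0 ∷ 0 ∷ []) ∷
    atom (0 ∷ 0 ∷ 0 ∷ 0 ∷ 2 ∷ 0 ∷ []) ∷ atom (0 ∷ 0 ∷ 0 ∷ 0 ∷ 0 ∷ 2 ∷ []) ∷ [] , refl , refl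

  lengths-6 : Fact six (2 · 𝟙) 6
  lengths-6 = _ , atom (2 ∷ 0 ∷ 0 ∷ 0 ∷ 0 ∷ 0 ∷ []) ∷ atom (0 ∷ 2 ∷ 0 ∷ 0 ∷ 0 ∷ 0 ∷ []) ∷ atom (0 ∷ 0 ∷ 2 ∷ 0 ∷ 0 ∷ 0 ∷ []) ∷
    atom (0 ∷ 0 ∷ 0 ∷ 2 ∷ 0 ∷ 0 ∷ []) ∷ atom (0 ∷ 0 ∷ 0 ∷ 0 ∷ 2 ∷ 0 ∷ []) ∷ atom (0 ∷ 0 ∷ 0 ∷ 0 ∷ 0 ∷ 2 ∷ []) ∷ [] , refl , refl

-- Lengths over the cyclic group of order four

module CyclicFour where
  module ℂ = Homocyclic 4 1
  open Families ℂ.group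

  classes : Vec C 4
  classes = Vec.tabulate (λ k _ → k)

  index : ∀ g → ∃ λ i → g ≈ lookup classes i
  index g = g zero , λ { zero → cong (λ f → f zero) (sym (VecP.lookup∘tabulate (λ k _ → k) (g zero))) }

  private
    zs⇒∣ : ∀ {x} → Zs classes x → 4 ∣ ℂ.dot classes x zero
    zs⇒∣ {x} z = cong-0⇒∣ (cong-trans (cong-sym (ℂ.eval-cong classes x zero)) (cong-trans (cong-≡ (cong toℕ (z zero))) (ℂ.mod-cong 0)))

    -- The seven atoms, as multisets of residues modulo 4: 0; 1, 3; 2, 2; 1, 1, 1, 1; 3, 3, 3, 3; 1,
    -- 1, 2; 2, 3, 3.
    shapes : List (Vec ℕ 4)
    shapes = (1 ∷ 0 ∷ 0 ∷ 0 ∷ []) ∷ (0 ∷ 1 ∷ 0 ∷ 1 ∷ []) ∷ (0 ∷ 0 ∷ 2 ∷ 0 ∷ []) ∷ (0 ∷ 4 ∷ 0 ∷ 0 ∷ []) ∷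
             (0 ∷ 0 ∷ 0 ∷ 4 ∷ []) ∷ (0 ∷ 2 ∷ 1 ∷ 0 ∷ []) ∷ (0 ∷ 0 ∷ 1 ∷ 2 ∷ []) ∷ []

    shape-zs : All (Zs classes) shapes
    shape-zs = (λ { zero → refl }) ∷ (λ { zero → refl }) ∷ (λ { zero → refl }) ∷ (λ { zero → refl }) ∷
               (λ { zero → refl }) ∷ (λ { zero → refl }) ∷ (λ { zero → refl }) ∷ []

    shape-≢𝟘 : All (_≢ 𝟘) shapes
    shape-≢𝟘 = (λ ()) ∷ (λ ()) ∷ (λ ()) ∷ (λ ()) ∷ (λ ()) ∷ (λ ()) ∷ (λ ()) ∷ []

    -- A nonzero exponent vector contains one of the shapes, and then equals it if it is an atom, or
    -- it is one of nine small vectors whose sum is not divisible by 4.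
    shape : ∀ {a} → Atom classes a → a ∈ shapes
    shape {a} at = go a refl
      where
      hit : ∀ {u} → u ∈ shapes → u ⊑ a → a ∈ shapes
      hit u∈ u⊑ = subst (_∈ shapes) (atom-min classes at (All.lookup shape-zs u∈) (All.lookup shape-≢𝟘 u∈) u⊑) u∈
      miss : ∀ {x} → a ≡ x → {_ : True (¬? (4 ∣? ℂ.dot classes x zero))} → a ∈ shapes
      miss {x} refl {no-4} = ⊥-elim (toWitness no-4 (zs⇒∣ {x} (proj₁ at)))
      go : ∀ x → a ≡ x → a ∈ shapes
      go (suc p ∷ q ∷ r ∷ s ∷ []) e = hit (here refl) ((p ∷ q ∷ r ∷ s ∷ []) , e)
      go (0 ∷ suc q ∷ r ∷ suc s ∷ []) e = hit (there (here refl)) ((0 ∷ q ∷ r ∷ s ∷ []) , e)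
      go (0 ∷ q ∷ suc (suc r) ∷ s ∷ []) e = hit (there (there (here refl))) ((0 ∷ q ∷ r ∷ s ∷ []) , e)
      go (0 ∷ suc (suc q) ∷ 1 ∷ 0 ∷ []) e = hit (there (there (there (there (there (here refl)))))) ((0 ∷ q ∷ 0 ∷ 0 ∷ []) , e)
      go (0 ∷ 0 ∷ 1 ∷ suc (suc s) ∷ []) e = hit (there (there (there (there (there (there (here refl))))))) ((0 ∷ 0 ∷ 0 ∷ s ∷ []) , e)
      go (0 ∷ suc (suc (suc (suc q))) ∷ 0 ∷ 0 ∷ []) e = hit (there (there (there (here refl)))) ((0 ∷ q ∷ 0 ∷ 0 ∷ []) , e)
      go (0 ∷ 0 ∷ 0 ∷ suc (suc (suc (suc s))) ∷ []) e = hit (there (there (there (there (here refl))))) ((0 ∷ 0 ∷ 0 ∷ s ∷ []) , e)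
      go (0 ∷ 0 ∷ 0 ∷ 0 ∷ []) e = ⊥-elim (proj₁ (proj₂ at) e)
      go (0 ∷ 1 ∷ 0 ∷ 0 ∷ []) e = miss e
      go (0 ∷ 2 ∷ 0 ∷ 0 ∷ []) e = miss e
      go (0 ∷ 3 ∷ 0 ∷ 0 ∷ []) e = miss e
      go (0 ∷ 0 ∷ 0 ∷ 1 ∷ []) e = miss e
      go (0 ∷ 0 ∷ 0 ∷ 2 ∷ []) e = miss e
      go (0 ∷ 0 ∷ 0 ∷ 3 ∷ []) e = miss e
      go (0 ∷ 0 ∷ 1 ∷ 0 ∷ []) e = miss e
      go (0 ∷ 1 ∷ 1 ∷ 0 ∷ []) e = miss e
      go (0 ∷ 0 ∷ 1 ∷ 1 ∷ []) e = miss e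

    -- four times the cross number
    ω : Vec ℕ 4 → ℕ
    ω (p ∷ q ∷ r ∷ s ∷ []) = 4 * p + q + 2 * r + s

    ω-⊕ : ∀ x y → ω (x ⊕ y) ≡ ω x + ω y
    ω-⊕ (a ∷ b ∷ c ∷ d ∷ []) (a′ ∷ b′ ∷ c′ ∷ d′ ∷ []) = sh a b c d a′ b′ c′ d′
      where
      sh : ∀ a b c d a′ b′ c′ d′ → 4 * (a + a′) + (b + b′) + 2 * (c + c′) + (d + d′) ≡ 4 * a + b + 2 * c + d + (4 * a′ + b′ + 2 * c′ + d′)
      sh = solve-∀

    ω-bounds : All (λ w → 2 ≤ ω w × ω w ≤ 4 × (ω w ≤ 2 → w ≡ 0 ∷ 1 ∷ 0 ∷ 1 ∷ [])) shapes
    ω-bounds = (s≤s (s≤s z≤n) , ≤-refl , λ { (s≤s (s≤s ())) }) ∷ (≤-refl , s≤s (s≤s z≤n) , λ _ → refl) ∷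
      (s≤s (s≤s z≤n) , ≤-refl , λ { (s≤s (s≤s ())) }) ∷ (s≤s (s≤s z≤n) , ≤-refl , λ { (s≤s (s≤s ())) }) ∷
      (s≤s (s≤s z≤n) , ≤-refl , λ { (s≤s (s≤s ())) }) ∷ (s≤s (s≤s z≤n) , ≤-refl , λ { (s≤s (s≤s ())) }) ∷
      (s≤s (s≤s z≤n) , ≤-refl , λ { (s≤s (s≤s ())) }) ∷ []

    upper : ∀ {ws} → All (Atom classes) ws → ω (sumV ws) ≤ length ws * 4
    upper [] = z≤n
    upper {w ∷ ws} (p ∷ ps) = subst (_≤ 4 + length ws * 4) (sym (ω-⊕ w (sumV ws)))
      (+-mono-≤ (proj₁ (proj₂ (All.lookup ω-bounds (shape p)))) (upper ps))

    lower : ∀ {ws} → All (Atom classes) ws → length ws * 2 ≤ ω (sumV ws)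
    lower [] = z≤n
    lower {w ∷ ws} (p ∷ ps) = subst (2 + length ws * 2 ≤_) (sym (ω-⊕ w (sumV ws)))
      (+-mono-≤ (proj₁ (All.lookup ω-bounds (shape p))) (lower ps))

    extremal : ∀ {ws} → All (Atom classes) ws → ω (sumV ws) ≤ length ws * 2 → sumV ws ≡ length ws · (0 ∷ 1 ∷ 0 ∷ 1 ∷ [])
    extremal [] le = refl
    extremal {w ∷ ws} (p ∷ ps) le = trans (cong₂ _⊕_ (proj₂ (proj₂ (All.lookup ω-bounds (shape p))) ω≤2) (extremal ps rest≤))
        (sym (suc· (length ws) (0 ∷ 1 ∷ 0 ∷ 1 ∷ [])))
      where
      le′ : ω w + ω (sumV ws) ≤ 2 + length ws * 2
      le′ = subst (_≤ 2 + length ws * 2) (ω-⊕ w (sumV ws)) le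
      ω≤2 : ω w ≤ 2
      ω≤2 = +-cancelʳ-≤ (length ws * 2) (ω w) 2 (≤-trans (+-monoʳ-≤ (ω w) (lower ps)) le′)
      rest≤ : ω (sumV ws) ≤ length ws * 2
      rest≤ = +-cancelˡ-≤ 2 _ _ (≤-trans (+-monoˡ-≤ (ω (sumV ws)) (proj₁ (All.lookup ω-bounds (shape p)))) le′)

    -- number of factors (±1)⁴ and (1)(-1) when only the classes ±1 occur
    balanced : ∀ {ws} → All (Atom classes) ws → ∀ q s → sumV ws ≡ 0 ∷ q ∷ 0 ∷ s ∷ [] →
      ∃₂ λ α β → ∃ λ γ → length ws ≡ α + β + γ × q ≡ 4 * α + γ × s ≡ 4 * β + γ
    balanced [] q s refl = 0 , 0 , 0 , refl , refl , refl
    balanced {w ∷ ws} (p ∷ ps) q s e with sumV ws in eq | shape p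
    balanced (p ∷ ps) q s () | _ ∷ _ ∷ _ ∷ _ ∷ [] | here refl
    balanced (p ∷ ps) q s refl | 0 ∷ q′ ∷ 0 ∷ s′ ∷ [] | there (here refl) with balanced ps q′ s′ eq
    ... | α , β , γ , el , refl , refl = α , β , suc γ , trans (cong suc el) (sym (+-suc (α + β) γ)) , sym (+-suc (4 * α) γ) , sym (+-suc (4 * β) γ)
    balanced (p ∷ ps) q s () | 0 ∷ _ ∷ suc _ ∷ _ ∷ [] | there (here refl)
    balanced (p ∷ ps) q s () | suc _ ∷ _ ∷ _ ∷ _ ∷ [] | there (here refl)
    balanced (p ∷ ps) q s () | 0 ∷ _ ∷ suc _ ∷ _ ∷ [] | there (there (there (here refl)))
    balanced (p ∷ ps) q s () | suc _ ∷ _ ∷ _ ∷ _ ∷ [] | there (there (there (here refl)))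
    balanced (p ∷ ps) q s () | 0 ∷ _ ∷ suc _ ∷ _ ∷ [] | there (there (there (there (here refl))))
    balanced (p ∷ ps) q s () | suc _ ∷ _ ∷ _ ∷ _ ∷ [] | there (there (there (there (here refl))))
    balanced (p ∷ ps) q s () | _ ∷ _ ∷ _ ∷ _ ∷ [] | there (there (here refl))
    balanced (p ∷ ps) q s refl | 0 ∷ q′ ∷ 0 ∷ s′ ∷ [] | there (there (there (here refl))) with balanced ps q′ s′ eq
    ... | α , β , γ , el , refl , refl = suc α , β , γ , cong suc el , sh α γ , refl
      where
      sh : ∀ α γ → 4 + (4 * α + γ) ≡ 4 * suc α + γ
      sh = solve-∀
    balanced (p ∷ ps) q s refl | 0 ∷ q′ ∷ 0 ∷ s′ ∷ [] | there (there (there (there (here refl)))) with balanced ps q′ s′ eq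
    ... | α , β , γ , el , refl , refl = α , suc β , γ , trans (cong suc el) (cong (_+ γ) (sym (+-suc α β))) , refl , sh β γ
      where
      sh : ∀ α γ → 4 + (4 * α + γ) ≡ 4 * suc α + γ
      sh = solve-∀
    balanced (p ∷ ps) q s () | _ ∷ _ ∷ _ ∷ _ ∷ [] | there (there (there (there (there (here refl)))))
    balanced (p ∷ ps) q s () | _ ∷ _ ∷ _ ∷ _ ∷ [] | there (there (there (there (there (there (here refl))))))

    no-balance : ∀ α β γ → 5 ≡ α + β + γ → 6 ≡ 4 * α + γ → 6 ≡ 4 * β + γ → ⊥
    no-balance (suc (suc α)) β γ e e₁ e₂ = <⇒≱ (s≤s (s≤s (s≤s (s≤s (s≤s (s≤s (s≤s z≤n))))))) (≤-trans (≤-trans (*-monoʳ-≤ 4 (s≤s (s≤s (z≤n {α})))) (m≤m+n _ γ)) (≤-reflexive (sym e₁)))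
    no-balance zero       (suc (suc β)) γ e e₁ e₂ = <⇒≱ (s≤s (s≤s (s≤s (s≤s (s≤s (s≤s (s≤s z≤n))))))) (≤-trans (≤-trans (*-monoʳ-≤ 4 (s≤s (s≤s (z≤n {β})))) (m≤m+n _ γ)) (≤-reflexive (sym e₂)))
    no-balance (suc zero) (suc (suc β)) γ e e₁ e₂ = <⇒≱ (s≤s (s≤s (s≤s (s≤s (s≤s (s≤s (s≤s z≤n))))))) (≤-trans (≤-trans (*-monoʳ-≤ 4 (s≤s (s≤s (z≤n {β})))) (m≤m+n _ γ)) (≤-reflexive (sym e₂)))
    no-balance zero       zero       γ refl () e₂
    no-balance zero       (suc zero) γ refl () e₂
    no-balance (suc zero) zero       γ refl () e₂
    no-balance (suc zero) (suc zero) γ refl () e₂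

  -- Three atoms give `ω ≤ 12` and six give `ω ≥ 12`. Equality leaves only the sixth power of
  -- `1 (-1)`. Length 5 would then require `α = β`, `2 α + γ = 5` and `4 α + γ = 6`, so `2 α = 1`.
  lengths-3-5-6 : ∀ {y} → Fact classes y 3 → Fact classes y 5 → Fact classes y 6 → ⊥
  lengths-3-5-6 (us , aus , lu , refl) (vs , avs , lv , ev) (ws , aws , lw , ew) =
    let y≡ = trans (extremal aws (≤-trans (≤-trans (≤-reflexive (cong ω ew)) (upper aus)) (≤-reflexive (trans (cong (_* 4) lu) (cong (_* 2) (sym lw))))))
               (cong (_· (0 ∷ 1 ∷ 0 ∷ 1 ∷ [])) lw)
        (α , β , γ , e , e₁ , e₂) = balanced avs 6 6 (trans ev (trans (sym ew) y≡))
    in no-balance α β γ (trans (sym lv) e) e₁ e₂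

-- Groups of exponent at most four

even-or-odd : ∀ k → ∃ λ q → k ≡ 2 * q ⊎ k ≡ suc (2 * q)
even-or-odd zero = 0 , inj₁ refl
even-or-odd (suc k) with even-or-odd k
... | q , inj₁ e = q , inj₂ (cong suc e)
... | q , inj₂ e = suc q , inj₁ (trans (cong suc e) (sym (*-suc 2 q)))

halve : (x : Vec ℕ t) → ∃₂ λ z w → x ≡ z ⊕ 2 · w × (∀ i → lookup z i ≤ 1)
halve []      = [] , [] , refl , λ ()
halve (k ∷ x) with even-or-odd k | halve x
... | q , inj₁ e | z , w , e′ , le = 0 ∷ z , q ∷ w , cong₂ _∷_ e e′ , λ { zero → z≤n ; (suc i) → le i }
... | q , inj₂ e | z , w , e′ , le = 1 ∷ z , q ∷ w , cong₂ _∷_ e e′ , λ { zero → ≤-refl ; (suc i) → le i }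

dotℕ : Vec ℕ t → Vec ℕ t → ℕ
dotℕ m x = Vec.sum (zipWith _*_ m x)

dotℕ-⊕ : (m x y : Vec ℕ t) → dotℕ m (x ⊕ y) ≡ dotℕ m x + dotℕ m y
dotℕ-⊕ []      []      []      = refl
dotℕ-⊕ (a ∷ m) (k ∷ x) (l ∷ y) = trans (cong (a * (k + l) +_) (dotℕ-⊕ m x y)) (sh a k l (dotℕ m x) (dotℕ m y))
  where
  sh : ∀ a k l u v → a * (k + l) + (u + v) ≡ a * k + u + (a * l + v)
  sh = solve-∀

dotℕ-single : (m : Vec ℕ t) (i : Fin t) (k : ℕ) → dotℕ m (single i k) ≡ lookup m i * k
dotℕ-single (a ∷ m) zero    k = trans (cong (a * k +_) (zeros m)) (+-identityʳ _)
  where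
  zeros : ∀ {t} (m : Vec ℕ t) → dotℕ m 𝟘 ≡ 0
  zeros []      = refl
  zeros (a ∷ m) = cong₂ _+_ (*-zeroʳ a) (zeros m)
dotℕ-single (a ∷ m) (suc i) k = trans (cong (_+ dotℕ m (single i k)) (*-zeroʳ a)) (dotℕ-single m i k)

dotℕ-2· : (m x : Vec ℕ t) → dotℕ m (2 · x) ≡ 2 * dotℕ m x
dotℕ-2· []      []      = refl
dotℕ-2· (a ∷ m) (k ∷ x) = trans (cong (a * (2 * k) +_) (dotℕ-2· m x)) (sh a k (dotℕ m x))
  where
  sh : ∀ a k u → a * (2 * k) + 2 * u ≡ 2 * (a * k + u)
  sh = solve-∀

indicatorᵇ : Vec Bool t → Vec ℕ t
indicatorᵇ = Vec.map λ b → if b then 1 else 0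

indicatorᵇ-xor : (a b : Vec Bool t) → indicatorᵇ a ⊕ indicatorᵇ b ≡ indicatorᵇ (zipWith _xor_ a b) ⊕ 2 · indicatorᵇ (zipWith _∧_ a b)
indicatorᵇ-xor []      []      = refl
indicatorᵇ-xor (true  ∷ a) (true  ∷ b) = cong (2 ∷_) (indicatorᵇ-xor a b)
indicatorᵇ-xor (true  ∷ a) (false ∷ b) = cong (1 ∷_) (indicatorᵇ-xor a b)
indicatorᵇ-xor (false ∷ a) (true  ∷ b) = cong (1 ∷_) (indicatorᵇ-xor a b)
indicatorᵇ-xor (false ∷ a) (false ∷ b) = cong (0 ∷_) (indicatorᵇ-xor a b)

indicatorᵇ-∧ : (a b c : Vec Bool t) → indicatorᵇ (zipWith _∧_ a b) ⊕ indicatorᵇ (zipWith _∧_ a c) ≡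
  indicatorᵇ (zipWith _∧_ a (zipWith _xor_ b c)) ⊕ 2 · indicatorᵇ (zipWith _∧_ a (zipWith _∧_ b c))
indicatorᵇ-∧ []          []          []          = refl
indicatorᵇ-∧ (false ∷ a) (b     ∷ v) (c     ∷ w) = cong (0 ∷_) (indicatorᵇ-∧ a v w)
indicatorᵇ-∧ (true  ∷ a) (true  ∷ v) (true  ∷ w) = cong (2 ∷_) (indicatorᵇ-∧ a v w)
indicatorᵇ-∧ (true  ∷ a) (true  ∷ v) (false ∷ w) = cong (1 ∷_) (indicatorᵇ-∧ a v w)
indicatorᵇ-∧ (true  ∷ a) (false ∷ v) (true  ∷ w) = cong (1 ∷_) (indicatorᵇ-∧ a v w)
indicatorᵇ-∧ (true  ∷ a) (false ∷ v) (false ∷ w) = cong (0 ∷_) (indicatorᵇ-∧ a v w)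

indicatorᵇ-≤1 : (b : Vec Bool t) (i : Fin t) → lookup (indicatorᵇ b) i ≤ 1
indicatorᵇ-≤1 (true  ∷ b) zero    = ≤-refl
indicatorᵇ-≤1 (false ∷ b) zero    = z≤n
indicatorᵇ-≤1 (_     ∷ b) (suc i) = indicatorᵇ-≤1 b i

indicatorᵇ-support : (x : Vec ℕ t) → (∀ i → lookup x i ≤ 1) → indicatorᵇ (support x) ≡ x
indicatorᵇ-support []                le = refl
indicatorᵇ-support (0 ∷ x)           le = cong (0 ∷_) (indicatorᵇ-support x (le ∘ suc))
indicatorᵇ-support (1 ∷ x)           le = cong (1 ∷_) (indicatorᵇ-support x (le ∘ suc))
indicatorᵇ-support (suc (suc k) ∷ x) le = ⊥-elim (<⇒≱ (s≤s (s≤s z≤n)) (le zero))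

lookup-support-0 : (x : Vec ℕ t) (i : Fin t) → lookup x i ≡ 0 → lookup (support x) i ≡ false
lookup-support-0 (0 ∷ x)     zero    e = refl
lookup-support-0 (0 ∷ x)     (suc i) e = lookup-support-0 x i e
lookup-support-0 (suc _ ∷ x) (suc i) e = lookup-support-0 x i e

lookup-support-pos : (x : Vec ℕ t) (i : Fin t) → 0 < lookup x i → lookup (support x) i ≡ true
lookup-support-pos (0 ∷ x)     (suc i) p = lookup-support-pos x i p
lookup-support-pos (suc _ ∷ x) zero    p = refl
lookup-support-pos (suc _ ∷ x) (suc i) p = lookup-support-pos x i p

mask-size-remove : (m : Vec Bool t) (i : Fin t) → mask-size m ≤ suc (mask-size (m Vec.[ i ]≔ false))
mask-size-remove (true  ∷ m) zero    = ≤-refl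
mask-size-remove (false ∷ m) zero    = n≤1+n _
mask-size-remove (true  ∷ m) (suc i) = s≤s (mask-size-remove m i)
mask-size-remove (false ∷ m) (suc i) = mask-size-remove m i

lookup-extend-false : (m : Vec Bool t) (x : Vec ℕ (mask-size m)) (i : Fin t) → lookup m i ≡ false → lookup (extend m x) i ≡ 0
lookup-extend-false (false ∷ m) x       zero    e = refl
lookup-extend-false (false ∷ m) x       (suc i) e = lookup-extend-false m x i e
lookup-extend-false (true  ∷ m) (_ ∷ x) (suc i) e = lookup-extend-false m x i e

extend-≤ : (m : Vec Bool t) (x : Vec ℕ (mask-size m)) (k : ℕ) → (∀ i → lookup x i ≤ k) → ∀ i → lookup (extend m x) i ≤ k
extend-≤ (false ∷ m) x       k le zero    = z≤n
extend-≤ (false ∷ m) x       k le (suc i) = extend-≤ m x k le i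
extend-≤ (true  ∷ m) (_ ∷ x) k le zero    = le zero
extend-≤ (true  ∷ m) (_ ∷ x) k le (suc i) = extend-≤ m x k (le ∘ suc) i

module SmallExponent {c ℓ : Level} (𝔾 : AbelianGroup c ℓ)
  (_≟ᵍ_ : ∀ x y → Dec (AbelianGroup._≈_ 𝔾 x y)) where
  open Families 𝔾
  open Decidable _≟ᵍ_
  open ZeroSumFree 𝔾

  ⊗-multiple : ∀ {g m k} → m ∣ k → m ⊗ g ≈ ε → k ⊗ g ≈ ε
  ⊗-multiple {g} {m} (divides q e) h = ≈-trans (×-congˡ e) (≈-trans (≈-sym (×-assocˡ g q m)) (≈-trans (×-congʳ q h) (⊗-ε q)))

  ⊗-resp-cong : ∀ {n g k l} → n ⊗ g ≈ ε → Cong n k l → k ⊗ g ≈ l ⊗ g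
  ⊗-resp-cong {n} {g} {k} {l} h (a , b , e) = ≈-trans (≈-sym (absorb k a)) (≈-trans (×-congˡ e) (absorb l b))
    where
    absorb : ∀ k a → (k + a * n) ⊗ g ≈ k ⊗ g
    absorb k a = ≈-trans (×-homo-+ g k (a * n)) (≈-trans (∙-congˡ (⊗-multiple {g} (n∣m*n a) h)) (identityʳ _))

  no-zsf : (∀ g → 1 ⊗ g ≈ ε) → ∀ {k} → ¬ HasZsf (suc k)
  no-zsf triv {k} (S , zsf) with zsf (single zero 1) (λ { zero → ≤-refl ; (suc i) → subst (_≤ 1) (sym (lookup-𝟘 i)) z≤n })
                                   (≈-trans (eval-single S zero 1) (triv (lookup S zero)))
  ... | ()

  even-part : ∀ (S : Vec C t) → (∀ i → 2 ⊗ lookup S i ≈ ε) → ∀ {x z w} → x ≡ z ⊕ 2 · w → eval S x ≈ eval S z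
  even-part S h {x} {z} {w} refl = ≈-trans (eval-⊕ S z (2 · w)) (≈-trans (∙-congˡ (≈-trans (eval-· S 2 w) (⊗-eval 2 S h w))) (identityʳ _))

  2∣-coordinates : ∀ {x z w : Vec ℕ t} → x ≡ z ⊕ 2 · w → z ≡ 𝟘 → ∀ i → 2 ∣ lookup x i
  2∣-coordinates {w = w} refl refl i = subst (2 ∣_) (sym (trans (cong (λ v → lookup v i) (⊕-identityˡ (2 · w))) (lookup-· 2 w i))) (m∣m*n (lookup w i))

  -- When 2 annihilates the members, multiplicities matter only modulo 2, so zero-sum freeness is
  -- linear independence over the field with two elements.
  zsf⇒indep-2 : (S : Vec C t) → (∀ i → 2 ⊗ lookup S i ≈ ε) → Zsf S → Indep 2 S
  zsf⇒indep-2 S h zsf = h , λ x zx → let (z , w , e , le) = halve x in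
    2∣-coordinates {x = x} {z} {w} e (zsf z le (≈-trans (≈-sym (even-part S h {x} {z} {w} e)) zx))

  -- Were all four elements multiples of `g₀`, they would give a zero-sum free sequence of length 4
  -- in C_3, contrary to `zsf-bound`. An element outside the multiples of `g₀` is independent of it.
  indep-3 : (∀ g → 3 ⊗ g ≈ ε) → ∀ g₀ → Indep 3 (g₀ ∷ []) → HasZsf 4 → ∃ λ (F : Vec C 2) → Indep 3 F
  indep-3 exp g₀ (_ , ind₀) (S , zsf) with FinP.all? (λ i → FinP.any? (λ (k : Fin 3) → lookup S i ≟ᵍ (toℕ k ⊗ g₀)))
  ... | yes all = ⊥-elim (<⇒≱ (Finite.zsf-bound ℂ₃.group ℂ₃._≟ᶜ_ (3 ^ 1) ℂ₃.elements ℂ₃.index (K , zsf-K)) (n≤1+n 3))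
    where
    module ℂ₃ = Homocyclic 3 1
    K : Vec (Fin 1 → Fin 3) 4
    K = Vec.tabulate λ i _ → proj₁ (all i)
    lookup-K : ∀ i → lookup S i ≈ toℕ (lookup K i zero) ⊗ g₀
    lookup-K i = ≈-trans (proj₂ (all i)) (×-congˡ (cong toℕ (cong (λ f → f zero) (sym (VecP.lookup∘tabulate (λ i (_ : Fin 1) → proj₁ (all i)) i)))))
    eval-dot : ∀ {t} (S : Vec C t) (K : Vec (Fin 1 → Fin 3) t) → (∀ i → lookup S i ≈ toℕ (lookup K i zero) ⊗ g₀) →
      ∀ x → eval S x ≈ ℂ₃.dot K x zero ⊗ g₀
    eval-dot []      []      h []      = ≈-refl
    eval-dot (s ∷ S) (κ ∷ K) h (k ∷ x) = ≈-trans (∙-cong (≈-trans (×-congʳ k (h zero)) (×-assocˡ g₀ k (toℕ (κ zero)))) (eval-dot S K (h ∘ suc) x))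
      (≈-sym (×-homo-+ g₀ (k * toℕ (κ zero)) (ℂ₃.dot K x zero)))
    zsf-K : ZeroSumFree.Zsf ℂ₃.group K
    zsf-K x le zx = zsf x le (≈-trans (eval-dot S K lookup-K x) (⊗-multiple {g₀} {3} (cong-0⇒∣
      (cong-trans (cong-sym (ℂ₃.eval-cong K x zero)) (cong-trans (cong-≡ (cong toℕ (zx zero))) (ℂ₃.mod-cong 0)))) (exp g₀)))
  ... | no ¬all with FinP.¬∀⟶∃¬ 4 _ (λ i → FinP.any? (λ (k : Fin 3) → lookup S i ≟ᵍ (toℕ k ⊗ g₀))) ¬all
  ... | i , outside = x ∷ g₀ ∷ [] , (λ { zero → exp x ; (suc zero) → exp g₀ }) , ind
    where
    x = lookup S i
    module ℂ₃ = Homocyclic 3 1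
    not-multiple : ∀ k → ¬ x ≈ k ⊗ g₀
    not-multiple k e = outside (k mod 3 , ≈-trans e (⊗-resp-cong {3} {g₀} (exp g₀) (cong-sym (ℂ₃.mod-cong k))))
    ind : ∀ y → Zs (x ∷ g₀ ∷ []) y → ∀ j → 3 ∣ lookup y j
    ind (a ∷ b ∷ []) z = go (a % 3) (m%n<n a 3) (ℂ₃.mod-cong a) refl
      where
      go : ∀ ρ → ρ < 3 → Cong 3 (toℕ (a mod 3)) a → a % 3 ≡ ρ → ∀ j → 3 ∣ lookup (a ∷ b ∷ []) j
      go ρ ρ<3 _ e = by ρ ρ<3 (cong-sym (0 , a / 3 , trans (+-identityʳ a) (trans (m≡m%n+[m/n]*n a 3) (cong (_+ a / 3 * 3) e))))
        where
        rel : ∀ ρ → Cong 3 ρ a → ρ ⊗ x ∙ b ⊗ g₀ ≈ ε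
        rel ρ c = ≈-trans (∙-cong (⊗-resp-cong {3} {x} (exp x) c) (≈-sym (identityʳ _))) z
        by : ∀ ρ → ρ < 3 → Cong 3 ρ a → ∀ j → 3 ∣ lookup (a ∷ b ∷ []) j
        by 0 _ c zero       = cong-∣ c (3 ∣0)
        by 0 _ c (suc zero) = ind₀ (b ∷ []) (≈-trans (identityʳ _) (≈-trans (≈-sym (identityˡ _)) (rel 0 c))) zero
        by 1 _ c j = ⊥-elim (not-multiple (2 * b) (Algebra.Properties.AbelianGroup.∙-cancelʳ 𝔾 (b ⊗ g₀) x ((2 * b) ⊗ g₀)
          (≈-trans (≈-trans (∙-congʳ (≈-sym (×-homo-1 x))) (rel 1 c)) (≈-sym (≈-trans (≈-sym (×-homo-+ g₀ (2 * b) b))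
            (⊗-multiple {g₀} {3} (divides b (trans (+-comm (2 * b) b) (*-comm 3 b))) (exp g₀)))))))
        by 2 _ c j = ⊥-elim (not-multiple b (≈-trans (≈-sym (identityʳ x)) (≈-trans (∙-congˡ (≈-sym (rel 2 c)))
          (≈-trans (≈-sym (assoc x (2 ⊗ x) (b ⊗ g₀))) (≈-trans (∙-congʳ (exp x)) (identityˡ _))))))
        by (suc (suc (suc ρ))) (s≤s (s≤s (s≤s ()))) c j

  module _ (t₀ : C) (2t≈ε : 2 ⊗ t₀ ≈ ε) where

    ⊗-parity : ∀ {v} → 2 ⊗ v ≈ ε → ∀ k → (2 ∣ k × k ⊗ v ≈ ε) ⊎ k ⊗ v ≈ v
    ⊗-parity {v} h k with even-or-odd k
    ... | q , inj₁ e = inj₁ (d , ⊗-multiple {v} d h)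
      where d = subst (2 ∣_) (sym e) (m∣m*n q)
    ... | q , inj₂ e = inj₂ (≈-trans (×-congˡ e) (≈-trans (∙-congˡ (⊗-multiple {v} {2} (m∣m*n q) h)) (identityʳ v)))

    2t∙t : t₀ ∙ t₀ ≈ ε
    2t∙t = ≈-trans (∙-congˡ (≈-sym (×-homo-1 t₀))) 2t≈ε

    module _ (t≉ε : ¬ t₀ ≈ ε) (doubles : ∀ x → 2 ⊗ x ≈ ε ⊎ 2 ⊗ x ≈ t₀) where

      -- A relation in the quotient by the subgroup with elements 0 and `t₀`, which has exponent 2
      -- because all doubles lie in that subgroup.
      Isotropic : Vec C t → Vec ℕ t → Set ℓ
      Isotropic y z = eval y z ≈ ε ⊎ eval y z ≈ t₀

      -- If 2 yᵢ = t, adding yᵢ to those yⱼ with 2 yⱼ = t makes all orders 2 (and turns yᵢ into t).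
      no-isotropic⇒indep : (y : Vec C t) → (∀ z → (∀ i → lookup z i ≤ 1) → Isotropic y z → z ≡ 𝟘) → ∃ λ (F : Vec C t) → Indep 2 F
      no-isotropic⇒indep {t} y none with FinP.any? (λ i → (2 ⊗ lookup y i) ≟ᵍ t₀)
      ... | no no-t = y , zsf⇒indep-2 y (λ i → [ id , (λ e → ⊥-elim (no-t (i , e))) ]′ (doubles (lookup y i)))
                            λ z le zz → none z le (inj₁ zz)
      ... | yes (i , yi-t) = F , F-2 , ind
        where
        h = lookup y i
        μ : C → ℕ
        μ g = if does ((2 ⊗ g) ≟ᵍ t₀) then 1 else 0
        μ-spec : ∀ g → 2 ⊗ g ≈ μ g ⊗ t₀
        μ-spec g with (2 ⊗ g) ≟ᵍ t₀
        ... | yes e = ≈-trans e (≈-sym (×-homo-1 t₀))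
        ... | no ¬e = [ id , (λ e → ⊥-elim (¬e e)) ]′ (doubles g)
        μ-h : μ h ≡ 1
        μ-h with (2 ⊗ h) ≟ᵍ t₀
        ... | yes e = refl
        ... | no ¬e = ⊥-elim (¬e yi-t)
        m : ∀ {t} → Vec C t → Vec ℕ t
        m = Vec.map μ
        F : Vec C t
        F = Vec.map (λ g → g ∙ μ g ⊗ h) y
        F-2 : ∀ j → 2 ⊗ lookup F j ≈ ε
        F-2 j = ≈-trans (×-congʳ 2 (reflexive (VecP.lookup-map j (λ g → g ∙ μ g ⊗ h) y))) (order-2 (lookup y j))
          where
          order-2 : ∀ g → 2 ⊗ (g ∙ μ g ⊗ h) ≈ ε
          order-2 g = begin
            2 ⊗ (g ∙ μ g ⊗ h)               ≈⟨ ×-distrib-+ g (μ g ⊗ h) 2 ⟩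
            2 ⊗ g ∙ 2 ⊗ (μ g ⊗ h)           ≈⟨ ∙-cong (μ-spec g) (≈-trans (×-assocˡ h 2 (μ g)) (≈-trans (×-congˡ (*-comm 2 (μ g))) (≈-sym (×-assocˡ h (μ g) 2)))) ⟩
            μ g ⊗ t₀ ∙ μ g ⊗ (2 ⊗ h)        ≈⟨ ∙-congˡ (×-congʳ (μ g) yi-t) ⟩
            μ g ⊗ t₀ ∙ μ g ⊗ t₀             ≈⟨ ×-distrib-+ t₀ t₀ (μ g) ⟨
            μ g ⊗ (t₀ ∙ t₀)                 ≈⟨ ×-congʳ (μ g) 2t∙t ⟩
            μ g ⊗ ε                         ≈⟨ ⊗-ε (μ g) ⟩
            ε                               ∎
            where open ≈R
        eval-F : ∀ {t} (y : Vec C t) x → eval (Vec.map (λ g → g ∙ μ g ⊗ h) y) x ≈ eval y x ∙ dotℕ (m y) x ⊗ h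
        eval-F []      []      = ≈-sym (identityˡ ε)
        eval-F (g ∷ y) (k ∷ x) = ≈-trans (∙-cong (≈-trans (×-distrib-+ g (μ g ⊗ h) k) (∙-congˡ (≈-trans (×-assocˡ h k (μ g)) (×-congˡ (*-comm k (μ g))))))
          (eval-F y x)) (≈-trans (∙-interchange _ _ _ _) (∙-congˡ (≈-sym (×-homo-+ h (μ g * k) (dotℕ (m y) x)))))
        eval-2 : ∀ {t} (y : Vec C t) x → 2 ⊗ eval y x ≈ dotℕ (m y) x ⊗ t₀
        eval-2 []      []      = ⊗-ε 2
        eval-2 (g ∷ y) (k ∷ x) = ≈-trans (×-distrib-+ (k ⊗ g) (eval y x) 2) (≈-trans (∙-cong
          (≈-trans (×-assocˡ g 2 k) (≈-trans (×-congˡ (*-comm 2 k)) (≈-trans (≈-sym (×-assocˡ g k 2)) (≈-trans (×-congʳ k (μ-spec g))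
            (≈-trans (×-assocˡ t₀ k (μ g)) (×-congˡ (*-comm k (μ g))))))))
          (eval-2 y x)) (≈-sym (×-homo-+ t₀ (μ g * k) (dotℕ (m y) x))))
        ind : ∀ x → Zs F x → ∀ j → 2 ∣ lookup x j
        ind x zx j = go (i Fin.≟ j)
          where
          M = dotℕ (m y) x
          w = x ⊕ single i M
          hw = halve w
          z = proj₁ hw
          w′ = proj₁ (proj₂ hw)
          e = proj₁ (proj₂ (proj₂ hw))
          zw : Zs y w
          zw = ≈-trans (eval-⊕ y x (single i M)) (≈-trans (∙-congˡ (eval-single y i M)) (≈-trans (≈-sym (eval-F y x)) zx))
          split : eval y z ∙ 2 ⊗ eval y w′ ≈ ε
          split = ≈-trans (∙-congˡ (≈-sym (eval-· y 2 w′))) (≈-trans (≈-sym (eval-⊕ y z (2 · w′))) (subst (Zs y) e zw))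
          z≡𝟘 : z ≡ 𝟘
          z≡𝟘 = none z (proj₂ (proj₂ (proj₂ hw))) (iso (doubles (eval y w′)))
            where
            iso : 2 ⊗ eval y w′ ≈ ε ⊎ 2 ⊗ eval y w′ ≈ t₀ → Isotropic y z
            iso (inj₁ p) = inj₁ (≈-trans (≈-sym (identityʳ _)) (≈-trans (∙-congˡ (≈-sym p)) split))
            iso (inj₂ p) = inj₂ (Algebra.Properties.AbelianGroup.∙-cancelʳ 𝔾 t₀ _ _ (≈-trans (∙-congˡ (≈-sym p)) (≈-trans split (≈-sym 2t∙t))))
          2∣w : ∀ j → 2 ∣ lookup w j
          2∣w = 2∣-coordinates {x = w} {z} {w′} e z≡𝟘
          w≡2w′ : w ≡ 2 · w′
          w≡2w′ = trans e (trans (cong (_⊕ 2 · w′) z≡𝟘) (⊕-identityˡ (2 · w′)))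
          -- Adding `M` copies of `yᵢ` doubles the count `M` of members with double `t₀`, and
          -- halving restores it. Since `w = 2 w′` is a relation, the double of the sum of `w′` is
          -- both 0 and `M t₀`, so `M` is even.
          dot≡M : dotℕ (m y) w′ ≡ M
          dot≡M = *-cancelˡ-≡ (dotℕ (m y) w′) M 2 (trans (sym (dotℕ-2· (m y) w′)) (trans (cong (dotℕ (m y)) (sym w≡2w′))
            (trans (dotℕ-⊕ (m y) x (single i M)) (trans (cong (M +_) (trans (dotℕ-single (m y) i M)
              (cong (_* M) (trans (VecP.lookup-map i μ y) μ-h)))) refl))))
          Mt : M ⊗ t₀ ≈ ε
          Mt = ≈-trans (×-congˡ (sym dot≡M)) (≈-trans (≈-sym (eval-2 y w′)) (≈-trans (≈-trans (≈-sym (identityˡ _))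
            (∙-congʳ (≈-sym (≈-trans (reflexive (cong (eval y) z≡𝟘)) (eval-𝟘 y))))) split))
          2∣M : 2 ∣ M
          2∣M = [ proj₁ , (λ e → ⊥-elim (t≉ε (≈-trans (≈-sym e) Mt))) ]′ (⊗-parity {t₀} 2t≈ε M)
          go : Dec (i ≡ j) → 2 ∣ lookup x j
          go (no i≢j)   = subst (2 ∣_) (trans (lookup-⊕ x (single i M) j) (trans (cong (lookup x j +_) (lookup-single-≢ i j M i≢j)) (+-identityʳ _))) (2∣w j)
          go (yes refl) = ∣m+n∣m⇒∣n (subst (2 ∣_) (trans (lookup-⊕ x (single i M) i) (trans (cong (lookup x i +_) (lookup-single i M)) (+-comm (lookup x i) M))) (2∣w i)) 2∣M

      module _ (no-indep : ¬ ∃ λ (F : Vec C 4) → Indep 2 F) where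

        isotropic : ∀ {k} → 4 ≤ k → (y : Vec C k) → ∃ λ z → (∀ i → lookup z i ≤ 1) × z ≢ 𝟘 × Isotropic y z
        isotropic {k} 4≤k y with search-below (λ z → ¬? (z ≟ᵛ 𝟘) ×-dec ((eval y z ≟ᵍ ε) ⊎-dec (eval y z ≟ᵍ t₀))) (𝟙 {k})
        ... | inj₁ (z , le , z≢𝟘 , iso) = z , (λ i → subst (lookup z i ≤_) (lookup-𝟙 i) (le i)) , z≢𝟘 , iso
        ... | inj₂ none = ⊥-elim (no-indep (let (F , ind) = no-isotropic⇒indep y trivial in indep-shorten 4≤k F ind))
          where
          trivial : ∀ z → (∀ i → lookup z i ≤ 1) → Isotropic y z → z ≡ 𝟘
          trivial z le iso with z ≟ᵛ 𝟘
          ... | yes p = p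
          ... | no ¬p = ⊥-elim (none z (λ i → subst (lookup z i ≤_) (sym (lookup-𝟙 i)) (le i)) (¬p , iso))

        -- (A , B) ↦ 2 σ(A ∩ B) is bilinear on subsets, but would equal t for all distinct nonempty isotropic A, B.
        no-zsf-6 : ¬ HasZsf 6
        no-zsf-6 (S , zsf) = t≉ε (≈-trans (Algebra.Properties.AbelianGroup.∙-cancelˡ 𝔾 t₀ t₀ ε (≈-trans 2t∙t (≈-sym (≈-trans (identityʳ _) t≈ε′)))) ≈-refl)
          where
          σ : Vec Bool 6 → C
          σ A = eval S (indicatorᵇ A)

          -- At least four positions remain besides `i` and `j`. The sum of an isotropic subset
          -- among them cannot be 0, as `S` is zero-sum free, so it is `t₀`.
          subset : ∀ i j → ∃ λ A → lookup A i ≡ false × lookup A j ≡ false × σ A ≈ t₀ × ∃ λ l → lookup A l ≡ true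
          subset i j = A , off i i-false , off j j-false ,
              [ (λ e → ⊥-elim (x≢𝟘 (zsf x x≤1 (≈-trans (eval-restrict m S z) e)))) ,
                (λ e → ≈-trans (reflexive (cong (eval S) (indicatorᵇ-support x x≤1))) (≈-trans (eval-restrict m S z) e)) ]′ iso ,
              (let (l , p) = nonzero-coordinate x x≢𝟘 in l , lookup-support-pos x l p)
            where
            m₁ m : Vec Bool 6
            m₁ = replicate 6 true Vec.[ i ]≔ false
            m = m₁ Vec.[ j ]≔ false
            found = isotropic {mask-size m} (s≤s⁻¹ (s≤s⁻¹ (≤-trans (mask-size-remove (replicate 6 true) i) (s≤s (mask-size-remove m₁ j))))) (restrict m S)
            z = proj₁ found
            z≢𝟘 = proj₁ (proj₂ (proj₂ found))
            iso = proj₂ (proj₂ (proj₂ found))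
            x : Vec ℕ 6
            x = extend m z
            A : Vec Bool 6
            A = support x
            x≤1 : ∀ i → lookup x i ≤ 1
            x≤1 = extend-≤ m z 1 (proj₁ (proj₂ found))
            x≢𝟘 : x ≢ 𝟘
            x≢𝟘 e = z≢𝟘 (extend-injective m (trans e (sym (extend-𝟘 m))))
            j-false : lookup m j ≡ false
            j-false = VecP.lookup∘updateAt j m₁
            i-false : lookup m i ≡ false
            i-false with i Fin.≟ j
            ... | yes refl = j-false
            ... | no i≢j = trans (VecP.lookup∘updateAt′ i j i≢j m₁) (VecP.lookup∘updateAt i (replicate 6 true))
            off : ∀ l → lookup m l ≡ false → lookup A l ≡ false
            off l e = lookup-support-0 x l (lookup-extend-false m z l e)

          q : Vec Bool 6 → Vec Bool 6 → C
          q A B = 2 ⊗ σ (zipWith _∧_ A B)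

          -- The sums of `A` and `B` add up to 0, and also to the sum of the symmetric difference
          -- plus `q A B`. Position `l` keeps the symmetric difference nonempty, so its sum is
          -- nonzero, which excludes `q A B = 0`.
          σ-pair : ∀ A B l → σ A ≈ t₀ → σ B ≈ t₀ → lookup A l ≡ true → lookup B l ≡ false → q A B ≈ t₀ × σ (zipWith _xor_ A B) ≈ t₀
          σ-pair A B l eA eB Al Bl = go (doubles (σ (zipWith _∧_ A B)))
            where
            X = zipWith _xor_ A B
            sum : t₀ ∙ t₀ ≈ σ X ∙ q A B
            sum = ≈-trans (∙-cong (≈-sym eA) (≈-sym eB)) (≈-trans (≈-sym (eval-⊕ S (indicatorᵇ A) (indicatorᵇ B)))
              (≈-trans (reflexive (cong (eval S) (indicatorᵇ-xor A B))) (≈-trans (eval-⊕ S (indicatorᵇ X) (2 · indicatorᵇ (zipWith _∧_ A B)))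
              (∙-congˡ (eval-· S 2 (indicatorᵇ (zipWith _∧_ A B)))))))
            X≢𝟘 : indicatorᵇ X ≢ 𝟘
            X≢𝟘 e = 1≢0 (trans (sym (trans (VecP.lookup-map l (λ b → if b then 1 else 0) X) (cong (λ b → if b then 1 else 0)
              (trans (VecP.lookup-zipWith _xor_ l A B) (cong₂ _xor_ Al Bl))))) (trans (cong (λ v → lookup v l) e) (lookup-𝟘 l)))
              where
              1≢0 : 1 ≢ 0
              1≢0 ()
            go : q A B ≈ ε ⊎ q A B ≈ t₀ → q A B ≈ t₀ × σ X ≈ t₀
            go (inj₁ e) = ⊥-elim (X≢𝟘 (zsf (indicatorᵇ X) (indicatorᵇ-≤1 X) (≈-trans (≈-sym (identityʳ _)) (≈-trans (∙-congˡ (≈-sym e)) (≈-trans (≈-sym sum) 2t∙t)))))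
            go (inj₂ e) = e , Algebra.Properties.AbelianGroup.∙-cancelʳ 𝔾 t₀ (σ X) t₀ (≈-trans (∙-congˡ (≈-sym e)) (≈-sym sum))

          q-additive : ∀ A B B′ → q A B ∙ q A B′ ≈ q A (zipWith _xor_ B B′)
          q-additive A B B′ = ≈-trans (≈-sym (×-distrib-+ (σ (zipWith _∧_ A B)) (σ (zipWith _∧_ A B′)) 2)) (≈-trans (×-congʳ 2
            (≈-trans (≈-sym (eval-⊕ S (indicatorᵇ (zipWith _∧_ A B)) (indicatorᵇ (zipWith _∧_ A B′)))) (≈-trans (reflexive (cong (eval S) (indicatorᵇ-∧ A B B′)))
              (≈-trans (eval-⊕ S (indicatorᵇ Y) (2 · indicatorᵇ Z)) (∙-congˡ (eval-· S 2 (indicatorᵇ Z)))))))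
            (≈-trans (×-distrib-+ (σ Y) (2 ⊗ σ Z) 2) (≈-trans (∙-congˡ four) (identityʳ _))))
            where
            Y = zipWith _∧_ A (zipWith _xor_ B B′)
            Z = zipWith _∧_ A (zipWith _∧_ B B′)
            four : 2 ⊗ (2 ⊗ σ Z) ≈ ε
            four = [ (λ e → ≈-trans (×-congʳ 2 e) (⊗-ε 2)) , (λ e → ≈-trans (×-congʳ 2 e) 2t≈ε) ]′ (doubles (σ Z))

          -- `A₂` avoids a position `l₁` of `A₁`, and `A₃` avoids `l₁` and a position `l₂` of `A₂`.
          -- Thus `l₁` also separates `A₁` from the symmetric difference of `A₂` and `A₃`.
          s₁ = subset zero zero
          A₁ = proj₁ s₁
          l₁ = proj₁ (proj₂ (proj₂ (proj₂ (proj₂ s₁))))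
          A₁l₁ : lookup A₁ l₁ ≡ true
          A₁l₁ = proj₂ (proj₂ (proj₂ (proj₂ (proj₂ s₁))))
          σA₁ : σ A₁ ≈ t₀
          σA₁ = proj₁ (proj₂ (proj₂ (proj₂ s₁)))
          s₂ = subset l₁ l₁
          A₂ = proj₁ s₂
          A₂l₁ : lookup A₂ l₁ ≡ false
          A₂l₁ = proj₁ (proj₂ s₂)
          l₂ = proj₁ (proj₂ (proj₂ (proj₂ (proj₂ s₂))))
          A₂l₂ : lookup A₂ l₂ ≡ true
          A₂l₂ = proj₂ (proj₂ (proj₂ (proj₂ (proj₂ s₂))))
          σA₂ : σ A₂ ≈ t₀
          σA₂ = proj₁ (proj₂ (proj₂ (proj₂ s₂)))
          s₃ = subset l₁ l₂
          A₃ = proj₁ s₃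
          A₃l₁ : lookup A₃ l₁ ≡ false
          A₃l₁ = proj₁ (proj₂ s₃)
          A₃l₂ : lookup A₃ l₂ ≡ false
          A₃l₂ = proj₁ (proj₂ (proj₂ s₃))
          σA₃ : σ A₃ ≈ t₀
          σA₃ = proj₁ (proj₂ (proj₂ (proj₂ s₃)))
          p₁₂ : q A₁ A₂ ≈ t₀
          p₁₂ = proj₁ (σ-pair A₁ A₂ l₁ σA₁ σA₂ A₁l₁ A₂l₁)
          p₁₃ : q A₁ A₃ ≈ t₀
          p₁₃ = proj₁ (σ-pair A₁ A₃ l₁ σA₁ σA₃ A₁l₁ A₃l₁)
          σA₂₃ : σ (zipWith _xor_ A₂ A₃) ≈ t₀
          σA₂₃ = proj₂ (σ-pair A₂ A₃ l₂ σA₂ σA₃ A₂l₂ A₃l₂)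
          p₁₂₃ : q A₁ (zipWith _xor_ A₂ A₃) ≈ t₀
          p₁₂₃ = proj₁ (σ-pair A₁ (zipWith _xor_ A₂ A₃) l₁ σA₁ σA₂₃ A₁l₁ (trans (VecP.lookup-zipWith _xor_ l₁ A₂ A₃) (cong₂ _xor_ A₂l₁ A₃l₁)))
          t≈ε′ : t₀ ≈ ε
          t≈ε′ = ≈-trans (≈-sym p₁₂₃) (≈-trans (≈-sym (q-additive A₁ A₂ A₃)) (≈-trans (∙-cong p₁₂ p₁₃) 2t∙t))

  -- Doubling a relation `a x + b f = 0` and using that `2 x` is no multiple of `2 f` shows that `a`
  -- and `b` are even. The same argument for their halves gives divisibility of `a` by 4, and then
  -- `b f = 0`.
  indep-4 : (∀ g → 4 ⊗ g ≈ ε) → ∀ f → Indep 4 (f ∷ []) → ∀ x → ¬ 2 ⊗ x ≈ ε → ¬ 2 ⊗ x ≈ 2 ⊗ f → Indep 4 (x ∷ f ∷ [])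
  indep-4 exp f (_ , ind-f) x 2x≉ε 2x≉2f = (λ { zero → exp x ; (suc zero) → exp f }) , ind
    where
    u v : C
    u = 2 ⊗ x
    v = 2 ⊗ f
    double : ∀ g → 2 ⊗ (2 ⊗ g) ≈ ε
    double g = ≈-trans (×-assocˡ g 2 2) (exp g)
    v∙v : v ∙ v ≈ ε
    v∙v = 2t∙t v (double f)
    impossible : ∀ k → ¬ u ∙ k ⊗ v ≈ ε
    impossible k e with ⊗-parity v (double f) {v} (double f) k
    ... | inj₁ (_ , kv) = 2x≉ε (≈-trans (≈-sym (identityʳ u)) (≈-trans (∙-congˡ (≈-sym kv)) e))
    ... | inj₂ kv = 2x≉2f (Algebra.Properties.AbelianGroup.∙-cancelʳ 𝔾 v u v (≈-trans (∙-congˡ (≈-sym kv)) (≈-trans e (≈-sym v∙v))))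
    ⊗-swap : ∀ g k l → k ⊗ (l ⊗ g) ≈ l ⊗ (k ⊗ g)
    ⊗-swap g k l = ≈-trans (×-assocˡ g k l) (≈-trans (×-congˡ (*-comm k l)) (≈-sym (×-assocˡ g l k)))
    ind : ∀ y → Zs (x ∷ f ∷ []) y → ∀ j → 4 ∣ lookup y j
    ind (a ∷ b ∷ []) z = by (⊗-parity v (double f) {u} (double x) a)
      where
      rel : a ⊗ x ∙ b ⊗ f ≈ ε
      rel = ≈-trans (∙-congˡ (≈-sym (identityʳ _))) z
      rel₂ : a ⊗ u ∙ b ⊗ v ≈ ε
      rel₂ = ≈-trans (∙-cong (⊗-swap x a 2) (⊗-swap f b 2)) (≈-trans (≈-sym (×-distrib-+ (a ⊗ x) (b ⊗ f) 2)) (≈-trans (×-congʳ 2 rel) (⊗-ε 2)))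
      by : (2 ∣ a × a ⊗ u ≈ ε) ⊎ a ⊗ u ≈ u → ∀ j → 4 ∣ lookup (a ∷ b ∷ []) j
      by (inj₂ au) j = ⊥-elim (impossible b (≈-trans (∙-congʳ (≈-sym au)) rel₂))
      by (inj₁ (divides a′ a≡ , au)) = half (⊗-parity v (double f) {u} (double x) a′)
        where
        b⊗v : b ⊗ v ≈ ε
        b⊗v = ≈-trans (≈-sym (identityˡ _)) (≈-trans (∙-congʳ (≈-sym au)) rel₂)
        4∣2b : 4 ∣ b * 2
        4∣2b = ind-f (b * 2 ∷ []) (≈-trans (identityʳ _) (≈-trans (≈-sym (×-assocˡ f b 2)) b⊗v)) zero
        2∣b : 2 ∣ b
        2∣b = *-cancelʳ-∣ 2 4∣2b
        rel₃ : a′ ⊗ u ∙ b ⊗ f ≈ ε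
        rel₃ = ≈-trans (∙-congʳ (≈-trans (×-assocˡ x a′ 2) (×-congˡ (sym a≡)))) rel
        half : (2 ∣ a′ × a′ ⊗ u ≈ ε) ⊎ a′ ⊗ u ≈ u → ∀ j → 4 ∣ lookup (a ∷ b ∷ []) j
        half (inj₂ a′u) j = ⊥-elim (impossible (quotient 2∣b) (≈-trans (∙-cong (≈-sym a′u)
          (≈-trans (×-assocˡ f (quotient 2∣b) 2) (×-congˡ (sym (_∣_.equality 2∣b))))) rel₃))
        half (inj₁ (2∣a′ , _)) zero = subst (4 ∣_) (sym a≡) (*-monoˡ-∣ 2 2∣a′)
        half (inj₁ (_ , a′u)) (suc zero) = ind-f (b ∷ []) (≈-trans (identityʳ _) (≈-trans (≈-sym (identityˡ _)) (≈-trans (∙-congʳ (≈-sym a′u)) rel₃))) zero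

-- Comparison with the homocyclic group

module Characterization (n r : ℕ) .{{_ : NonZero n}} (3≤n : 3 ≤ n) (1≤r : 1 ≤ r) (r<n : r < n)
  {c ℓ : Level} (𝔾 : AbelianGroup c ℓ)
  (_≟ᵍ_ : ∀ x y → Dec (AbelianGroup._≈_ 𝔾 x y))
  (N : ℕ) (E : Vec (AbelianGroup.Carrier 𝔾) N) (index : ∀ g → ∃ λ i → AbelianGroup._≈_ 𝔾 g (lookup E i))
  (n′ : ℕ) (0<n′ : 0 < n′)
  (exponent : ∀ g → AbelianGroup._≈_ 𝔾 (Families._⊗_ 𝔾 n′ g) (AbelianGroup.ε 𝔾))
  (g₀ : AbelianGroup.Carrier 𝔾) (indep-g₀ : Families.Indep 𝔾 n′ (g₀ ∷ []))
  (GC : AbelianGroup.rawMonoid 𝔾 ⊆ℒ Cⁿʳ n r) (CG : Cⁿʳ n r ⊆ℒ AbelianGroup.rawMonoid 𝔾) where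
  open Families 𝔾
  module ℂ = Homocyclic n r

  2≤n : 2 ≤ n
  2≤n = ≤-trans (n≤1+n 2) 3≤n

  -- In C_n^r the condition `r ≤ d` excludes `d + 1` independent elements of equal order, by
  -- `indep-rank`.
  into-ℂ : ∀ d → r ≤ d → n ≤ suc (2 * d) → ∀ p q → HasLengths d p q → p < q →
    ¬ ¬ ∃ λ k → 1 ≤ k × suc k + d ≡ n × q * suc k ≤ p * n × Families.IndepExists ℂ.group n k
  into-ℂ d r≤d n≤ = Limit.transferred 𝔾 ℂ.group ℂ._≟ᶜ_ n ℂ.0<n ℂ.exponent (n ^ r) ℂ.elements ℂ.index GC d n≤
    λ P 2≤P (F , ind) → <⇒≱ (s≤s r≤d) (ℂ.indep-rank 2≤P F ind)

  -- The source is `MinusSum` for `s + 1` of the basis elements of C_n^r, with lengths `s + 2` and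
  -- `n`.
  into-𝔾 : ∀ d → n′ ≤ suc (2 * d) → (∀ P → 2 ≤ P → ¬ IndepExists P (suc d)) →
    ∀ s → suc (suc s) + d ≡ n → suc s ≤ r → suc (suc s) < n →
    ¬ ¬ ∃ λ k → 1 ≤ k × suc k + d ≡ n′ × IndepExists n′ k
  into-𝔾 d n′≤ no-indep s e s<r lt k₀ =
    let (F , ind) = Families.indep-shorten ℂ.group s<r (ℂ.units 2≤n) (ℂ.units-indep 2≤n) in
    Limit.transferred ℂ.group 𝔾 _≟ᵍ_ n′ 0<n′ exponent N E index CG d n′≤ no-indep (suc (suc s)) n
      (IndependentFamilies.MinusSum.minus-sum ℂ.group ℂ._≟ᶜ_ n ℂ.0<n ℂ.exponent n 2≤n s F ind d e) lt
      λ (k , 1≤k , e′ , _ , ind′) → k₀ (k , 1≤k , e′ , ind′)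

  -- An element of order `n′` and its inverse realise the difference `n′ - 2`. In C_n^r a difference
  -- this large needs a light atom of weight `n - (n′ - 2)`, which must be at least 2.
  exponent≤n : n′ ≤ n
  exponent≤n = ≮⇒≥ λ n<n′ → let (d , 2+d≡n′) = m≤n⇒∃[o]m+o≡n (≤-trans 2≤n (<⇒≤ n<n′)) in impossible n<n′ d 2+d≡n′
    where
    impossible : n < n′ → ∀ d → 2 + d ≡ n′ → ⊥
    impossible n<n′ d 2+d≡n′ = into-ℂ d r≤d n≤ 2 n′ lengths (≤-trans 3≤n (<⇒≤ n<n′))
        λ (k , 1≤k , e , _) → <⇒≱ n<n′ (≤-trans (≤-reflexive (sym 2+d≡n′)) (≤-trans (+-monoˡ-≤ d (s≤s 1≤k)) (≤-reflexive e)))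
      where
      lengths : HasLengths d 2 n′
      lengths = IndependentFamilies.MinusSum.minus-sum 𝔾 _≟ᵍ_ n′ 0<n′ exponent n′ (≤-trans 2≤n (<⇒≤ n<n′)) 0 (g₀ ∷ []) indep-g₀ d 2+d≡n′
      n≤1+d : n ≤ suc d
      n≤1+d = s≤s⁻¹ (≤-trans n<n′ (≤-reflexive (sym 2+d≡n′)))
      r≤d : r ≤ d
      r≤d = s≤s⁻¹ (≤-trans r<n n≤1+d)
      n≤ : n ≤ suc (2 * d)
      n≤ = ≤-trans n≤1+d (s≤s (m≤n*m d 2))

  -- The sum of the `d + 1` elements is adjoined as in `PlusSum`, which keeps the difference `d`;
  -- the resulting elasticity is then compared with that of C_n^r.
  independent-bound : ∀ d → 1 ≤ d → r ≤ d → n ≤ suc (2 * d) → ∀ P → 2 ≤ P → IndepExists P (suc d) →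
    ¬ ¬ ∃ λ k → 1 ≤ k × suc k + d ≡ n × (1 + pred P * suc d) * suc k ≤ P * n × Families.IndepExists ℂ.group n k
  independent-bound d 1≤d r≤d n≤ P 2≤P (F , ind) =
    into-ℂ d r≤d n≤ P (1 + pred P * suc d) (IndependentFamilies.PlusSum.plus-sum 𝔾 _≟ᵍ_ n′ 0<n′ exponent P 2≤P d F ind) (lt P 2≤P)
    where
    lt : ∀ P → 2 ≤ P → P < 1 + pred P * suc d
    lt (suc zero)    (s≤s ())
    lt (suc (suc p)) 2≤P = s≤s (m<m*n (suc p) (suc d) (s≤s 1≤d))

  module LargeExponent (d : ℕ) (1+r+d≡n : suc r + d ≡ n) (r≤d : r ≤ d)
    (no-indep : ∀ P → 2 ≤ P → ¬ IndepExists P (suc d)) where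

    private
      1≤d : 1 ≤ d
      1≤d = ≤-trans 1≤r r≤d

      exponent≡n : n′ ≡ n
      exponent≡n = decidable-stable (n′ ≟ n) λ n′≢n → let (d₂ , 2+d₂≡n) = m≤n⇒∃[o]m+o≡n 2≤n in go d₂ 2+d₂≡n n′≢n
        where
        go : ∀ d₂ → 2 + d₂ ≡ n → n′ ≢ n → ⊥
        go d₂ 2+d₂≡n n′≢n = into-𝔾 d₂ n′≤ no-indep₂ 0 2+d₂≡n 1≤r 3≤n
            λ (k , 1≤k , e , _) → n′≢n (≤-antisym exponent≤n (≤-trans (≤-reflexive (sym 2+d₂≡n)) (≤-trans (+-monoˡ-≤ d₂ (s≤s 1≤k)) (≤-reflexive e))))
          where
          d≤d₂ : d ≤ d₂
          d≤d₂ = +-cancelˡ-≤ 2 d d₂ (≤-trans (+-monoˡ-≤ d (s≤s 1≤r)) (≤-reflexive (trans 1+r+d≡n (sym 2+d₂≡n))))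
          n′≤ : n′ ≤ suc (2 * d₂)
          n′≤ = ≤-trans exponent≤n (≤-trans (≤-reflexive (sym 2+d₂≡n)) (s≤s (≤-trans (+-monoˡ-≤ d₂ (≤-trans 1≤d d≤d₂)) (+-monoʳ-≤ d₂ (m≤m+n d₂ 0)))))
          no-indep₂ : ∀ P → 2 ≤ P → ¬ IndepExists P (suc d₂)
          no-indep₂ P 2≤P (F , ind) = no-indep P 2≤P (indep-shorten (s≤s d≤d₂) F ind)

    homocyclic-subgroup : ¬ ¬ IndepExists n r
    homocyclic-subgroup k₀ with m≤n⇒∃[o]m+o≡n 1≤r
    ... | s , refl = into-𝔾 d n′≤ no-indep s 1+r+d≡n ≤-refl
            (≤-trans (≤-reflexive (+-comm 1 (suc (suc s)))) (≤-trans (+-monoʳ-≤ (suc (suc s)) 1≤d) (≤-reflexive 1+r+d≡n)))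
            λ (k , _ , e , ind) → k₀ (subst₂ IndepExists exponent≡n
              (suc-injective (+-cancelʳ-≡ d (suc k) (suc r) (trans e (trans exponent≡n (sym 1+r+d≡n))))) ind)
      where
      n′≤ : n′ ≤ suc (2 * d)
      n′≤ = ≤-trans exponent≤n (≤-trans (≤-reflexive (sym 1+r+d≡n)) (s≤s (≤-trans (+-monoˡ-≤ d r≤d) (+-monoʳ-≤ d (m≤m+n d 0)))))

  -- elasticity of the sets of lengths with difference n - r - 1: at most n / (r + 1) in Cₙʳ
  no-indep-rank≥2 : 2 ≤ r → ∀ d → suc r + d ≡ n → r ≤ d → ∀ P → 2 ≤ P → ¬ IndepExists P (suc d)
  no-indep-rank≥2 2≤r d e r≤d P 2≤P ind = independent-bound d (≤-trans 1≤r r≤d) r≤d n≤ P 2≤P ind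
      λ (k , _ , e′ , le , _) → elastic r d P n k 2≤r r≤d 2≤P e (suc-injective (+-cancelʳ-≡ d (suc k) (suc r) (trans e′ (sym e)))) le
    where
    n≤ : n ≤ suc (2 * d)
    n≤ = ≤-trans (≤-reflexive (sym e)) (s≤s (≤-trans (+-monoˡ-≤ d r≤d) (+-monoʳ-≤ d (m≤m+n d 0))))
    elastic : ∀ r d P n k → 2 ≤ r → r ≤ d → 2 ≤ P → suc r + d ≡ n → k ≡ r → ¬ (1 + pred P * suc d) * suc k ≤ P * n
    elastic (suc zero)    _       _             n k (s≤s ()) _ _ _ _ _
    elastic (suc (suc r)) (suc d) (suc zero)    n k _ _ (s≤s ()) _ _ _
    elastic (suc (suc r)) (suc d) (suc (suc p)) n k _ _ _ refl refl le = <⇒≱ (s≤s (m≤m+n _ (d + 2 * p + 2 * (p * d) + r * (1 + d + p + p * d))))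
        (≤-trans (≤-reflexive (sym (sh r d p))) le)
      where
      -- After `r`, `d` and `P` are shifted by their lower bounds 2, 1 and 2, the difference of the
      -- two sides has nonnegative coefficients and constant term 1.
      sh : ∀ r d p → (1 + suc p * suc (suc d)) * suc (suc (suc r)) ≡
        suc (suc (suc p) * (suc (suc (suc r)) + suc d) + (d + 2 * p + 2 * (p * d) + r * (1 + d + p + p * d)))
      sh = solve-∀

  -- With difference `n - 2` the case `P = 2` just meets the elasticity bound, so one element is
  -- dropped and the difference `n - 3` is used. In C_n this would force two independent elements of
  -- order `n`. The weight argument needs `n ≤ 2 (n - 3) + 1`, which is `n ≥ 5`.
  no-indep-cyclic : r ≡ 1 → 5 ≤ n → ∀ d → suc r + d ≡ n → ∀ P → 2 ≤ P → ¬ IndepExists P (suc d)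
  no-indep-cyclic refl 5≤n (suc d) e P 2≤P (F , ind) = independent-bound d (≤-trans (s≤s z≤n) 2≤d) (≤-trans (s≤s z≤n) 2≤d) n≤ P 2≤P (indep-tail′ F ind)
      λ (k , _ , e′ , _ , (F′ , ind′)) → <⇒≱ (n<1+n 1) (subst (_≤ 1) (suc-injective (+-cancelʳ-≡ d (suc k) 3 (trans e′ (trans (sym e) (+-suc 2 d))))) (ℂ.indep-rank 2≤n F′ ind′))
    where
    2≤d : 2 ≤ d
    2≤d = +-cancelˡ-≤ 3 2 d (≤-trans 5≤n (≤-reflexive (trans (sym e) (+-suc 2 d))))
    n≤ : n ≤ suc (2 * d)
    n≤ = ≤-trans (≤-reflexive (trans (sym e) (+-suc 2 d))) (s≤s (≤-trans (+-monoˡ-≤ d 2≤d) (+-monoʳ-≤ d (m≤m+n d 0))))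
    indep-tail′ : ∀ {k} (F : Vec C (suc k)) → Indep P F → IndepExists P k
    indep-tail′ (_ ∷ F) ind = F , indep-tail ind
  no-indep-cyclic refl 5≤n zero e P 2≤P _ = <⇒≱ (s≤s (s≤s (s≤s z≤n))) (≤-trans 5≤n (≤-reflexive (sym e)))

  -- At difference 2 the group C_4^r admits elasticity at most 2, while three independent elements
  -- of order `P` give `(3 P - 2) / P`, which exceeds 2 from `P = 3` on.
  exceptional-order : n ≡ 4 → r ≤ 2 → ∀ P → 2 ≤ P → IndepExists P 3 → ¬ ¬ P ≡ 2
  exceptional-order refl r≤2 P 2≤P ind P≢2 = independent-bound 2 (s≤s z≤n) r≤2 (s≤s (s≤s (s≤s (s≤s z≤n)))) P 2≤P ind
    λ (k , _ , e , le , _) → bound P 2≤P P≢2 (subst (λ k → (1 + pred P * 3) * suc k ≤ P * 4) (suc-injective (+-cancelʳ-≡ 2 (suc k) 2 e)) le)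
    where
    bound : ∀ P → 2 ≤ P → P ≢ 2 → ¬ (1 + pred P * 3) * 2 ≤ P * 4
    bound (suc zero)          (s≤s ()) P≢2 le
    bound (suc (suc zero))    _ P≢2 le = P≢2 refl
    bound (suc (suc (suc p))) _ P≢2 le = <⇒≱ (s≤s (m≤m+n _ (1 + 2 * p))) (≤-trans (≤-reflexive (sym (sh p))) le)
      where
      sh : ∀ p → (1 + suc (suc p) * 3) * 2 ≡ suc (suc (suc (suc p)) * 4 + (1 + 2 * p))
      sh = solve-∀

cyclic-four : ∀ {c ℓ} (𝔾 : AbelianGroup c ℓ) → AbelianGroup.rawMonoid 𝔾 ⊆ℒ Cⁿʳ 4 1 →
  ∀ (F : Vec (AbelianGroup.Carrier 𝔾) 3) → ¬ Families.Indep 𝔾 2 F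
cyclic-four 𝔾 GC F ind = CyclicFour.lengths-3-5-6 (to 3 X.lengths-3) (to 5 X.lengths-5) (to 6 X.lengths-6)
  where
  module X = SixPoints 𝔾 F ind
  module ℂ = Homocyclic 4 1
  module T = Transfer 𝔾 ℂ.group ℂ._≟ᶜ_ 4 ℂ.0<n ℂ.exponent 4 CyclicFour.classes CyclicFour.index GC
  image = T.same-lengths X.six (2 · 𝟙) (Families.fact-zs 𝔾 X.six X.lengths-3)
  to : ∀ k → Families.Fact 𝔾 X.six (2 · 𝟙) k → Families.Fact ℂ.group CyclicFour.classes (proj₁ image) k
  to k = Equivalence.to (proj₂ image k)

-- Cases for the parameters and the homocyclic subgroup

-- `rank≥2` records `r ≤ n - r - 1`, so that the difference `n - r - 1` is within reach of the
-- weight and elasticity arguments. It covers `r = 2` from `n = 5` on, and larger `r` by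
-- `6 r ≤ n + 2`.
data Parameters : ℕ → ℕ → Set where
  rank≥2     : ∀ {n r} → 2 ≤ r → suc (2 * r) ≤ n → Parameters n r
  cyclic≥5   : ∀ {n} → 5 ≤ n → Parameters n 1
  cyclic-4   : Parameters 4 1
  rank-2-exponent-3 : Parameters 3 2
  rank-2-exponent-4 : Parameters 4 2

parameters : ∀ n r → 2 ≤ n → 1 ≤ r → ¬ (n ≡ 2 × r ≡ 1) → ¬ (n ≡ 2 × r ≡ 2) → ¬ (n ≡ 3 × r ≡ 1) →
  (r ≤ 2 ⊎ 6 * r ≤ n + 2) → Parameters n r
parameters n zero 2≤n () _ _ _ _
parameters 0 (suc zero) () _ _ _ _ _
parameters 1 (suc zero) (s≤s ()) _ _ _ _ _
parameters 2 (suc zero) _ _ ≢21 _ _ _ = ⊥-elim (≢21 (refl , refl))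
parameters 3 (suc zero) _ _ _ _ ≢31 _ = ⊥-elim (≢31 (refl , refl))
parameters 4 (suc zero) _ _ _ _ _ _ = cyclic-4
parameters (suc (suc (suc (suc (suc n))))) (suc zero) _ _ _ _ _ _ = cyclic≥5 (s≤s (s≤s (s≤s (s≤s (s≤s z≤n)))))
parameters 0 (suc (suc zero)) () _ _ _ _ _
parameters 1 (suc (suc zero)) (s≤s ()) _ _ _ _ _
parameters 2 (suc (suc zero)) _ _ _ ≢22 _ _ = ⊥-elim (≢22 (refl , refl))
parameters 3 (suc (suc zero)) _ _ _ _ _ _ = rank-2-exponent-3
parameters 4 (suc (suc zero)) _ _ _ _ _ _ = rank-2-exponent-4
parameters (suc (suc (suc (suc (suc n))))) (suc (suc zero)) _ _ _ _ _ _ = rank≥2 ≤-refl (s≤s (s≤s (s≤s (s≤s (s≤s z≤n)))))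
parameters n r@(suc (suc (suc r′))) _ _ _ _ _ (inj₁ (s≤s (s≤s ())))
parameters n r@(suc (suc (suc r′))) _ _ _ _ _ (inj₂ 6r≤n+2) = rank≥2 (s≤s (s≤s z≤n)) (+-cancelʳ-≤ 2 (suc (2 * r)) n
  (≤-trans (≤-trans (m≤m+n (suc (2 * r) + 2) (9 + 4 * r′)) (≤-reflexive (sh r′))) 6r≤n+2))
  where
  sh : ∀ r → suc (2 * suc (suc (suc r))) + 2 + (9 + 4 * r) ≡ 6 * suc (suc (suc r))
  sh = solve-∀

parameters-bounds : ∀ {n r} → Parameters n r → 3 ≤ n × 1 ≤ r × r < n
parameters-bounds (rank≥2 {n} {r} 2≤r le) = ≤-trans (s≤s (≤-trans 2≤r (m≤n*m r 2))) le , ≤-trans (s≤s z≤n) 2≤r , ≤-trans (s≤s (m≤n*m r 2)) le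
parameters-bounds (cyclic≥5 5≤n) = ≤-trans (s≤s (s≤s (s≤s z≤n))) 5≤n , s≤s z≤n , ≤-trans (s≤s (s≤s z≤n)) 5≤n
parameters-bounds cyclic-4 = s≤s (s≤s (s≤s z≤n)) , s≤s z≤n , s≤s (s≤s z≤n)
parameters-bounds rank-2-exponent-3 = s≤s (s≤s (s≤s z≤n)) , s≤s z≤n , s≤s (s≤s (s≤s z≤n))
parameters-bounds rank-2-exponent-4 = s≤s (s≤s (s≤s z≤n)) , s≤s z≤n , s≤s (s≤s (s≤s z≤n))

module _ {c ℓ : Level} {n r : ℕ} .{{_ : NonZero n}} (ps : Parameters n r) (𝔾 : AbelianGroup c ℓ)
  (_≟ᵍ_ : ∀ x y → Dec (AbelianGroup._≈_ 𝔾 x y))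
  (N : ℕ) (E : Vec (AbelianGroup.Carrier 𝔾) N) (index : ∀ g → ∃ λ i → AbelianGroup._≈_ 𝔾 g (lookup E i))
  (zsf : ZeroSumFree.HasZsf 𝔾 (r * pred n))
  (GC : AbelianGroup.rawMonoid 𝔾 ⊆ℒ Cⁿʳ n r) (CG : Cⁿʳ n r ⊆ℒ AbelianGroup.rawMonoid 𝔾) where
  open Families 𝔾

  private
    subgroup : ∀ {n r} .{{_ : NonZero n}} → Parameters n r → (ZeroSumFree.HasZsf 𝔾 (r * pred n)) →
      AbelianGroup.rawMonoid 𝔾 ⊆ℒ Cⁿʳ n r → Cⁿʳ n r ⊆ℒ AbelianGroup.rawMonoid 𝔾 →
      ∀ n′ → 0 < n′ → (∀ g → n′ ⊗ g ≈ ε) → ∀ g₀ → Indep n′ (g₀ ∷ []) → ¬ ¬ IndepExists n r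
    subgroup {n} {r} ps@(rank≥2 2≤r le) zsf GC CG n′ 0<n′ exponent g₀ ind₀ =
      let (d , 1+2r+d≡n) = m≤n⇒∃[o]m+o≡n le
          e = trans (sh r d) 1+2r+d≡n
          (3≤n , 1≤r , r<n) = parameters-bounds ps
          no-indep = Characterization.no-indep-rank≥2 n r 3≤n 1≤r r<n 𝔾 _≟ᵍ_ N E index n′ 0<n′ exponent g₀ ind₀ GC CG 2≤r (r + d) e (m≤m+n r d)
      in Characterization.LargeExponent.homocyclic-subgroup n r 3≤n 1≤r r<n 𝔾 _≟ᵍ_ N E index n′ 0<n′ exponent g₀ ind₀ GC CG (r + d) e (m≤m+n r d) no-indep
      where
      sh : ∀ r d → suc r + (r + d) ≡ suc (2 * r) + d
      sh = solve-∀
    subgroup {n} ps@(cyclic≥5 5≤n) zsf GC CG n′ 0<n′ exponent g₀ ind₀ =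
      let (d , 2+d≡n) = m≤n⇒∃[o]m+o≡n (≤-trans (s≤s (s≤s z≤n)) 5≤n)
          (3≤n , 1≤r , r<n) = parameters-bounds ps
          1≤d = +-cancelˡ-≤ 2 1 d (≤-trans 3≤n (≤-reflexive (sym 2+d≡n)))
          no-indep = Characterization.no-indep-cyclic n 1 3≤n 1≤r r<n 𝔾 _≟ᵍ_ N E index n′ 0<n′ exponent g₀ ind₀ GC CG refl 5≤n d 2+d≡n
      in Characterization.LargeExponent.homocyclic-subgroup n 1 3≤n 1≤r r<n 𝔾 _≟ᵍ_ N E index n′ 0<n′ exponent g₀ ind₀ GC CG d 2+d≡n 1≤d no-indep
    subgroup ps@cyclic-4 zsf GC CG n′ 0<n′ exponent g₀ ind₀ =
      let (3≤n , 1≤r , r<n) = parameters-bounds ps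
          order = Characterization.exceptional-order 4 1 3≤n 1≤r r<n 𝔾 _≟ᵍ_ N E index n′ 0<n′ exponent g₀ ind₀ GC CG refl (s≤s z≤n)
      in Characterization.LargeExponent.homocyclic-subgroup 4 1 3≤n 1≤r r<n 𝔾 _≟ᵍ_ N E index n′ 0<n′ exponent g₀ ind₀ GC CG 2 refl (s≤s z≤n)
           λ P 2≤P (F , ind) → order P 2≤P (F , ind) λ { refl → cyclic-four 𝔾 GC F ind }
    -- Here `n - r - 1 = 0`. Difference 2 still excludes three independent elements, and each
    -- exponent up to 3 is examined with a zero-sum free sequence of length 4.
    subgroup ps@rank-2-exponent-3 zsf GC CG n′ 0<n′ exponent g₀ ind₀ k₀ =
      let (3≤n , 1≤r , r<n) = parameters-bounds ps in
      go n′ 0<n′ (Characterization.exponent≤n 3 2 3≤n 1≤r r<n 𝔾 _≟ᵍ_ N E index n′ 0<n′ exponent g₀ ind₀ GC CG) exponent ind₀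
        λ P 2≤P ind → Characterization.independent-bound 3 2 3≤n 1≤r r<n 𝔾 _≟ᵍ_ N E index n′ 0<n′ exponent g₀ ind₀ GC CG
          2 (s≤s z≤n) ≤-refl (s≤s (s≤s (s≤s z≤n))) P 2≤P ind
          λ (k , 1≤k , e , _) → <⇒≱ (s≤s (≤-trans 1≤k (≤-reflexive (suc-injective (+-cancelʳ-≡ 2 (suc k) 1 e))))) (s≤s z≤n)
      where
      open SmallExponent 𝔾 _≟ᵍ_
      go : ∀ n′ → 0 < n′ → n′ ≤ 3 → (∀ g → n′ ⊗ g ≈ ε) → Indep n′ (g₀ ∷ []) → (∀ P → 2 ≤ P → ¬ IndepExists P 3) → ⊥
      go 1 _ _ exponent ind₀ none = no-zsf exponent zsf
      go 2 _ _ exponent ind₀ none = none 2 ≤-refl (indep-shorten (n≤1+n 3) (proj₁ zsf) (zsf⇒indep-2 (proj₁ zsf) (λ i → exponent _) (proj₂ zsf)))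
      go 3 _ _ exponent ind₀ none = k₀ (indep-3 exponent g₀ ind₀ zsf)
      go (suc (suc (suc (suc _)))) _ (s≤s (s≤s (s≤s ()))) exponent ind₀ none
    -- The difference `n - r - 1 = 1` violates `n ≤ 2 d + 1`. Difference 3 excludes four independent
    -- elements, and difference 2 restricts three of them to order 2. Exponents below 4 are refuted;
    -- for exponent 4, a zero-sum free sequence of length 6 forces an element whose double is
    -- neither 0 nor `2 g₀`.
    subgroup ps@rank-2-exponent-4 zsf GC CG n′ 0<n′ exponent g₀ ind₀ k₀ =
      let (3≤n , 1≤r , r<n) = parameters-bounds ps in
      go n′ 0<n′ (Characterization.exponent≤n 4 2 3≤n 1≤r r<n 𝔾 _≟ᵍ_ N E index n′ 0<n′ exponent g₀ ind₀ GC CG) exponent ind₀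
        (λ P 2≤P ind → Characterization.independent-bound 4 2 3≤n 1≤r r<n 𝔾 _≟ᵍ_ N E index n′ 0<n′ exponent g₀ ind₀ GC CG
          3 (s≤s z≤n) (n≤1+n 2) (s≤s (s≤s (s≤s (s≤s z≤n)))) P 2≤P ind
          λ (k , 1≤k , e , _) → <⇒≱ (s≤s (≤-trans 1≤k (≤-reflexive (suc-injective (+-cancelʳ-≡ 3 (suc k) 1 e))))) (s≤s z≤n))
        (Characterization.exceptional-order 4 2 3≤n 1≤r r<n 𝔾 _≟ᵍ_ N E index n′ 0<n′ exponent g₀ ind₀ GC CG refl ≤-refl)
      where
      open SmallExponent 𝔾 _≟ᵍ_
      go : ∀ n′ → 0 < n′ → n′ ≤ 4 → (∀ g → n′ ⊗ g ≈ ε) → Indep n′ (g₀ ∷ []) →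
        (∀ P → 2 ≤ P → ¬ IndepExists P 4) → (∀ P → 2 ≤ P → IndepExists P 3 → ¬ ¬ P ≡ 2) → ⊥
      go 1 _ _ exponent ind₀ none order = no-zsf exponent zsf
      go 2 _ _ exponent ind₀ none order = none 2 ≤-refl (indep-shorten (s≤s (s≤s (s≤s (s≤s z≤n)))) (proj₁ zsf) (zsf⇒indep-2 (proj₁ zsf) (λ i → exponent _) (proj₂ zsf)))
      go 3 0<3 _ exponent ind₀ none order = Characterization.into-𝔾 4 2 (s≤s (s≤s (s≤s z≤n))) (s≤s z≤n) (s≤s (s≤s (s≤s z≤n))) 𝔾 _≟ᵍ_ N E index
          3 0<3 exponent g₀ ind₀ GC CG 2 (s≤s (s≤s (s≤s z≤n))) (λ P 2≤P (F , ind) → order P 2≤P (F , ind) λ { refl → clash F ind })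
          0 refl (s≤s z≤n) (s≤s (s≤s (s≤s z≤n)))
          λ (k , 1≤k , e , _) → <⇒≱ (s≤s (≤-trans 1≤k (≤-reflexive (suc-injective (+-cancelʳ-≡ 2 (suc k) 1 e))))) (s≤s z≤n)
        where
        clash : ∀ (F : Vec C 3) → Indep 2 F → ⊥
        clash F (_ , ind) = toWitness {a? = ¬? (2 ∣? 3)} _ (ind (single zero 3) (≈-trans (eval-single F zero 3) (exponent _)) zero)
      go 4 _ _ exponent ind₀ none order with FinP.any? (λ i → ¬? ((2 ⊗ lookup E i) ≟ᵍ ε) ×-dec ¬? ((2 ⊗ lookup E i) ≟ᵍ (2 ⊗ g₀)))
      ... | yes (i , ≉ε , ≉t) = k₀ (lookup E i ∷ g₀ ∷ [] , indep-4 exponent g₀ ind₀ (lookup E i) ≉ε ≉t)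
      ... | no all-double = no-zsf-6 (2 ⊗ g₀) (≈-trans (×-assocˡ g₀ 2 2) (exponent g₀)) t≉ε doubles (none 2 ≤-refl) zsf
        where
        t≉ε : ¬ 2 ⊗ g₀ ≈ ε
        t≉ε e = <⇒≱ (s≤s (s≤s (s≤s z≤n))) (∣⇒≤ (proj₂ ind₀ (2 ∷ []) (≈-trans (identityʳ _) e) zero))
        doubles : ∀ x → 2 ⊗ x ≈ ε ⊎ 2 ⊗ x ≈ 2 ⊗ g₀
        doubles x with index x | (2 ⊗ x) ≟ᵍ ε | (2 ⊗ x) ≟ᵍ (2 ⊗ g₀)
        ... | _ | yes p | _ = inj₁ p
        ... | _ | _ | yes q = inj₂ q
        ... | i , e | no p | no q = ⊥-elim (all-double (i , (λ z → p (≈-trans (×-congʳ 2 e) z)) , λ z → q (≈-trans (×-congʳ 2 e) z)))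
      go (suc (suc (suc (suc (suc _))))) _ (s≤s (s≤s (s≤s (s≤s ())))) exponent ind₀ none order

  -- Exhaustive search over `E` removes the double negation left by the transfer.
  independent-subset : IndepExists n r
  independent-subset = decidable-stable (Finite.has-indep? 𝔾 _≟ᵍ_ N E index n (>-nonZero⁻¹ n) r)
    (let (n′ , 0<n′ , exponent , g₀ , ind₀) = Finite.exponent 𝔾 _≟ᵍ_ N E index in subgroup ps zsf GC CG n′ 0<n′ exponent g₀ ind₀)

-- The Davenport constant and the conclusion

maximal-zsf : ∀ n r .{{_ : NonZero n}} → ∃ λ δ → ZeroSumFree.HasZsf (Homocyclic.group n r) δ × ¬ ZeroSumFree.HasZsf (Homocyclic.group n r) (suc δ)
maximal-zsf n r = go (least (λ k → ¬? (F.has-zsf? k)) (n ^ r) (λ h → <-irrefl refl (F.zsf-bound h)))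
  where
  module ℂ = Homocyclic n r
  module F = Finite ℂ.group ℂ._≟ᶜ_ (n ^ r) ℂ.elements ℂ.index
  HasZsf = ZeroSumFree.HasZsf ℂ.group
  go : (∃ λ m → ¬ HasZsf m × m ≤ n ^ r × (∀ k → k < m → ¬ ¬ HasZsf k)) → ∃ λ δ → HasZsf δ × ¬ HasZsf (suc δ)
  go (zero  , ¬zsf , _ , _)   = ⊥-elim (¬zsf ([] , λ { [] _ _ → refl }))
  go (suc δ , ¬zsf , _ , min) = δ , decidable-stable (F.has-zsf? δ) (min δ ≤-refl) , ¬zsf

theorem1p1 : ∀ {c ℓ} (n r : ℕ) .{{_ : NonZero n}} →
    2 ≤ n → 1 ≤ r →
    ¬ (n ≡ 2 × r ≡ 1) → ¬ (n ≡ 2 × r ≡ 2) → ¬ (n ≡ 3 × r ≡ 1) →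
    (r ≤ 2 ⊎ 6 * r ≤ n + 2) →
    (G : AbelianGroup c ℓ) →
    AbelianGroup.rawMonoid G ≡ℒ Cⁿʳ n r →
    ∃[ f ] MonoidMorphisms.IsMonoidIsomorphism (AbelianGroup.rawMonoid G) (Cⁿʳ n r) f
theorem1p1 n r 2≤n 1≤r ≢21 ≢22 ≢31 bound G (GC , CG) =
  let (δ , zsf , no-longer) = maximal-zsf n r
      ps = parameters n r 2≤n 1≤r ≢21 ≢22 ≢31 bound
      (3≤n , _ , _) = parameters-bounds ps
      r[n-1]≤δ = ≮⇒≥ λ lt → no-longer (zsf-shorten ℂ.group lt (indep⇒zsf ℂ.group ℂ.0<n (ℂ.units 2≤n) (ℂ.units-indep 2≤n)))
      -- Lengths of atoms are transferred only from 3 on, so `δ + 1`, the Davenport constant of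
      -- C_n^r, has to be at least 3.
      2≤δ = ≤-trans (≤-trans (<⇒≤pred 3≤n) (m≤n*m (pred n) r {{>-nonZero 1≤r}})) r[n-1]≤δ
      _≟ᵍ_ = decidable-equality G ℂ.group ℂ._≟ᶜ_ GC
      zsfᴳ = ZeroSumFree.long-atom⇒zsf G (long-atom-transfer ℂ.group G CG (s≤s 2≤δ) (ZeroSumFree.zsf⇒long-atom ℂ.group zsf))
      no-longerᴳ = λ z → no-longer (ZeroSumFree.long-atom⇒zsf ℂ.group
        (long-atom-transfer G ℂ.group GC (s≤s (m≤n⇒m≤1+n 2≤δ)) (ZeroSumFree.zsf⇒long-atom G z)))
      (N , E , index) = enumerate G _≟ᵍ_ δ zsfᴳ no-longerᴳ
      (F , indep) = independent-subset ps G _≟ᵍ_ N E index (zsf-shorten G r[n-1]≤δ zsfᴳ) GC CG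
  in Isomorphism.isomorphism n r G _≟ᵍ_ F indep δ zsf no-longerᴳ
  where module ℂ = Homocyclic n r
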